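{- For every index $\boldsymbol{k}$, we have $\zeta^{\star,\mathrm{sh}}(\boldsymbol{k})\equiv \zeta^{\star,KY}(\boldsymbol{k}) \pmod{\zeta(2)\mathcal{Z}}$.
   Context: An index is a tuple $\boldsymbol{k}=(k_1,\dots,k_r)$ of positive integers ($r\ge 0$; $r=0$ gives the empty index $\varnothing$). It is admissible if it is empty or $k_r\ge 2$. For admissible $\boldsymbol{k}$, $\zeta(k_1,\dots,k_r)=\sum_{1\le n_1<\cdots<n_r}\frac{1}{n_1^{k_1}\cdots n_r^{k_r}}$, $\zeta(\varnothing)=1$. $\mathcal{Z}\subset\mathbb{R}$ is the $\mathbb{Q}$-linear span of $1$ and all multiple zeta values; it is a $\mathbb{Q}$-algebra. Let $\mathfrak{H}=\mathbb{Q}\langle x,y\rangle$, $\mathfrak{H}^1=\mathbb{Q}+y\mathfrak{H}\supset\mathfrak{H}^0=\mathbb{Q}+y\mathfrak{H}x$, $z_k=yx^{k-1}$, $z_{\boldsymbol{k}}=z_{k_1}\cdots z_{k_r}$. Let $Z:\mathfrak{H}^0\to\mathbb{R}$ be the $\mathbb{Q}$-linear map with $Z(z_{\boldsymbol{k}})=\zeta(\boldsymbol{k})$ for admissible $\boldsymbol{k}$ (so $Z(1)=1$). The shuffle product $\mathrm{sh}$ on $\mathfrak{H}$ is the $\mathbb{Q}$-bilinear product with $w\,\mathrm{sh}\,1=1\,\mathrm{sh}\,w=w$ and $w_1u_1\,\mathrm{sh}\,w_2u_2=(w_1\,\mathrm{sh}\,w_2u_2)u_1+(w_1u_1\,\mathrm{sh}\,w_2)u_2$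 for $u_1,u_2\in\{x,y\}$. Then $Z$ is a homomorphism for $\mathrm{sh}$ on $\mathfrak{H}^0$, $(\mathfrak{H}^1,\mathrm{sh})\cong(\mathfrak{H}^0,\mathrm{sh})[y]$, and $Z^{\mathrm{sh}}:(\mathfrak{H}^1,\mathrm{sh})\to\mathbb{R}[T]$, $w\mapsto Z^{\mathrm{sh}}(w;T)$, is the unique $\mathbb{Q}$-algebra homomorphism extending $Z$ with $Z^{\mathrm{sh}}(y;T)=T$; its image lies in $\mathcal{Z}[T]$. Put $\zeta^{\mathrm{sh}}(\boldsymbol{k})=Z^{\mathrm{sh}}(z_{\boldsymbol{k}};0)$ and $$\zeta^{\star,\mathrm{sh}}(k_1,\dots,k_r)=\sum_{\square=\text{`,' or `+'}}\zeta^{\mathrm{sh}}(k_1\square\cdots\square k_r),$$ the sum being over all $2^{r-1}$ ways to replace each $\square$ by a comma or a plus sign (and $\zeta^{\star,\mathrm{sh}}(\varnothing)=1$). Kaneko–Yamamoto regularization: a 2-poset is a finite poset $X$ with a label map $\delta_X:X\to\{x,y\}$. Put $W(X)=\sum_f \delta_X(f^{ -1}(1))\cdots\delta_X(f^{ -1}(\#X))\in\mathfrak{H}$, summed over all bijections $f:X\to\{1,\dots,\#X\}$ such that $p<q$ implies $f(p)<f(q)$ ($W(\varnothing)=1$). For $\boldsymbol{k}=(k_1,\dots,k_r)$, let $X^\star(\boldsymbol{k})$ be the 2-poset with elements $p_{i,m}$ ($1\le i\le r$, $1\le m\le k_i$), with order generated by $p_{i,1}<p_{i,2}<\cdots<p_{i,k_i}$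 for each $i$ and $p_{i,1}<p_{i+1,k_{i+1}}$ for $1\le i\le r-1$, and with $p_{i,1}$ labelled $y$ and $p_{i,m}$ ($m\ge2$) labelled $x$. Put $w^\star(\boldsymbol{k})=W(X^\star(\boldsymbol{k}))\in\mathfrak{H}^1$ and $\zeta^{\star,KY}(\boldsymbol{k})=Z^{\mathrm{sh}}(w^\star(\boldsymbol{k});0)\in\mathcal{Z}$. -}

module Defs where

open import Algebra.Bundles.Raw using (RawRing)
open import Algebra.Module.Bundles.Raw using (RawLeftModule)
open import Algebra.Module.Morphism.Structures using (module LeftModuleMorphisms)
open import Algebra.Morphism.Structures using (module RingMorphisms)
open import Data.Bool.Base using (if_then_else_)
open import Data.Fin.Base as Fin using (Fin; zero; suc; toℕ)
import Data.Fin.Properties as Fin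
open import Data.Integer.Base as ℤ using (+_; +[1+_]; -[1+_])
import Data.Integer.Properties as ℤ
open import Data.List.Base using (List; []; _∷_; _++_; [_]; _∷ʳ_; foldl; foldr; map; concatMap; length; lookup; filter; allFin; cartesianProductWith)
open import Data.List.Properties using (foldl-∷ʳ)
open import Data.List.Relation.Unary.All as All using (All; []; _∷_)
import Data.List.Relation.Unary.All.Properties as All
open import Data.Nat.Base as ℕ using (ℕ; zero; suc; z≤n; s≤s)
open import Data.Nat.Induction using (<-wellFounded)
open import Data.Nat.ListAction using (sum)
import Data.Nat.Properties as ℕ
open import Data.Product.Base using (Σ; ∃; _×_; _,_; proj₁; proj₂; uncurry)
open import Data.Product.Relation.Binary.Lex.Strict using (×-Lex; ×-wellFounded)
open import Data.Rational.Base using (ℚ; mkℚ; *<*; 0ℚ; 1ℚ; ½; _+_; _*_; _-_; -_; ∣_∣; _/_; 1/_; _<_; _≤_; toℚᵘ; positive; nonNegative)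
open import Data.Rational.Properties hiding (_≟_; _<?_)
open import Data.Rational.Solver using (module +-*-Solver)
import Data.Rational.Unnormalised.Base as ℚᵘ
import Data.Rational.Unnormalised.Properties as ℚᵘ
open import Data.Sum.Base using (_⊎_; inj₁; inj₂)
open import Data.Sum.Function.Propositional using (_⊎-↔_)
open import Data.Vec.Base as Vec using (Vec; []; _∷_)
open import Function.Base using (_∘_; id)
open import Function.Bundles using (_↔_; Inverse; mk↔ₛ′)
open import Function.Construct.Composition using (_↔-∘_)
open import Function.Construct.Identity using (↔-id)
open import Function.Construct.Symmetry using (↔-sym)
open import Function.Definitions using (Injective; Surjective; Bijective)
open import Induction.WellFounded using (WellFounded; Acc; acc; module Subrelation; wf⇒asym)
open import Level using (0ℓ)
import Relation.Binary.Construct.On as On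
open import Relation.Binary.Construct.Closure.Transitive as ⁺ using (TransClosure)
open import Relation.Binary.Core using (Rel)
open import Relation.Binary.Definitions using (Decidable; DecidableEquality)
open import Relation.Binary.PropositionalEquality hiding ([_])
open import Relation.Binary.Structures using (IsDecStrictPartialOrder)
open import Relation.Nullary.Decidable as Dec using (Dec; yes; no; does; _×-dec_; _⊎-dec_; _→-dec_)
open import Relation.Nullary.Negation using (contradiction)

IsCauchy : (ℕ → ℚ) → Set
IsCauchy a = ∀ ε → 0ℚ < ε → ∃ λ N → ∀ m n → N ℕ.≤ m → N ℕ.≤ n → ∣ a m - a n ∣ < ε

record ℝ : Set where
  constructor mkℝ
  field
    approx   : ℕ → ℚ
    isCauchy : IsCauchy approx

open ℝ public

infix 4 _≈ᴿ_

record _≈ᴿ_ (x y : ℝ) : Set where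
  constructor mk≈ᴿ
  field
    converge : ∀ ε → 0ℚ < ε → ∃ λ N → ∀ n → N ℕ.≤ n → ∣ approx x n - approx y n ∣ < ε

module Cauchy where
  open +-*-Solver

  abs : ℚ → ℚ
  abs = ∣_∣

  halve : ∀ ε → 0ℚ < ε → ∃ λ δ → 0ℚ < δ × δ + δ ≡ ε
  halve ε 0<ε = ½ * ε
    , subst (_< ½ * ε) (*-zeroʳ ½) (*-monoʳ-<-pos ½ 0<ε)
    , trans (sym (*-distribʳ-+ ε ½ ½)) (*-identityˡ ε)

  divide : ∀ c ε → 0ℚ < c → 0ℚ < ε → ∃ λ δ → 0ℚ < δ × c * δ ≡ ε
  divide c ε 0<c 0<ε = c⁻¹ * ε
    , subst (_< c⁻¹ * ε) (*-zeroʳ c⁻¹) (*-monoʳ-<-pos c⁻¹ {{1/pos⇒pos c}} 0<ε)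
    , trans (sym (*-assoc c c⁻¹ ε))
        (trans (cong (_* ε) (*-inverseʳ c {{pos⇒nonZero c}})) (*-identityˡ ε))
    where
    instance
      _ = positive 0<c
    c⁻¹ = (1/ c) {{pos⇒nonZero c}}

  0<1 : 0ℚ < 1ℚ
  0<1 = positive⁻¹ 1ℚ

  0<1+ : ∀ {c} → 0ℚ ≤ c → 0ℚ < 1ℚ + c
  0<1+ 0≤c = +-mono-<-≤ 0<1 0≤c

  const-cauchy : ∀ q → IsCauchy (λ _ → q)
  const-cauchy q ε 0<ε = 0 , λ _ _ _ _ → subst (_< ε) (sym (cong abs (+-inverseʳ q))) 0<ε

  +-cauchy : ∀ {a b} → IsCauchy a → IsCauchy b → IsCauchy (λ n → a n + b n)
  +-cauchy {a} {b} ca cb ε 0<ε with halve ε 0<ε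
  ... | δ , 0<δ , refl with ca δ 0<δ | cb δ 0<δ
  ... | M , p | N , q = M ℕ.⊔ N , λ m n l l′ → begin-strict
    abs ((a m + b m) - (a n + b n))     ≡⟨ cong abs (rearrange (a m) (b m) (a n) (b n)) ⟩
    abs ((a m - a n) + (b m - b n))     ≤⟨ ∣p+q∣≤∣p∣+∣q∣ (a m - a n) (b m - b n) ⟩
    abs (a m - a n) + abs (b m - b n)
      <⟨ +-mono-< (p m n (ℕ.m⊔n≤o⇒m≤o M N l) (ℕ.m⊔n≤o⇒m≤o M N l′))
                  (q m n (ℕ.m⊔n≤o⇒n≤o M N l) (ℕ.m⊔n≤o⇒n≤o M N l′)) ⟩
    δ + δ ∎
    where
    open ≤-Reasoning
    rearrange : ∀ x y z w → (x + y) - (z + w) ≡ (x - z) + (y - w)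
    rearrange = solve 4 (λ x y z w → (x :+ y) :- (z :+ w) := (x :- z) :+ (y :- w)) refl

  neg-cauchy : ∀ {a} → IsCauchy a → IsCauchy (λ n → - a n)
  neg-cauchy {a} ca ε 0<ε with ca ε 0<ε
  ... | N , p = N , λ m n l l′ → subst (_< ε)
    (trans (sym (∣-p∣≡∣p∣ (a m - a n))) (cong abs (neg-distrib-+ (a m) (- a n)))) (p m n l l′)

  eventually-bounded : ∀ {a} → IsCauchy a → ∃ λ B → 0ℚ < B × ∃ λ N → ∀ n → N ℕ.≤ n → abs (a n) ≤ B
  eventually-bounded {a} ca with ca 1ℚ 0<1
  ... | N , p = 1ℚ + abs (a N)
    , 0<1+ (0≤∣p∣ (a N))
    , N , λ n l → begin
      abs (a n)                       ≡⟨ cong abs (rearrange (a n) (a N)) ⟩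
      abs ((a n - a N) + a N)         ≤⟨ ∣p+q∣≤∣p∣+∣q∣ (a n - a N) (a N) ⟩
      abs (a n - a N) + abs (a N)     ≤⟨ +-monoˡ-≤ (abs (a N)) (<⇒≤ (p n N l ℕ.≤-refl)) ⟩
      1ℚ + abs (a N) ∎
    where
    open ≤-Reasoning
    rearrange : ∀ x y → x ≡ (x - y) + y
    rearrange = solve 2 (λ x y → x := (x :- y) :+ y) refl

  0≤-+ : ∀ {p q} → 0ℚ ≤ p → 0ℚ ≤ q → 0ℚ ≤ p + q
  0≤-+ = +-mono-≤

  0≤-* : ∀ {p q} → 0ℚ ≤ p → 0ℚ ≤ q → 0ℚ ≤ p * q
  0≤-* {p} {q} 0≤p 0≤q = nonNegative⁻¹ (p * q)
    {{nonNeg*nonNeg⇒nonNeg p {{nonNegative 0≤p}} q {{nonNegative 0≤q}}}}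

  *-monoˡ : ∀ {p q} s → 0ℚ ≤ s → p ≤ q → s * p ≤ s * q
  *-monoˡ s 0≤s = *-monoˡ-≤-nonNeg s {{nonNegative 0≤s}}

  *-monoʳ : ∀ {p q} s → 0ℚ ≤ s → p ≤ q → p * s ≤ q * s
  *-monoʳ s 0≤s = *-monoʳ-≤-nonNeg s {{nonNegative 0≤s}}

  *-mono< : ∀ {p q} s → 0ℚ < s → p < q → s * p < s * q
  *-mono< s 0<s = *-monoʳ-<-pos s {{positive 0<s}}

  *-estimate : ∀ x y z w {A B γ δ} → 0ℚ < A → 0ℚ < B → abs x ≤ A → abs w ≤ B →
               abs (x - z) < γ → abs (y - w) < δ → abs (x * y - z * w) < A * δ + B * γ
  *-estimate x y z w {A} {B} {γ} {δ} 0<A 0<B x≤A w≤B dx dy = begin-strict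
    abs (x * y - z * w)
      ≡⟨ cong abs (rearrange x y z w) ⟩
    abs (x * (y - w) + w * (x - z))
      ≤⟨ ∣p+q∣≤∣p∣+∣q∣ (x * (y - w)) (w * (x - z)) ⟩
    abs (x * (y - w)) + abs (w * (x - z))
      ≡⟨ cong₂ _+_ (∣p*q∣≡∣p∣*∣q∣ x (y - w)) (∣p*q∣≡∣p∣*∣q∣ w (x - z)) ⟩
    abs x * abs (y - w) + abs w * abs (x - z)
      ≤⟨ +-mono-≤ (*-monoʳ (abs (y - w)) (0≤∣p∣ (y - w)) x≤A)
                  (*-monoʳ (abs (x - z)) (0≤∣p∣ (x - z)) w≤B) ⟩
    A * abs (y - w) + B * abs (x - z)
      <⟨ +-mono-< (*-mono< A 0<A dy) (*-mono< B 0<B dx) ⟩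
    A * δ + B * γ ∎
    where
    open ≤-Reasoning
    rearrange : ∀ x y z w → x * y - z * w ≡ x * (y - w) + w * (x - z)
    rearrange = solve 4 (λ x y z w → x :* y :- z :* w := x :* (y :- w) :+ w :* (x :- z)) refl

  *-cauchy : ∀ {a b} → IsCauchy a → IsCauchy b → IsCauchy (λ n → a n * b n)
  *-cauchy {a} {b} ca cb ε 0<ε =
    let A , 0<A , K , boundA = eventually-bounded {a} ca
        B , 0<B , L , boundB = eventually-bounded {b} cb
        η , 0<η , η+η≡ε = halve ε 0<ε
        δ , 0<δ , Aδ≡η = divide A η 0<A 0<η
        γ , 0<γ , Bγ≡η = divide B η 0<B 0<η
        M , p = ca γ 0<γ
        N , q = cb δ 0<δ
        KL = K ℕ.⊔ L
        MN = M ℕ.⊔ N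
    in KL ℕ.⊔ MN , λ m n l l′ →
      subst (abs (a m * b m - a n * b n) <_) (trans (cong₂ _+_ Aδ≡η Bγ≡η) η+η≡ε)
        (*-estimate (a m) (b m) (a n) (b n) 0<A 0<B
          (boundA m (ℕ.m⊔n≤o⇒m≤o K L (ℕ.m⊔n≤o⇒m≤o KL MN l)))
          (boundB n (ℕ.m⊔n≤o⇒n≤o K L (ℕ.m⊔n≤o⇒m≤o KL MN l′)))
          (p m n (ℕ.m⊔n≤o⇒m≤o M N (ℕ.m⊔n≤o⇒n≤o KL MN l)) (ℕ.m⊔n≤o⇒m≤o M N (ℕ.m⊔n≤o⇒n≤o KL MN l′)))
          (q m n (ℕ.m⊔n≤o⇒n≤o M N (ℕ.m⊔n≤o⇒n≤o KL MN l)) (ℕ.m⊔n≤o⇒n≤o M N (ℕ.m⊔n≤o⇒n≤o KL MN l′))))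

open Cauchy using (const-cauchy; +-cauchy; neg-cauchy; *-cauchy)

fromℚ : ℚ → ℝ
fromℚ q = mkℝ (λ _ → q) (const-cauchy q)

0ᴿ 1ᴿ : ℝ
0ᴿ = fromℚ 0ℚ
1ᴿ = fromℚ 1ℚ

infixl 6 _+ᴿ_ _-ᴿ_
infixl 7 _*ᴿ_
infix 8 -ᴿ_

-ᴿ_ : ℝ → ℝ
-ᴿ x = mkℝ (λ n → - approx x n) (neg-cauchy {approx x} (isCauchy x))

_+ᴿ_ _*ᴿ_ : ℝ → ℝ → ℝ
x +ᴿ y = mkℝ (λ n → approx x n + approx y n) (+-cauchy {approx x} {approx y} (isCauchy x) (isCauchy y))
x *ᴿ y = mkℝ (λ n → approx x n * approx y n) (*-cauchy {approx x} {approx y} (isCauchy x) (isCauchy y))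

_-ᴿ_ : ℝ → ℝ → ℝ
x -ᴿ y = x +ᴿ (-ᴿ y)

infix 9 1+_

record ℕ⁺ : Set where
  constructor 1+_
  field
    pred : ℕ

val : ℕ⁺ → ℕ
val (1+ j) = suc j

infixl 6 _+⁺_

_+⁺_ : ℕ⁺ → ℕ⁺ → ℕ⁺
(1+ i) +⁺ (1+ j) = 1+ (i ℕ.+ suc j)

Index : Set
Index = List ℕ⁺

data Admissible : Index → Set where
  empty  : Admissible []
  last≥2 : ∀ ks {k} → 2 ℕ.≤ val k → Admissible (ks ∷ʳ k)

1/_^_ : ∀ n .{{_ : ℕ.NonZero n}} → ℕ → ℚ
1/ n ^ k = (+ 1 / n ℕ.^ k) {{ℕ.m^n≢0 n k}}

-- step a k N = ∑_{1≤n≤N} a(n-1) / n^k, so that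
-- ζ≤ (k₁,…,kᵣ) N = ∑_{1≤n₁<⋯<nᵣ≤N} 1 / (n₁^k₁ ⋯ nᵣ^kᵣ).
step : (ℕ → ℚ) → ℕ⁺ → ℕ → ℚ
step a k zero    = 0ℚ
step a k (suc n) = step a k n + a n * (1/ suc n ^ val k)

ζ≤ : Index → ℕ → ℚ
ζ≤ = foldl step (λ _ → 1ℚ)

module PartialSums where
  open Cauchy
  open +-*-Solver

  r : ℕ → ℚ
  r n = + 1 / suc n

  /-mono : ∀ m n .{{_ : ℕ.NonZero m}} .{{_ : ℕ.NonZero n}} → m ℕ.≤ n → + 1 / n ≤ + 1 / m
  /-mono m@(suc _) n@(suc _) m≤n = toℚᵘ-cancel-≤
    (ℚᵘ.≤-respˡ-≃ (ℚᵘ.≃-sym (toℚᵘ-fromℚᵘ (+ 1 ℚᵘ./ n)))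
    (ℚᵘ.≤-respʳ-≃ (ℚᵘ.≃-sym (toℚᵘ-fromℚᵘ (+ 1 ℚᵘ./ m)))
    (ℚᵘ.*≤* (subst₂ ℤ._≤_ (sym (ℤ.*-identityˡ (+ m))) (sym (ℤ.*-identityˡ (+ n))) (ℤ.+≤+ m≤n)))))

  /-* : ∀ m n .{{_ : ℕ.NonZero m}} .{{_ : ℕ.NonZero n}} .{{_ : ℕ.NonZero (m ℕ.* n)}} →
        (+ 1 / m) * (+ 1 / n) ≡ + 1 / (m ℕ.* n)
  /-* m@(suc _) n@(suc _) = toℚᵘ-injective
    (ℚᵘ.≃-trans (toℚᵘ-homo-* (+ 1 / m) (+ 1 / n))
    (ℚᵘ.≃-trans (ℚᵘ.*-cong (toℚᵘ-fromℚᵘ (+ 1 ℚᵘ./ m)) (toℚᵘ-fromℚᵘ (+ 1 ℚᵘ./ n)))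
    (ℚᵘ.≃-sym (toℚᵘ-fromℚᵘ (+ 1 ℚᵘ./ (m ℕ.* n))))))

  1/-nonNeg : ∀ n .{{_ : ℕ.NonZero n}} → 0ℚ ≤ + 1 / n
  1/-nonNeg n = nonNegative⁻¹ (+ 1 / n) {{normalize-nonNeg 1 n}}

  1/^≤r : ∀ n k → 1/ suc n ^ val k ≤ r n
  1/^≤r n k = /-mono (suc n) (suc n ℕ.^ val k) {{_}} {{ℕ.m^n≢0 (suc n) (val k)}}
    (subst (ℕ._≤ suc n ℕ.^ val k) (ℕ.*-identityʳ (suc n))
      (ℕ.^-monoʳ-≤ (suc n) {1} {val k} (s≤s z≤n)))

  1/^≤r² : ∀ n k → 2 ℕ.≤ val k → 1/ suc n ^ val k ≤ r n * r n
  1/^≤r² n k 2≤k = subst (1/ suc n ^ val k ≤_) (sym (/-* (suc n) (suc n)))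
    (/-mono (suc n ℕ.* suc n) (suc n ℕ.^ val k) {{_}} {{ℕ.m^n≢0 (suc n) (val k)}}
      (subst (ℕ._≤ suc n ℕ.^ val k) (cong (suc n ℕ.*_) (ℕ.*-identityʳ (suc n)))
        (ℕ.^-monoʳ-≤ (suc n) 2≤k)))

  L : ℕ → ℚ
  L n = + suc n / 1

  L-suc : ∀ n → L (suc n) ≡ L n + 1ℚ
  L-suc n = toℚᵘ-injective
    (ℚᵘ.≃-trans (toℚᵘ-fromℚᵘ (+ suc (suc n) ℚᵘ./ 1)) (ℚᵘ.≃-sym
    (ℚᵘ.≃-trans (toℚᵘ-homo-+ (L n) 1ℚ)
    (ℚᵘ.≃-trans (ℚᵘ.+-cong (toℚᵘ-fromℚᵘ (+ suc n ℚᵘ./ 1)) (ℚᵘ.≃-refl {toℚᵘ 1ℚ}))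
    (ℚᵘ.*≡* (cong (λ j → + suc j ℤ.* + 1)
      (trans (ℕ.+-comm (n ℕ.* 1) 1) (cong suc (ℕ.*-identityʳ n)))))))))

  L*r : ∀ n → L n * r n ≡ 1ℚ
  L*r n = toℚᵘ-injective
    (ℚᵘ.≃-trans (toℚᵘ-homo-* (L n) (r n))
    (ℚᵘ.≃-trans (ℚᵘ.*-cong (toℚᵘ-fromℚᵘ (+ suc n ℚᵘ./ 1)) (toℚᵘ-fromℚᵘ (+ 1 ℚᵘ./ suc n)))
    (ℚᵘ.*≡* (trans (ℤ.*-identityʳ (+ suc n ℤ.* + 1)) (trans (ℤ.*-identityʳ (+ suc n))
      (sym (trans (ℤ.*-identityˡ _) (ℤ.*-identityˡ (+ suc n)))))))))

  Small : (ℕ → ℚ) → Set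
  Small a = ∀ ε → 0ℚ < ε → ∃ λ N → ∀ n → N ℕ.≤ n → a n ≤ ε

  r-small : Small r
  r-small (mkℚ +[1+ p ] q c) 0<ε = q , λ n l → ≤-trans (/-mono (suc q) (suc n) (s≤s l))
    (toℚᵘ-cancel-≤ (ℚᵘ.≤-respˡ-≃ (ℚᵘ.≃-sym (toℚᵘ-fromℚᵘ (+ 1 ℚᵘ./ suc q)))
      (ℚᵘ.*≤* (ℤ.*-monoʳ-≤-nonNeg (+ suc q) (ℤ.+≤+ (s≤s (z≤n {p})))))))
  r-small (mkℚ (+ 0) q c) (*<* (ℤ.+<+ ()))
  r-small (mkℚ -[1+ p ] q c) (*<* ())

  small-≡ : ∀ {a b} → (∀ n → a n ≡ b n) → Small b → Small a
  small-≡ a≡b sb ε 0<ε =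
    let N , p = sb ε 0<ε in N , λ n l → subst (_≤ ε) (sym (a≡b n)) (p n l)

  small-+ : ∀ {a b} → Small a → Small b → Small (λ n → a n + b n)
  small-+ {a} {b} sa sb ε 0<ε =
    let δ , 0<δ , δ+δ≡ε = halve ε 0<ε
        M , p = sa δ 0<δ
        N , q = sb δ 0<δ
    in M ℕ.⊔ N , λ n l → subst (a n + b n ≤_) δ+δ≡ε
      (+-mono-≤ (p n (ℕ.m⊔n≤o⇒m≤o M N l)) (q n (ℕ.m⊔n≤o⇒n≤o M N l)))

  small-* : ∀ c {a} → 0ℚ ≤ c → Small a → Small (λ n → c * a n)
  small-* c {a} 0≤c sa ε 0<ε =
    let δ , 0<δ , [1+c]δ≡ε = divide (1ℚ + c) ε (0<1+ 0≤c) 0<ε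
        N , p = sa δ 0<δ
    in N , λ n l → subst (c * a n ≤_) [1+c]δ≡ε (bound δ (a n) 0<δ (p n l))
    where
    open ≤-Reasoning
    bound : ∀ δ x → 0ℚ < δ → x ≤ δ → c * x ≤ (1ℚ + c) * δ
    bound δ x 0<δ x≤δ = begin
      c * x          ≤⟨ *-monoˡ c 0≤c x≤δ ⟩
      c * δ          ≡⟨ +-identityˡ (c * δ) ⟨
      0ℚ + c * δ     ≤⟨ +-monoˡ-≤ (c * δ) (<⇒≤ 0<δ) ⟩
      δ + c * δ      ≡⟨ cong (_+ c * δ) (*-identityˡ δ) ⟨
      1ℚ * δ + c * δ ≡⟨ *-distribʳ-+ δ 1ℚ c ⟨
      (1ℚ + c) * δ   ∎

  L≥0 : ∀ n → 0ℚ ≤ L n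
  L≥0 n = nonNegative⁻¹ (L n) {{normalize-nonNeg (suc n) 1}}

  r≥0 : ∀ n → 0ℚ ≤ r n
  r≥0 n = 1/-nonNeg (suc n)

  r-telescope : ∀ n → r n ≡ r (suc n) + r n * r (suc n)
  r-telescope n = begin
    r n                               ≡⟨ *-identityʳ (r n) ⟨
    r n * 1ℚ                          ≡⟨ cong (r n *_) (L*r (suc n)) ⟨
    r n * (L (suc n) * r (suc n))     ≡⟨ cong (λ l → r n * (l * r (suc n))) (L-suc n) ⟩
    r n * ((L n + 1ℚ) * r (suc n))    ≡⟨ solve 3 (λ x l y → x :* ((l :+ con 1ℚ) :* y) := (l :* x) :* y :+ x :* y) refl (r n) (L n) (r (suc n)) ⟩
    (L n * r n) * r (suc n) + r n * r (suc n) ≡⟨ cong (_+ r n * r (suc n)) (trans (cong (_* r (suc n)) (L*r n)) (*-identityˡ (r (suc n)))) ⟩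
    r (suc n) + r n * r (suc n)       ∎
    where open ≡-Reasoning

  r²-telescope : ∀ n → r n * r n + (r (suc n) + r (suc n)) ≤ r n + r n
  r²-telescope n = begin
    x * x + (y + y)           ≤⟨ +-monoˡ-≤ (y + y) (*-monoˡ x (r≥0 n) x≤2y) ⟩
    x * (y + y) + (y + y)     ≡⟨ solve 2 (λ x y → x :* (y :+ y) :+ (y :+ y) := (y :+ x :* y) :+ (y :+ x :* y)) refl x y ⟩
    (y + x * y) + (y + x * y) ≡⟨ cong₂ _+_ (r-telescope n) (r-telescope n) ⟨
    x + x                     ∎
    where
    open ≤-Reasoning
    x = r n
    y = r (suc n)
    x≤2y : x ≤ y + y
    x≤2y = begin
      x          ≡⟨ r-telescope n ⟩
      y + x * y  ≤⟨ +-monoʳ-≤ y (*-monoʳ y (r≥0 (suc n)) (/-mono 1 (suc n) (s≤s z≤n))) ⟩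
      y + 1ℚ * y ≡⟨ cong (λ t → y + t) (*-identityˡ y) ⟩
      y + y      ∎

  r-antitone : ∀ n → r (suc n) ≤ r n
  r-antitone n = /-mono (suc n) (suc (suc n)) (ℕ.n≤1+n _)

  -- tail dominates the tails of ∑ a(n) / (n+1)²
  record Tame (a : ℕ → ℚ) : Set where
    field
      nonneg     : ∀ n → 0ℚ ≤ a n
      sublinear  : Small (λ n → a n * r n)
      tail       : ℕ → ℚ
      tail-step  : ∀ n → a n * (r n * r n) + tail (suc n) ≤ tail n
      tail-small : Small tail
      tail≥0     : ∀ n → 0ℚ ≤ tail n
  open Tame

  const-tame : Tame (λ _ → 1ℚ)
  const-tame = record
    { nonneg     = λ _ → nonNegative⁻¹ 1ℚ
    ; sublinear  = small-≡ (λ n → *-identityˡ (r n)) r-small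
    ; tail       = λ n → r n + r n
    ; tail-step  = λ n → subst (λ t → t + (r (suc n) + r (suc n)) ≤ r n + r n)
                     (sym (*-identityˡ (r n * r n))) (r²-telescope n)
    ; tail-small = small-+ r-small r-small
    ; tail≥0     = λ n → 0≤-+ (r≥0 n) (r≥0 n)
    }

  module _ {a} (tame : Tame a) (k : ℕ⁺) where
    private
      b = step a k
      T = tail tame

    1/^≥0 : ∀ n → 0ℚ ≤ 1/ suc n ^ val k
    1/^≥0 n = 1/-nonNeg (suc n ℕ.^ val k) {{ℕ.m^n≢0 (suc n) (val k)}}

    step-mono : ∀ n → b n ≤ b (suc n)
    step-mono n = subst (_≤ b (suc n)) (+-identityʳ (b n))
      (+-monoʳ-≤ (b n) (0≤-* (nonneg tame n) (1/^≥0 n)))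

    step≥0 : ∀ n → 0ℚ ≤ b n
    step≥0 zero    = ≤-refl
    step≥0 (suc n) = ≤-trans (step≥0 n) (step-mono n)

    step≤ : ∀ n → b (suc n) ≤ b n + a n * r n
    step≤ n = +-monoʳ-≤ (b n) (*-monoˡ (a n) (nonneg tame n) (1/^≤r n k))

    grow : ∀ N δ → 0ℚ < δ → (∀ n → N ℕ.≤ n → a n * r n ≤ δ) → ∀ {n} → N ℕ.≤′ n → b n ≤ b N + δ * L n
    grow N δ 0<δ p ℕ.≤′-refl = subst (_≤ b N + δ * L N) (+-identityʳ (b N))
      (+-monoʳ-≤ (b N) (0≤-* (<⇒≤ 0<δ) (L≥0 N)))
    grow N δ 0<δ p (ℕ.≤′-step {n} N≤n) = begin
      b (suc n)            ≤⟨ step≤ n ⟩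
      b n + a n * r n      ≤⟨ +-mono-≤ (grow N δ 0<δ p N≤n) (p n (ℕ.≤′⇒≤ N≤n)) ⟩
      (b N + δ * L n) + δ  ≡⟨ rearrange (b N) δ (L n) ⟩
      b N + δ * (L n + 1ℚ) ≡⟨ cong (λ l → b N + δ * l) (L-suc n) ⟨
      b N + δ * L (suc n)  ∎
      where
      open ≤-Reasoning
      rearrange : ∀ b d l → (b + d * l) + d ≡ b + d * (l + 1ℚ)
      rearrange = solve 3 (λ b d l → (b :+ d :* l) :+ d := b :+ d :* (l :+ con 1ℚ)) refl

    step-sublinear : Small (λ n → b n * r n)
    step-sublinear ε 0<ε =
      let δ , 0<δ , δ+δ≡ε = halve ε 0<ε
          N , p = sublinear tame δ 0<δ
          M , q = small-* (b N) {r} (step≥0 N) r-small δ 0<δ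
      in N ℕ.⊔ M , λ n l → subst (b n * r n ≤_) δ+δ≡ε (bound N n δ
           (grow N δ 0<δ p (ℕ.≤⇒≤′ (ℕ.m⊔n≤o⇒m≤o N M l)))
           (q n (ℕ.m⊔n≤o⇒n≤o N M l)))
      where
      open ≤-Reasoning
      rearrange : ∀ b d l r → (b + d * l) * r ≡ b * r + d * (l * r)
      rearrange = solve 4 (λ b d l r → (b :+ d :* l) :* r := b :* r :+ d :* (l :* r)) refl
      bound : ∀ N n δ → b n ≤ b N + δ * L n → b N * r n ≤ δ → b n * r n ≤ δ + δ
      bound N n δ bn≤ bN≤ = begin
        b n * r n                   ≤⟨ *-monoʳ (r n) (r≥0 n) bn≤ ⟩
        (b N + δ * L n) * r n       ≡⟨ rearrange (b N) δ (L n) (r n) ⟩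
        b N * r n + δ * (L n * r n) ≡⟨ cong (λ t → b N * r n + t) (trans (cong (δ *_) (L*r n)) (*-identityʳ δ)) ⟩
        b N * r n + δ               ≤⟨ +-monoˡ-≤ δ bN≤ ⟩
        δ + δ                       ∎

    step-tail : ∀ n → b n * (r n * r n) + (b (suc n) * (r (suc n) + r (suc n)) + (T (suc n) + T (suc n)))
                      ≤ b n * (r n + r n) + (T n + T n)
    step-tail n = begin
      b n * (x * x) + (b (suc n) * (y + y) + (T′ + T′))
        ≤⟨ +-monoʳ-≤ (b n * (x * x)) (+-monoˡ-≤ (T′ + T′) (*-monoʳ (y + y) (0≤-+ (r≥0 (suc n)) (r≥0 (suc n))) (step≤ n))) ⟩
      b n * (x * x) + ((b n + a n * x) * (y + y) + (T′ + T′))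
        ≡⟨ solve 5 (λ b a x y t → b :* (x :* x) :+ ((b :+ a :* x) :* (y :+ y) :+ (t :+ t))
              := b :* (x :* x :+ (y :+ y)) :+ (((a :* x) :* y :+ t) :+ ((a :* x) :* y :+ t))) refl (b n) (a n) x y T′ ⟩
      b n * (x * x + (y + y)) + (((a n * x) * y + T′) + ((a n * x) * y + T′))
        ≤⟨ +-mono-≤ (*-monoˡ (b n) (step≥0 n) (r²-telescope n)) (+-mono-≤ bound bound) ⟩
      b n * (x + x) + (T n + T n) ∎
      where
      open ≤-Reasoning
      x = r n
      y = r (suc n)
      T′ = T (suc n)
      bound : (a n * x) * y + T′ ≤ T n
      bound = begin
        (a n * x) * y + T′ ≤⟨ +-monoˡ-≤ T′ (*-monoˡ (a n * x) (0≤-* (nonneg tame n) (r≥0 n)) (r-antitone n)) ⟩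
        (a n * x) * x + T′ ≡⟨ cong (_+ T′) (*-assoc (a n) x x) ⟩
        a n * (x * x) + T′ ≤⟨ tail-step tame n ⟩
        T n                ∎

    step-tame : Tame b
    step-tame = record
      { nonneg     = step≥0
      ; sublinear  = step-sublinear
      ; tail       = λ n → b n * (r n + r n) + (T n + T n)
      ; tail-step  = step-tail
      ; tail-small = small-+
          (small-≡ (λ n → *-distribˡ-+ (b n) (r n) (r n)) (small-+ step-sublinear step-sublinear))
          (small-+ (tail-small tame) (tail-small tame))
      ; tail≥0     = λ n → 0≤-+ (0≤-* (step≥0 n) (0≤-+ (r≥0 n) (r≥0 n)))
                                (0≤-+ (tail≥0 tame n) (tail≥0 tame n))
      }

    above : ∀ {N n} → N ℕ.≤′ n → b N ≤ b n
    above ℕ.≤′-refl = ≤-refl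
    above (ℕ.≤′-step {n} N≤n) = ≤-trans (above N≤n) (step-mono n)

    module _ (2≤k : 2 ℕ.≤ val k) where
      open ≤-Reasoning

      below : ∀ {N n} → N ℕ.≤′ n → b n + T n ≤ b N + T N
      below ℕ.≤′-refl = ≤-refl
      below {N} (ℕ.≤′-step {n} N≤n) = begin
        b (suc n) + T (suc n)
          ≤⟨ +-monoˡ-≤ (T (suc n)) (+-monoʳ-≤ (b n) (*-monoˡ (a n) (nonneg tame n) (1/^≤r² n k 2≤k))) ⟩
        (b n + a n * (r n * r n)) + T (suc n)
          ≡⟨ +-assoc (b n) (a n * (r n * r n)) (T (suc n)) ⟩
        b n + (a n * (r n * r n) + T (suc n))
          ≤⟨ +-monoʳ-≤ (b n) (tail-step tame n) ⟩
        b n + T n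
          ≤⟨ below N≤n ⟩
        b N + T N ∎

      within : ∀ {N m n} → N ℕ.≤ m → N ℕ.≤ n → b m - b n ≤ T N
      within {N} {m} {n} l l′ = begin
        b m - b n           ≡⟨ cong (_- b n) (+-identityʳ (b m)) ⟨
        (b m + 0ℚ) - b n    ≤⟨ +-monoˡ-≤ (- b n) (+-monoʳ-≤ (b m) (tail≥0 tame m)) ⟩
        (b m + T m) - b n   ≤⟨ +-mono-≤ (below (ℕ.≤⇒≤′ l)) (neg-antimono-≤ (above (ℕ.≤⇒≤′ l′))) ⟩
        (b N + T N) - b N   ≡⟨ cancel (b N) (T N) ⟩
        T N                 ∎
        where
        cancel : ∀ x t → (x + t) - x ≡ t
        cancel = solve 2 (λ x t → (x :+ t) :- x := t) refl

      step-cauchy : IsCauchy b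
      step-cauchy ε 0<ε =
        let δ , 0<δ , δ+δ≡ε = halve ε 0<ε
            N , p = tail-small tame δ 0<δ
            T<ε = subst (T N <_) δ+δ≡ε (subst (_< δ + δ) (+-identityʳ (T N)) (+-mono-≤-< (p N ℕ.≤-refl) 0<δ))
        in N , λ m n l l′ → ≤-<-trans
          (abs≤ (b m) (b n) (T N) (within l l′) (within l′ l)) T<ε
        where
        abs≤ : ∀ x y c → x - y ≤ c → y - x ≤ c → abs (x - y) ≤ c
        abs≤ x y c x-y≤c y-x≤c with abs (x - y) | ∣p∣≡p∨∣p∣≡-p (x - y)
        ... | _ | inj₁ refl = x-y≤c
        ... | _ | inj₂ refl = subst (_≤ c) (flip x y) y-x≤c
          where
          flip : ∀ x y → y - x ≡ - (x - y)
          flip = solve 2 (λ x y → y :- x := :- (x :- y)) refl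

  foldl-tame : ∀ {a} → Tame a → ∀ ks → Tame (foldl step a ks)
  foldl-tame tame []       = tame
  foldl-tame tame (k ∷ ks) = foldl-tame (step-tame tame k) ks

  ζ≤-cauchy : ∀ {k} → Admissible k → IsCauchy (ζ≤ k)
  ζ≤-cauchy empty = const-cauchy 1ℚ
  ζ≤-cauchy (last≥2 ks {k} 2≤k) = subst IsCauchy (sym (foldl-∷ʳ step (λ _ → 1ℚ) k ks))
    (step-cauchy (foldl-tame const-tame ks) k 2≤k)

ζ : ∀ k → Admissible k → ℝ
ζ k adm = mkℝ (ζ≤ k) (PartialSums.ζ≤-cauchy adm)

data Letter : Set where
  𝑥 𝑦 : Letter

infixl 6 _∙_
infixl 5 _·_

-- Words are built by appending letters on the right, as in the recursion
-- defining the shuffle product.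
data Word : Set where
  ε   : Word
  _∙_ : Word → Letter → Word

_·_ : Word → Word → Word
v · ε       = v
v · (w ∙ u) = (v · w) ∙ u

_≟ᴸ_ : DecidableEquality Letter
𝑥 ≟ᴸ 𝑥 = yes refl
𝑥 ≟ᴸ 𝑦 = no λ ()
𝑦 ≟ᴸ 𝑥 = no λ ()
𝑦 ≟ᴸ 𝑦 = yes refl

_≟ᵂ_ : DecidableEquality Word
ε       ≟ᵂ ε       = yes refl
ε       ≟ᵂ (_ ∙ _) = no λ ()
(_ ∙ _) ≟ᵂ ε       = no λ ()
(v ∙ t) ≟ᵂ (w ∙ u) = Dec.map′ (uncurry (cong₂ _∙_)) (λ { refl → refl , refl }) (v ≟ᵂ w ×-dec t ≟ᴸ u)

z : ℕ⁺ → Word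
z (1+ zero)  = ε ∙ 𝑦
z (1+ suc j) = z (1+ j) ∙ 𝑥

zʷ : Index → Word
zʷ = foldl (λ w k → w · z k) ε

-- 𝔥 = ℚ⟨x,y⟩. A list of terms stands for its sum; a word may occur repeatedly.
𝔥 : Set
𝔥 = List (ℚ × Word)

coeff : Word → 𝔥 → ℚ
coeff w []            = 0ℚ
coeff w ((q , v) ∷ h) = if does (w ≟ᵂ v) then q + coeff w h else coeff w h

infix 4 _≈ᴴ_

record _≈ᴴ_ (g h : 𝔥) : Set where
  constructor mk≈ᴴ
  field
    coeff-≡ : ∀ w → coeff w g ≡ coeff w h

infixr 7 _*ₗ_

_*ₗ_ : ℚ → 𝔥 → 𝔥
q *ₗ h = map (λ (p , w) → q * p , w) h

infixl 7 _∙ᴴ_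

_∙ᴴ_ : 𝔥 → Letter → 𝔥
h ∙ᴴ u = map (λ (q , w) → q , w ∙ u) h

_shʷ_ : Word → Word → 𝔥
ε           shʷ w           = [ 1ℚ , w ]
w@(_ ∙ _)   shʷ ε           = [ 1ℚ , w ]
v@(w₁ ∙ u₁) shʷ w@(w₂ ∙ u₂) = ((w₁ shʷ w) ∙ᴴ u₁) ++ ((v shʷ w₂) ∙ᴴ u₂)

_sh_ : 𝔥 → 𝔥 → 𝔥
g sh h = concatMap (λ (p , v) → concatMap (λ (q , w) → (p * q) *ₗ (v shʷ w)) h) g

data Word¹ : Word → Set where
  one : Word¹ ε
  y·_ : ∀ w → Word¹ (ε ∙ 𝑦 · w)

data Word⁰ : Word → Set where
  one   : Word⁰ ε
  y·_·x : ∀ w → Word⁰ ((ε ∙ 𝑦 · w) ∙ 𝑥)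

-- 𝔥¹ = ℚ + y𝔥 and 𝔥⁰ = ℚ + y𝔥x, through representatives in which every listed
-- word is 1 or of the form yw (respectively ywx); equality remains _≈ᴴ_.
𝔥¹ 𝔥⁰ : Set
𝔥¹ = Σ 𝔥 (All (Word¹ ∘ proj₂))
𝔥⁰ = Σ 𝔥 (All (Word⁰ ∘ proj₂))

𝔥⁰⊂𝔥¹ : 𝔥⁰ → 𝔥¹
𝔥⁰⊂𝔥¹ (h , p) = h , All.map Word⁰⇒Word¹ p
  where
  Word⁰⇒Word¹ : ∀ {w} → Word⁰ w → Word¹ w
  Word⁰⇒Word¹ one       = one
  Word⁰⇒Word¹ (y· w ·x) = y· (w ∙ 𝑥)

module Words where
  ·-assoc : ∀ u v w → (u · v) · w ≡ u · (v · w)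
  ·-assoc u v ε       = refl
  ·-assoc u v (w ∙ t) = cong (_∙ t) (·-assoc u v w)

  ε· : ∀ w → ε · w ≡ w
  ε· ε       = refl
  ε· (w ∙ t) = cong (_∙ t) (ε· w)

  StartsY : Word → Set
  StartsY w = ∃ λ v → w ≡ ε ∙ 𝑦 · v

  StartsY⇒Word¹ : ∀ {w} → StartsY w → Word¹ w
  StartsY⇒Word¹ (v , refl) = y· v

  Word¹-· : ∀ {v w} → Word¹ v → StartsY w → StartsY (v · w)
  Word¹-· {w = w} one    (w′ , refl) = w′ , ε· w
  Word¹-· {w = w} (y· v) _           = v · w , ·-assoc (ε ∙ 𝑦) v w

  z-startsY : ∀ k → StartsY (z k)
  z-startsY (1+ zero)  = ε , refl
  z-startsY (1+ suc j) = let v , eq = z-startsY (1+ j) in v ∙ 𝑥 , cong (_∙ 𝑥) eq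

  foldl-word¹ : ∀ {w} ks → Word¹ w → Word¹ (foldl (λ v k → v · z k) w ks)
  foldl-word¹ []       p = p
  foldl-word¹ (k ∷ ks) p = foldl-word¹ ks (StartsY⇒Word¹ (Word¹-· p (z-startsY k)))

  zʷ-word⁰ : ∀ {k} → Admissible k → Word⁰ (zʷ k)
  zʷ-word⁰ empty = one
  zʷ-word⁰ (last≥2 ks {1+ zero} (ℕ.s≤s ()))
  zʷ-word⁰ (last≥2 ks {1+ suc j} _) =
    subst Word⁰ (sym (foldl-∷ʳ (λ v k → v · z k) ε (1+ suc j) ks))
      (ends-x (Word¹-· (foldl-word¹ ks one) (z-startsY (1+ j))))
    where
    ends-x : ∀ {w} → StartsY w → Word⁰ (w ∙ 𝑥)
    ends-x (v , refl) = y· v ·x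

  sh-startsY : ∀ v w → All (StartsY ∘ proj₂) ((ε ∙ 𝑦 · v) shʷ (ε ∙ 𝑦 · w))
  sh-startsY v w = go v w
    where
    append : ∀ {h} t → All (StartsY ∘ proj₂) h → All (StartsY ∘ proj₂) (h ∙ᴴ t)
    append t = All.map⁺ ∘ All.map (λ { (v , eq) → v ∙ t , cong (_∙ t) eq })
    go : ∀ v w → All (StartsY ∘ proj₂) ((ε ∙ 𝑦 · v) shʷ (ε ∙ 𝑦 · w))
    go ε       ε       = (ε ∙ 𝑦 , refl) ∷ (ε ∙ 𝑦 , refl) ∷ []
    go ε       (w ∙ u) = (w ∙ u ∙ 𝑦 , refl) ∷ append u (go ε w)
    go (v ∙ t) ε       = All.++⁺ (append t (go v ε)) ((v ∙ t ∙ 𝑦 , refl) ∷ [])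
    go (v ∙ t) (w ∙ u) = All.++⁺ (append t (go v (w ∙ u))) (append u (go (v ∙ t) w))

  shʷ-word¹ : ∀ {v w} → Word¹ v → Word¹ w → All (Word¹ ∘ proj₂) (v shʷ w)
  shʷ-word¹ one    q      = q ∷ []
  shʷ-word¹ (y· v) (y· w) = All.map StartsY⇒Word¹ (sh-startsY v w)
  shʷ-word¹ (y· ε)       one = (y· ε) ∷ []
  shʷ-word¹ (y· (w ∙ t)) one = (y· (w ∙ t)) ∷ []

  *ₗ-all : ∀ {P : Word → Set} q {h} → All (P ∘ proj₂) h → All (P ∘ proj₂) (q *ₗ h)
  *ₗ-all q = All.map⁺ ∘ All.map id

  sh-word¹ : ∀ {g h} → All (Word¹ ∘ proj₂) g → All (Word¹ ∘ proj₂) h → All (Word¹ ∘ proj₂) (g sh h)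
  sh-word¹ ps qs = All.concat⁺ (All.map⁺ (All.map (λ {(p , v)} pv →
    All.concat⁺ (All.map⁺ (All.map (λ {(q , w)} qw → *ₗ-all (p * q) (shʷ-word¹ pv qw)) qs))) ps))

open Words using (zʷ-word⁰; foldl-word¹; *ₗ-all; sh-word¹)

z⁰ : ∀ k → Admissible k → 𝔥⁰
z⁰ k adm = [ 1ℚ , zʷ k ] , zʷ-word⁰ adm ∷ []

z¹ : Index → 𝔥¹
z¹ k = [ 1ℚ , zʷ k ] , foldl-word¹ k one ∷ []

𝔥¹-rawRing : RawRing 0ℓ 0ℓ
𝔥¹-rawRing = record
  { Carrier = 𝔥¹
  ; _≈_     = λ (g , _) (h , _) → g ≈ᴴ h
  ; _+_     = λ (g , p) (h , q) → g ++ h , All.++⁺ p q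
  ; _*_     = λ (g , p) (h , q) → g sh h , sh-word¹ p q
  ; -_      = λ (h , p) → (- 1ℚ) *ₗ h , *ₗ-all (- 1ℚ) p
  ; 0#      = [] , []
  ; 1#      = z¹ []
  }

𝔥¹-rawModule : RawLeftModule ℚ 0ℓ 0ℓ
𝔥¹-rawModule = record
  { Carrierᴹ = 𝔥¹
  ; _≈ᴹ_     = 𝔥¹._≈_
  ; _+ᴹ_     = 𝔥¹._+_
  ; _*ₗ_     = λ q (h , p) → q *ₗ h , *ₗ-all q p
  ; 0ᴹ       = 𝔥¹.0#
  ; -ᴹ_      = 𝔥¹.-_
  }
  where module 𝔥¹ = RawRing 𝔥¹-rawRing

𝔥⁰-rawModule : RawLeftModule ℚ 0ℓ 0ℓ
𝔥⁰-rawModule = record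
  { Carrierᴹ = 𝔥⁰
  ; _≈ᴹ_     = λ (g , _) (h , _) → g ≈ᴴ h
  ; _+ᴹ_     = λ (g , p) (h , q) → g ++ h , All.++⁺ p q
  ; _*ₗ_     = λ q (h , p) → q *ₗ h , *ₗ-all q p
  ; 0ᴹ       = [] , []
  ; -ᴹ_      = λ (h , p) → (- 1ℚ) *ₗ h , *ₗ-all (- 1ℚ) p
  }

infixr 7 _*ₗᴿ_

_*ₗᴿ_ : ℚ → ℝ → ℝ
q *ₗᴿ r = fromℚ q *ᴿ r

ℝ-rawModule : RawLeftModule ℚ 0ℓ 0ℓ
ℝ-rawModule = record
  { Carrierᴹ = ℝ
  ; _≈ᴹ_     = _≈ᴿ_
  ; _+ᴹ_     = _+ᴿ_
  ; _*ₗ_     = _*ₗᴿ_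
  ; 0ᴹ       = 0ᴿ
  ; -ᴹ_      = λ a → -ᴿ a
  }

-- Coefficients in order of increasing degree; trailing zeros are allowed.
ℝ[T] : Set
ℝ[T] = List ℝ

coeffᵀ : ℝ[T] → ℕ → ℝ
coeffᵀ []      _       = 0ᴿ
coeffᵀ (a ∷ f) zero    = a
coeffᵀ (a ∷ f) (suc n) = coeffᵀ f n

infix 4 _≈ᵀ_

record _≈ᵀ_ (f g : ℝ[T]) : Set where
  constructor mk≈ᵀ
  field
    coeff-≈ : ∀ n → coeffᵀ f n ≈ᴿ coeffᵀ g n

infixl 6 _+ᵀ_
infixl 7 _*ᵀ_

_+ᵀ_ : ℝ[T] → ℝ[T] → ℝ[T]
[]      +ᵀ g       = g
(a ∷ f) +ᵀ []      = a ∷ f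
(a ∷ f) +ᵀ (b ∷ g) = (a +ᴿ b) ∷ (f +ᵀ g)

_*ᵀ_ : ℝ[T] → ℝ[T] → ℝ[T]
[]      *ᵀ g = []
(a ∷ f) *ᵀ g = map (a *ᴿ_) g +ᵀ (0ᴿ ∷ (f *ᵀ g))

constant : ℝ → ℝ[T]
constant a = [ a ]

T : ℝ[T]
T = 0ᴿ ∷ 1ᴿ ∷ []

_[T≔_] : ℝ[T] → ℝ → ℝ
f [T≔ t ] = foldr (λ a b → a +ᴿ t *ᴿ b) 0ᴿ f

ℝ[T]-rawRing : RawRing 0ℓ 0ℓ
ℝ[T]-rawRing = record
  { Carrier = ℝ[T]
  ; _≈_     = _≈ᵀ_
  ; _+_     = _+ᵀ_
  ; _*_     = _*ᵀ_
  ; -_      = map (λ a → -ᴿ a)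
  ; 0#      = []
  ; 1#      = constant 1ᴿ
  }

ℝ[T]-rawModule : RawLeftModule ℚ 0ℓ 0ℓ
ℝ[T]-rawModule = record
  { Carrierᴹ = ℝ[T]
  ; _≈ᴹ_     = _≈ᵀ_
  ; _+ᴹ_     = _+ᵀ_
  ; _*ₗ_     = λ q → map (q *ₗᴿ_)
  ; 0ᴹ       = []
  ; -ᴹ_      = map (λ a → -ᴿ a)
  }

-- Z and Z^sh are given by the properties that determine them up to equality
-- in ℝ and ℝ[T].
record IsZ (Z : 𝔥⁰ → ℝ) : Set where
  open LeftModuleMorphisms 𝔥⁰-rawModule ℝ-rawModule
  field
    ℚ-linear : IsLeftModuleHomomorphism Z
    Z[zₖ]≈ζ  : ∀ k (adm : Admissible k) → Z (z⁰ k adm) ≈ᴿ ζ k adm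

record IsShuffleRegularization (Z : 𝔥⁰ → ℝ) (Zˢʰ : 𝔥¹ → ℝ[T]) : Set where
  open RingMorphisms 𝔥¹-rawRing ℝ[T]-rawRing
  open LeftModuleMorphisms 𝔥¹-rawModule ℝ[T]-rawModule
  field
    ring-homomorphism : IsRingHomomorphism Zˢʰ
    ℚ-linear          : IsLeftModuleHomomorphism Zˢʰ
    extends           : ∀ h → Zˢʰ (𝔥⁰⊂𝔥¹ h) ≈ᵀ constant (Z h)
    Zˢʰ[y]≈T          : Zˢʰ (z¹ [ 1+ 0 ]) ≈ᵀ T

-- k₁ □ ⋯ □ kᵣ for all choices of □ among comma and plus
contractions : Index → List Index
contractions⁺ : ℕ⁺ → List ℕ⁺ → List Index

contractions []       = [ [] ]
contractions (k ∷ ks) = contractions⁺ k ks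

contractions⁺ k []       = [ [ k ] ]
contractions⁺ k (l ∷ ls) = map (k ∷_) (contractions⁺ l ls) ++ contractions⁺ (k +⁺ l) ls

∑ᴿ : List ℝ → ℝ
∑ᴿ = foldr _+ᴿ_ 0ᴿ

ζˢʰ : (𝔥¹ → ℝ[T]) → Index → ℝ
ζˢʰ Zˢʰ k = Zˢʰ (z¹ k) [T≔ 0ᴿ ]

ζ⋆ˢʰ : (𝔥¹ → ℝ[T]) → Index → ℝ
ζ⋆ˢʰ Zˢʰ k = ∑ᴿ (map (ζˢʰ Zˢʰ) (contractions k))

-- The partial order of a 2-poset is given by its strict part.
record 2-Poset : Set₁ where
  infix 4 _≺_
  field
    Carrier : Set
    _≺_     : Rel Carrier 0ℓ
    isDecStrictPartialOrder : IsDecStrictPartialOrder _≡_ _≺_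
    size    : ℕ
    finite  : Carrier ↔ Fin size
    δ       : Carrier → Letter

  open IsDecStrictPartialOrder isDecStrictPartialOrder public using (_≟_) renaming (_<?_ to _≺?_)

  -- A bijection f onto {1,…,n} is represented by the tuple g of the values
  -- f⁻¹(1),…,f⁻¹(n); the second component says that p ≺ q implies f(p) < f(q).
  IsLinearExtension : ∀ {n} → Vec Carrier n → Set
  IsLinearExtension g = Bijective _≡_ _≡_ (Vec.lookup g)
                      × (∀ a b → Vec.lookup g a ≺ Vec.lookup g b → a Fin.< b)

  isLinearExtension? : ∀ {n} (g : Vec Carrier n) → Dec (IsLinearExtension g)
  isLinearExtension? g = (injective? ×-dec surjective?) ×-dec
    Fin.all? (λ a → Fin.all? λ b → (Vec.lookup g a ≺? Vec.lookup g b) →-dec (a Fin.<? b))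
    where
    open Inverse finite using (to; from; strictlyInverseʳ)
    injective? : Dec (Injective _≡_ _≡_ (Vec.lookup g))
    injective? = Dec.map′ (λ inj {a} {b} → inj a b) (λ inj a b → inj)
      (Fin.all? λ a → Fin.all? λ b → (Vec.lookup g a ≟ Vec.lookup g b) →-dec (a Fin.≟ b))
    hits-all : (∀ i → ∃ λ a → Vec.lookup g a ≡ from i) → Surjective _≡_ _≡_ (Vec.lookup g)
    hits-all hits p = let a , eq = hits (to p) in a , λ { refl → trans eq (strictlyInverseʳ p) }
    surjective? : Dec (Surjective _≡_ _≡_ (Vec.lookup g))
    surjective? = Dec.map′ hits-all (λ sur i → let a , eq = sur (from i) in a , eq refl)
      (Fin.all? λ i → Fin.any? λ a → Vec.lookup g a ≟ from i)

  elements : List Carrier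
  elements = map (Inverse.from finite) (allFin size)

  tuples : ∀ n → List (Vec Carrier n)
  tuples zero    = [ [] ]
  tuples (suc n) = cartesianProductWith _∷_ elements (tuples n)

  word : ∀ {n} → Vec Carrier n → Word
  word g = foldl _∙_ ε (map δ (Vec.toList g))

  W : 𝔥
  W = map (λ g → 1ℚ , word g) (filter isLinearExtension? (tuples size))

module X⋆ (k : Index) where

  -- Zero-based: (i , m) is p_{i+1,m+1}.
  Carrier : Set
  Carrier = Σ (Fin (length k)) λ i → Fin (val (lookup k i))

  infix 4 _⋖_ _⋖?_

  -- The generating relations p_{i,m} < p_{i,m+1} and p_{i,1} < p_{i+1,k_{i+1}}
  _⋖_ : Rel Carrier 0ℓ
  (i , m) ⋖ (j , n) = (i ≡ j × toℕ n ≡ suc (toℕ m))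
                    ⊎ (toℕ j ≡ suc (toℕ i) × toℕ m ≡ 0 × suc (toℕ n) ≡ val (lookup k j))

  _≺_ : Rel Carrier 0ℓ
  _≺_ = TransClosure _⋖_

  δ : Carrier → Letter
  δ (_ , zero)  = 𝑦
  δ (_ , suc _) = 𝑥

  _⋖?_ : Decidable _⋖_
  (i , m) ⋖? (j , n) = (i Fin.≟ j ×-dec toℕ n ℕ.≟ suc (toℕ m))
                  ⊎-dec (toℕ j ℕ.≟ suc (toℕ i) ×-dec toℕ m ℕ.≟ 0 ×-dec suc (toℕ n) ℕ.≟ val (lookup k j))

  ⋖-wellFounded : WellFounded _⋖_
  ⋖-wellFounded = Subrelation.wellFounded ⋖⇒lex
    (On.wellFounded position (×-wellFounded <-wellFounded <-wellFounded))
    where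
    position : Carrier → ℕ × ℕ
    position (i , m) = toℕ i , toℕ m
    ⋖⇒lex : ∀ {p q} → p ⋖ q → ×-Lex _≡_ ℕ._<_ ℕ._<_ (position p) (position q)
    ⋖⇒lex (inj₁ (refl , eq)) = inj₂ (refl , ℕ.≤-reflexive (sym eq))
    ⋖⇒lex (inj₂ (eq , _))    = inj₁ (ℕ.≤-reflexive (sym eq))

finite⋆ : ∀ k → X⋆.Carrier k ↔ Fin (sum (map val k))
finite⋆ []       = mk↔ₛ′ (λ ()) (λ ()) (λ ()) (λ ())
finite⋆ (k ∷ ks) = ↔-sym Fin.+↔⊎ ↔-∘ ((↔-id _ ⊎-↔ finite⋆ ks) ↔-∘ split)
  where
  split : X⋆.Carrier (k ∷ ks) ↔ (Fin (val k) ⊎ X⋆.Carrier ks)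
  split = mk↔ₛ′
    (λ { (zero , m) → inj₁ m ; (suc i , m) → inj₂ (i , m) })
    (λ { (inj₁ m) → zero , m ; (inj₂ (i , m)) → suc i , m })
    (λ { (inj₁ _) → refl ; (inj₂ _) → refl })
    (λ { (zero , _) → refl ; (suc _ , _) → refl })

module X⋆-Poset (k : Index) where
  open X⋆ k
  open Inverse (finite⋆ k) using (to; from; strictlyInverseʳ)

  any? : ∀ {P : Carrier → Set} → (∀ p → Dec (P p)) → Dec (∃ P)
  any? {P} P? = Dec.map′ (λ (i , h) → from i , h)
    (λ (p , h) → to p , subst P (sym (strictlyInverseʳ p)) h) (Fin.any? (P? ∘ from))

  unsnoc : ∀ {p r} → p ≺ r → p ⋖ r ⊎ ∃ λ q → q ⋖ r × p ≺ q
  unsnoc ⁺.[ p⋖r ]     = inj₁ p⋖r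
  unsnoc (p⋖q ⁺.∷ q<r) with unsnoc q<r
  ... | inj₁ q⋖r             = inj₂ (_ , q⋖r , ⁺.[ p⋖q ])
  ... | inj₂ (s , s⋖r , q<s) = inj₂ (s , s⋖r , p⋖q ⁺.∷ q<s)

  ≺?-acc : ∀ p {r} → Acc _⋖_ r → Dec (p ≺ r)
  ≺?-acc p {r} (acc below) = Dec.map′
    (λ { (inj₁ p⋖r) → ⁺.[ p⋖r ] ; (inj₂ (q , q⋖r , p<q)) → p<q ⁺.∷ʳ q⋖r }) unsnoc
    (p ⋖? r ⊎-dec any? via)
    where
    via : ∀ q → Dec (q ⋖ r × p ≺ q)
    via q with q ⋖? r
    ... | yes q⋖r = Dec.map′ (q⋖r ,_) proj₂ (≺?-acc p (below q⋖r))
    ... | no ¬q⋖r = no (¬q⋖r ∘ proj₁)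

  X⋆-poset : 2-Poset
  X⋆-poset = record
    { Carrier = Carrier
    ; _≺_     = _≺_
    ; isDecStrictPartialOrder = record
      { isStrictPartialOrder = record
        { isEquivalence = isEquivalence
        ; irrefl        = λ { refl p<p → wf⇒asym (⁺.wellFounded _⋖_ ⋖-wellFounded) p<p p<p }
        ; trans         = ⁺.transitive _⋖_
        ; <-resp-≈      = resp₂ _≺_
        }
      ; _≟_  = λ { (i , m) (j , n) → ≟-Σ i m j n }
      ; _<?_ = λ p r → ≺?-acc p (⋖-wellFounded r)
      }
    ; size   = sum (map val k)
    ; finite = finite⋆ k
    ; δ      = δ
    }
    where
    ≟-Σ : ∀ i m j n → Dec (_≡_ {A = Carrier} (i , m) (j , n))
    ≟-Σ i m j n with i Fin.≟ j
    ... | no i≢j   = no λ { refl → i≢j refl }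
    ... | yes refl = Dec.map′ (cong (i ,_)) (λ { refl → refl }) (m Fin.≟ n)

  open 2-Poset X⋆-poset using (IsLinearExtension; isLinearExtension?; tuples; size; word; W)

  first-is-y : ∀ {n p} {g : Vec Carrier n} → IsLinearExtension (p ∷ g) → δ p ≡ 𝑦
  first-is-y {p = i , zero}  _ = refl
  first-is-y {p = i , suc m} {g} ((_ , surjective) , monotone) =
    let a , eq = surjective (i , Fin.inject₁ m)
        q⋖p    = inj₁ (refl , cong suc (sym (Fin.toℕ-inject₁ m)))
    in contradiction (monotone a zero (subst (_≺ (i , suc m)) (sym (eq refl)) ⁺.[ q⋖p ])) λ ()

  word-word¹ : ∀ {n} (g : Vec Carrier n) → IsLinearExtension g → Word¹ (word g)
  word-word¹ []      _   = one
  word-word¹ (p ∷ g) ext rewrite first-is-y ext = go ε (map δ (Vec.toList g))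
    where
    go : ∀ v us → Word¹ (foldl _∙_ (ε ∙ 𝑦 · v) us)
    go v []       = y· v
    go v (u ∷ us) = go (v ∙ u) us

  w⋆ : 𝔥¹
  w⋆ = W , All.map⁺ (All.map (λ {g} → word-word¹ g) (All.all-filter isLinearExtension? (tuples size)))

open X⋆-Poset using (w⋆)

ζ⋆ᴷʸ : (𝔥¹ → ℝ[T]) → Index → ℝ
ζ⋆ᴷʸ Zˢʰ k = Zˢʰ (w⋆ k) [T≔ 0ᴿ ]

-- The term 1 = ζ(∅) is covered by the empty index.
_∈𝒵 : ℝ → Set
a ∈𝒵 = ∃ λ (c : List (ℚ × ∃ Admissible)) → a ≈ᴿ ∑ᴿ (map (λ (q , k , adm) → q *ₗᴿ ζ k adm) c)

ζ[2] : ℝ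
ζ[2] = ζ [ 1+ 1 ] (last≥2 [] (ℕ.s≤s (ℕ.s≤s ℕ.z≤n)))

infix 4 _≡ᴿ_mod-ζ[2]𝒵

_≡ᴿ_mod-ζ[2]𝒵 : ℝ → ℝ → Set
a ≡ᴿ b mod-ζ[2]𝒵 = ∃ λ c → c ∈𝒵 × a -ᴿ b ≈ᴿ ζ[2] *ᴿ c

-- Write ψ for Zˢʰ at T = 0, (f ✶ g)(k) = ∑ᵢ f(k₁,…,kᵢ) g(kᵢ₊₁,…,kᵣ) for functions f, g of indices,
-- with unit η, and (R f)(k) = (-1)ʳ f(kᵣ,…,k₁).  Splitting linear extensions according to whether
-- p_{i,1} < p_{i+1,k_{i+1}} gives Rψ ✶ ζ⋆ᴷʸ = η, where ψ(k) = ψ(z_k).  On the other side, the sums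
-- P_N(k) = ∑_{n₁<⋯<nᵣ≤N} ∏ nᵢ^{-kᵢ} are ordered products of factors η + λ_n, so RP_N ✶ CP_N = η for
-- the sum C over contractions.  Removing from P_N the factor supported on the indices (1,…,1) leaves
-- sums s_N with R s_N ✶ C s_N supported on these indices, where it is given by the coefficients of
-- ∏_{n≤N} (1 - u²/n²)⁻¹.  Now s_N(l,1ᵇ) = (-1)ᵇ ∑ n₁^{-l₁}⋯n_r^{-l_r} h_b(n_r) for l admissible, h_b(n) being
-- the complete homogeneous sum in 1,…,1/n, and shuffling with y shows that this converges to ψ(l,1ᵇ).
-- Hence Rψ ✶ (ζ⋆ˢʰ - ζ⋆ᴷʸ) takes values in ζ(2)𝒵, because the coefficients of ∏ (1 - u²/n²)⁻¹ are
-- polynomials in the ζ(2i) (Newton) and ζ(2i) ∈ ζ(2)𝒵 (Williams' formula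
-- (2k+5) ζ(2k+4) = 2 ∑_{i+j=k} ζ(2i+2) ζ(2j+2)); the theorem follows by induction on r.

module Submission where

open import Algebra.Bundles using (CommutativeRing)
open import Algebra.Bundles.Raw using (RawRing)
open import Algebra.Module.Bundles.Raw using (RawLeftModule)
open import Algebra.Module.Morphism.Structures using (module LeftModuleMorphisms)
open import Algebra.Morphism.Structures using (module RingMorphisms)
open import Algebra.Structures using (IsCommutativeRing)
open import Data.Empty using (⊥)
open import Data.Fin.Base as Fin using (Fin; zero; suc; toℕ; fromℕ; inject₁)
import Data.Fin.Properties as Fin
open import Data.List.Base as List using (List; []; _∷_; [_]; _++_; _∷ʳ_; map; concatMap; foldr; foldl; filter; length; reverse; lookup; replicate; initLast; _∷ʳ′_)
open import Data.List.Properties using (∷-injective; ∷-injectiveˡ; ∷-injectiveʳ; ++-assoc; ++-identityʳ; map-∘; map-cong; map-id; map-++; map-injective; foldl-∷ʳ; foldl-++; foldl-map; unfold-reverse; reverse-foldr; reverse-involutive; reverse-injective; length-++; length-reverse; length-map)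
open import Data.List.Membership.Propositional using (_∈_; find; lose)
open import Data.List.Membership.Propositional.Properties using (∈-++⁺ˡ; ∈-++⁺ʳ; ∈-++⁻; ∈-map⁺; ∈-map⁻; ∈-concatMap⁺; ∈-concatMap⁻; ∈-filter⁺; ∈-filter⁻; ∈-cartesianProductWith⁺; ∈-allFin)
open import Data.List.Membership.Propositional.Properties.WithK using (unique∧set⇒bag)
import Data.List.Membership.DecPropositional as DecMembership
open import Data.List.Relation.Binary.BagAndSetEquality using (∼bag⇒↭)
open import Data.List.Relation.Binary.Permutation.Propositional as ↭ using (_↭_)
import Data.List.Relation.Binary.Permutation.Propositional.Properties as ↭
open import Data.List.Relation.Unary.All as All using (All; []; _∷_)
import Data.List.Relation.Unary.All.Properties as All
open import Data.List.Relation.Unary.AllPairs as AllPairs using (AllPairs; []; _∷_)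
import Data.List.Relation.Unary.AllPairs.Properties as AllPairs
open import Data.List.Relation.Unary.Any using (here; there)
import Data.List.Relation.Unary.Any.Properties as Any
open import Data.List.Relation.Unary.Unique.Propositional using (Unique)
import Data.List.Relation.Unary.Unique.Propositional.Properties as Unique
open import Data.Nat.Base as ℕ using (ℕ; zero; suc; s≤s; z≤n)
open import Data.Nat.ListAction using (sum)
import Data.Nat.Properties as ℕ
import Data.Nat.Tactic.RingSolver as ℕ-Solver
open import Data.Product.Base using (∃; _×_; _,_; proj₁; proj₂)
open import Data.Rational.Base using (ℚ; 0ℚ; 1ℚ; _+_; _*_; _-_; -_; ∣_∣; _<_; _≤_)
open import Data.Rational.Properties
open import Data.Sum.Base as Sum using (_⊎_; inj₁; inj₂; [_,_]′)
open import Data.Sum.Properties using () renaming (≡-dec to ⊎-≡-dec)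
open import Data.Unit.Base using (⊤; tt)
open import Data.Vec.Base as Vec using (Vec; []; _∷_)
import Data.Vec.Properties as Vec
import Data.Vec.Membership.Propositional.Properties as VecMembership
import Data.Vec.Relation.Unary.Any as VecAny
import Data.Vec.Relation.Unary.Any.Properties as VecAny
open import Function.Base using (_∘_; id; case_of_)
open import Function.Bundles using (Inverse; mk⇔)
open import Level using (0ℓ)
open import Relation.Binary.Bundles using (Setoid)
import Relation.Binary.Construct.Closure.Transitive as ⁺
open import Relation.Binary.Definitions using (DecidableEquality; tri<; tri≈; tri>)
open import Relation.Binary.PropositionalEquality hiding ([_])
import Relation.Binary.Reasoning.Setoid as SetoidReasoning
open import Relation.Binary.Structures using (IsDecStrictPartialOrder)
open import Relation.Nullary.Decidable as Dec using (Dec; yes; no; ¬?)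
open import Relation.Nullary.Negation using (¬_; contradiction)
open import Tactic.RingSolver using (solve-∀)
open import Tactic.RingSolver.Core.AlmostCommutativeRing using (AlmostCommutativeRing; fromCommutativeRing)

open import Defs

open Cauchy using (0≤-+; 0≤-*)
open PartialSums using (r; L; L-suc; L*r; r≥0; r-antitone; r-telescope; Small; small-+; small-*; small-≡; Tame; const-tame; step-tame)

-- Real numbers as limits of rational sequences

-- All identities for `R`, `C` and `✶` are exact over ℚ at every finite n; real numbers enter only
-- as limits of their two sides. The obstacle is that `P n` diverges on indices ending in 1. Its
-- part on the indices (1,...,1) has the generating function ∏_{i≤n} (1 + u/i), and dividing by it
-- on the right gives `s n`. That the quotient tends to the shuffle regularization rests on the beta
-- integral ∫₀¹ tⁿ⁻¹ (1-t)ᵘ dt = (1/n) ∏_{i≤n} (1 + u/i)⁻¹, where (1-t)ᵘ is the generating function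
-- of the regularized tails yʲ. `R` replaces u by -u in the divided factor while `C` fixes it. Hence
-- this factor does not cancel in `R (s n) ✶ C (s n)`, as `P n` does, but leaves ∏ (1 - u/i)⁻¹ (1 +
-- u/i)⁻¹, which is where ζ(2) comes from. Williams' formula replaces Euler's evaluation of ζ(2i)
-- because it is the limit of a finite rational identity with an elementary error term, without any
-- mention of π.

ℚ-ring : AlmostCommutativeRing 0ℓ 0ℓ
ℚ-ring = fromCommutativeRing +-*-commutativeRing (λ q → Dec.dec⇒maybe (0ℚ ≟ q))

record Null (a : ℕ → ℚ) : Set where
  constructor mkNull
  field
    vanishes : ∀ ε → 0ℚ < ε → ∃ λ N → ∀ n → N ℕ.≤ n → ∣ a n ∣ < ε

open Null

null-cong : ∀ {a b} → (∀ n → a n ≡ b n) → Null a → Null b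
null-cong eq na = mkNull λ ε 0<ε → let N , p = vanishes na ε 0<ε in
  N , λ n l → subst (λ t → ∣ t ∣ < ε) (eq n) (p n l)

p≤∣p∣ : ∀ p → p ≤ ∣ p ∣
p≤∣p∣ p with ≤-total 0ℚ p
... | inj₁ 0≤p = ≤-reflexive (sym (0≤p⇒∣p∣≡p 0≤p))
... | inj₂ p≤0 = ≤-trans p≤0 (0≤∣p∣ p)

null-≤ : ∀ {a b} → (∀ n → ∣ b n ∣ ≤ a n) → Null a → Null b
null-≤ {a} le na = mkNull λ ε 0<ε → let N , p = vanishes na ε 0<ε in
  N , λ n l → ≤-<-trans (≤-trans (le n) (p≤∣p∣ (a n))) (p n l)

null-0 : Null (λ _ → 0ℚ)
null-0 = mkNull λ ε 0<ε → 0 , λ _ _ → 0<ε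

null-+ : ∀ {a b} → Null a → Null b → Null (λ n → a n + b n)
null-+ {a} {b} na nb = mkNull λ ε 0<ε →
  let δ , 0<δ , δ+δ≡ε = Cauchy.halve ε 0<ε
      M , p = vanishes na δ 0<δ
      N , q = vanishes nb δ 0<δ
  in M ℕ.⊔ N , λ n l → subst (∣ a n + b n ∣ <_) δ+δ≡ε
    (≤-<-trans (∣p+q∣≤∣p∣+∣q∣ (a n) (b n))
      (+-mono-< (p n (ℕ.m⊔n≤o⇒m≤o M N l)) (q n (ℕ.m⊔n≤o⇒n≤o M N l))))

null-neg : ∀ {a} → Null a → Null (λ n → - a n)
null-neg {a} na = mkNull λ ε 0<ε → let N , p = vanishes na ε 0<ε in
  N , λ n l → subst (_< ε) (sym (∣-p∣≡∣p∣ (a n))) (p n l)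

null-* : ∀ {a b : ℕ → ℚ} B → 0ℚ < B → (∃ λ N → ∀ n → N ℕ.≤ n → ∣ b n ∣ ≤ B) → Null a → Null (λ n → b n * a n)
null-* {a} {b} B 0<B (M , q) na = mkNull λ ε 0<ε →
  let δ , 0<δ , Bδ≡ε = Cauchy.divide B ε 0<B 0<ε
      N , p = vanishes na δ 0<δ
  in M ℕ.⊔ N , λ n l → subst (∣ b n * a n ∣ <_) Bδ≡ε (subst (_< B * δ) (sym (∣p*q∣≡∣p∣*∣q∣ (b n) (a n)))
    (≤-<-trans (Cauchy.*-monoʳ {p = ∣ b n ∣} ∣ a n ∣ (0≤∣p∣ (a n)) (q n (ℕ.m⊔n≤o⇒m≤o M N l)))
      (Cauchy.*-mono< B 0<B (p n (ℕ.m⊔n≤o⇒n≤o M N l)))))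

infix 4 _⟶_

-- Comparing with the approximant of the same index avoids embedding ℚ in ℝ; it is convergence to
-- `r` because `approx r` is Cauchy.
record _⟶_ (a : ℕ → ℚ) (r : ℝ) : Set where
  constructor lim
  field
    difference : Null (λ n → a n - approx r n)

open _⟶_

⟶-cong : ∀ {a b r} → (∀ n → a n ≡ b n) → a ⟶ r → b ⟶ r
⟶-cong {r = r} eq (lim e) = lim (null-cong (λ n → cong (_- approx r n) (eq n)) e)

⟶-approx : ∀ r → approx r ⟶ r
⟶-approx r = lim (null-cong (λ n → sym (+-inverseʳ (approx r n))) null-0)

≈⇒⟶ : ∀ {r s} → r ≈ᴿ s → approx r ⟶ s
≈⇒⟶ (mk≈ᴿ c) = lim (mkNull c)

⟶⇒≈ : ∀ {r s} → approx r ⟶ s → r ≈ᴿ s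
⟶⇒≈ (lim (mkNull c)) = mk≈ᴿ c

pointwise : ∀ {r s} → (∀ n → approx r n ≡ approx s n) → r ≈ᴿ s
pointwise {s = s} eq = ⟶⇒≈ (⟶-cong (λ n → sym (eq n)) (⟶-approx s))

⟶-resp : ∀ {a r s} → a ⟶ r → r ≈ᴿ s → a ⟶ s
⟶-resp {a} {r} {s} (lim e) r≈s = lim (null-cong (λ n → telescope (a n) (approx r n) (approx s n)) (null-+ e (difference (≈⇒⟶ r≈s))))
  where
  telescope : ∀ a r s → (a - r) + (r - s) ≡ a - s
  telescope = solve-∀ ℚ-ring

⟶-unique : ∀ {a r s} → a ⟶ r → a ⟶ s → r ≈ᴿ s
⟶-unique {a} {r} {s} (lim e) (lim e′) = ⟶⇒≈ (lim (null-cong (λ n → telescope (a n) (approx r n) (approx s n)) (null-+ (null-neg e) e′)))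
  where
  telescope : ∀ a r s → - (a - r) + (a - s) ≡ r - s
  telescope = solve-∀ ℚ-ring

⟶-const : ∀ q → (λ _ → q) ⟶ fromℚ q
⟶-const q = ⟶-approx (fromℚ q)

⟶-+ : ∀ {a b r s} → a ⟶ r → b ⟶ s → (λ n → a n + b n) ⟶ r +ᴿ s
⟶-+ {a} {b} {r} {s} (lim e) (lim e′) = lim (null-cong (λ n → rearrange (a n) (b n) (approx r n) (approx s n)) (null-+ e e′))
  where
  rearrange : ∀ a b r s → (a - r) + (b - s) ≡ (a + b) - (r + s)
  rearrange = solve-∀ ℚ-ring

⟶-neg : ∀ {a r} → a ⟶ r → (λ n → - a n) ⟶ -ᴿ r
⟶-neg {a} {r} (lim e) = lim (null-cong (λ n → neg-distrib-+ (a n) (- approx r n)) (null-neg e))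

⟶-bounded : ∀ {a r} → a ⟶ r → ∃ λ B → 0ℚ < B × ∃ λ N → ∀ n → N ℕ.≤ n → ∣ a n ∣ ≤ B
⟶-bounded {a} {r} (lim e) =
  let B , 0<B , M , p = Cauchy.eventually-bounded {approx r} (isCauchy r)
      N , q = vanishes e 1ℚ Cauchy.0<1
  in 1ℚ + B , Cauchy.0<1+ (<⇒≤ 0<B) , M ℕ.⊔ N , λ n l → subst (λ t → ∣ t ∣ ≤ 1ℚ + B) (telescope (a n) (approx r n))
    (≤-trans (∣p+q∣≤∣p∣+∣q∣ (a n - approx r n) (approx r n))
      (+-mono-≤ (<⇒≤ (q n (ℕ.m⊔n≤o⇒n≤o M N l))) (p n (ℕ.m⊔n≤o⇒m≤o M N l))))
  where
  telescope : ∀ a r → (a - r) + r ≡ a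
  telescope = solve-∀ ℚ-ring

⟶-* : ∀ {a b r s} → a ⟶ r → b ⟶ s → (λ n → a n * b n) ⟶ r *ᴿ s
⟶-* {a} {b} {r} {s} a⟶r@(lim e) (lim e′) =
  let A , 0<A , bA = ⟶-bounded a⟶r
      S , 0<S , bS = Cauchy.eventually-bounded {approx s} (isCauchy s)
  in lim (null-cong (λ n → rearrange (a n) (b n) (approx r n) (approx s n))
       (null-+ (null-* {b = a} A 0<A bA e′) (null-* {b = approx s} S 0<S bS e)))
  where
  rearrange : ∀ a b r s → a * (b - s) + s * (a - r) ≡ a * b - r * s
  rearrange = solve-∀ ℚ-ring

≈-refl : ∀ {r} → r ≈ᴿ r
≈-refl = pointwise (λ _ → refl)

≈-sym : ∀ {r s} → r ≈ᴿ s → s ≈ᴿ r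
≈-sym {r} r≈s = ⟶-unique (≈⇒⟶ r≈s) (⟶-approx r)

≈-trans : ∀ {r s t} → r ≈ᴿ s → s ≈ᴿ t → r ≈ᴿ t
≈-trans r≈s s≈t = ⟶⇒≈ (⟶-resp (≈⇒⟶ r≈s) s≈t)

ℝ-setoid : Setoid 0ℓ 0ℓ
ℝ-setoid = record
  { Carrier = ℝ ; _≈_ = _≈ᴿ_
  ; isEquivalence = record { refl = ≈-refl ; sym = ≈-sym ; trans = ≈-trans } }

-- Sealed copies of the operations of ℝ: comparing two of the original ones makes
-- the type checker unfold and compare their Cauchy proofs.
infixl 6 _⊕_
infixl 7 _⊗_
infix 8 ⊖_

opaque
  _⊕_ _⊗_ : ℝ → ℝ → ℝ
  _⊕_ = _+ᴿ_
  _⊗_ = _*ᴿ_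

  ⊖_ : ℝ → ℝ
  ⊖_ = -ᴿ_

  ⊕-≈ : ∀ r s → r ⊕ s ≈ᴿ r +ᴿ s
  ⊕-≈ r s = ≈-refl {r +ᴿ s}

  ⊗-≈ : ∀ r s → r ⊗ s ≈ᴿ r *ᴿ s
  ⊗-≈ r s = ≈-refl {r *ᴿ s}

  ⊖-≈ : ∀ r → ⊖ r ≈ᴿ -ᴿ r
  ⊖-≈ r = ≈-refl { -ᴿ r}

  ⊕-approx : ∀ r s n → approx (r ⊕ s) n ≡ approx r n + approx s n
  ⊕-approx r s n = refl

  ⊗-approx : ∀ r s n → approx (r ⊗ s) n ≡ approx r n * approx s n
  ⊗-approx r s n = refl

  ⊖-approx : ∀ r n → approx (⊖ r) n ≡ - approx r n
  ⊖-approx r n = refl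

  ⟶-⊕ : ∀ {a b r s} → a ⟶ r → b ⟶ s → (λ n → a n + b n) ⟶ r ⊕ s
  ⟶-⊕ {r = r} {s} = ⟶-+ {r = r} {s}

  ⟶-⊗ : ∀ {a b r s} → a ⟶ r → b ⟶ s → (λ n → a n * b n) ⟶ r ⊗ s
  ⟶-⊗ {r = r} {s} = ⟶-* {r = r} {s}

  ⟶-⊖ : ∀ {a r} → a ⟶ r → (λ n → - a n) ⟶ ⊖ r
  ⟶-⊖ {r = r} = ⟶-neg {r = r}

⊕-cong : ∀ {r r′ s s′} → r ≈ᴿ r′ → s ≈ᴿ s′ → r ⊕ s ≈ᴿ r′ ⊕ s′
⊕-cong {r} {r′} {s} {s′} p q = ⟶⇒≈ (⟶-cong (λ n → sym (⊕-approx r s n)) (⟶-⊕ (≈⇒⟶ p) (≈⇒⟶ q)))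

⊗-cong : ∀ {r r′ s s′} → r ≈ᴿ r′ → s ≈ᴿ s′ → r ⊗ s ≈ᴿ r′ ⊗ s′
⊗-cong {r} {r′} {s} {s′} p q = ⟶⇒≈ (⟶-cong (λ n → sym (⊗-approx r s n)) (⟶-⊗ (≈⇒⟶ p) (≈⇒⟶ q)))

⊖-cong : ∀ {r r′} → r ≈ᴿ r′ → ⊖ r ≈ᴿ ⊖ r′
⊖-cong {r} p = ⟶⇒≈ (⟶-cong (λ n → sym (⊖-approx r n)) (⟶-⊖ (≈⇒⟶ p)))

opaque
  unfolding _⊕_

  ℝ-isCommutativeRing : IsCommutativeRing _≈ᴿ_ _⊕_ _⊗_ ⊖_ 0ᴿ 1ᴿ
  ℝ-isCommutativeRing = record
    { isRing = record
      { +-isAbelianGroup = record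
        { isGroup = record
          { isMonoid = record
            { isSemigroup = record
              { isMagma = record { isEquivalence = Setoid.isEquivalence ℝ-setoid ; ∙-cong = ⊕-cong }
              ; assoc = λ r s t → pointwise (λ n → +-assoc (approx r n) (approx s n) (approx t n)) }
            ; identity = (λ r → pointwise (λ n → +-identityˡ (approx r n)))
                       , (λ r → pointwise (λ n → +-identityʳ (approx r n))) }
          ; inverse = (λ r → pointwise (λ n → +-inverseˡ (approx r n)))
                    , (λ r → pointwise (λ n → +-inverseʳ (approx r n)))
          ; ⁻¹-cong = ⊖-cong }
        ; comm = λ r s → pointwise (λ n → +-comm (approx r n) (approx s n)) }
      ; *-cong = ⊗-cong
      ; *-assoc = λ r s t → pointwise (λ n → *-assoc (approx r n) (approx s n) (approx t n))
      ; *-identity = (λ r → pointwise (λ n → *-identityˡ (approx r n)))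
                   , (λ r → pointwise (λ n → *-identityʳ (approx r n)))
      ; distrib = (λ r s t → pointwise (λ n → *-distribˡ-+ (approx r n) (approx s n) (approx t n)))
                , (λ r s t → pointwise (λ n → *-distribʳ-+ (approx r n) (approx s n) (approx t n))) }
    ; *-comm = λ r s → pointwise (λ n → *-comm (approx r n) (approx s n)) }

ℝ-commutativeRing : CommutativeRing 0ℓ 0ℓ
ℝ-commutativeRing = record { isCommutativeRing = ℝ-isCommutativeRing }

module Real = CommutativeRing ℝ-commutativeRing

-- The regularization at T = 0 as a character of the shuffle algebra

module ≈ᴿ-Reasoning = SetoidReasoning ℝ-setoid

⟨_,_⟩ : (Word → ℝ) → 𝔥 → ℝ
⟨ ψ , []          ⟩ = 0ᴿ
⟨ ψ , (q , w) ∷ h ⟩ = fromℚ q ⊗ ψ w ⊕ ⟨ ψ , h ⟩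

-- What the combinatorial and analytic parts use of `Zˢʰ`: its constant term, as a function on
-- single words.
record ShuffleCharacter (ψ : Word → ℝ) : Set where
  field
    ψ-ε  : ψ ε ≈ᴿ 1ᴿ
    ψ-y  : ψ (ε ∙ 𝑦) ≈ᴿ 0ᴿ
    ψ-sh : ∀ {v w} → Word¹ v → Word¹ w → ψ v ⊗ ψ w ≈ᴿ ⟨ ψ , v shʷ w ⟩
    ψ-ζ  : ∀ k (adm : Admissible k) → ψ (zʷ k) ≈ᴿ ζ k adm

starts-y⇒word¹ : ∀ {v w} → v ≡ ε ∙ 𝑦 · w → Word¹ v
starts-y⇒word¹ refl = y· _

drop-last : Word → Word
drop-last ε       = ε
drop-last (w ∙ _) = w

-- `Word¹` is indexed by a concatenation, which does not unify with a pattern. The refutations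
-- therefore take the word together with an equation and match on the factor after the first letter.
word¹? : ∀ w → Dec (Word¹ w)
word¹? ε = yes one
word¹? (ε ∙ 𝑦) = yes (y· ε)
word¹? (ε ∙ 𝑥) = no λ p → not-x p refl
  where
  not-x : ∀ {w} → Word¹ w → w ≡ ε ∙ 𝑥 → ⊥
  not-x one ()
  not-x (y· ε) ()
  not-x (y· (ε ∙ _)) ()
  not-x (y· (_ ∙ _ ∙ _)) ()
word¹? (w ∙ u ∙ t) with word¹? (w ∙ u)
... | yes p = yes (snoc p refl)
  where
  snoc : ∀ {v} → Word¹ v → v ≡ w ∙ u → Word¹ (v ∙ t)
  snoc one ()
  snoc (y· v) _ = y· (v ∙ t)
... | no ¬p = no λ p → ¬p (init p refl)
  where
  init : ∀ {v} → Word¹ v → v ≡ w ∙ u ∙ t → Word¹ (w ∙ u)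
  init one ()
  init (y· ε) ()
  init (y· (v ∙ _)) eq = starts-y⇒word¹ (sym (cong drop-last eq))

coeffᵀ₀ : ∀ f → f [T≔ 0ᴿ ] ≈ᴿ coeffᵀ f 0
coeffᵀ₀ []      = ≈-refl
coeffᵀ₀ (a ∷ f) = pointwise λ n → drop (approx a n) (approx (f [T≔ 0ᴿ ]) n)
  where
  drop : ∀ a b → a + 0ℚ * b ≡ a
  drop = solve-∀ ℚ-ring

coeffᵀ₀-+ : ∀ f g → coeffᵀ (f +ᵀ g) 0 ≈ᴿ coeffᵀ f 0 ⊕ coeffᵀ g 0
coeffᵀ₀-+ []      g       = Real.sym (Real.+-identityˡ _)
coeffᵀ₀-+ (a ∷ f) []      = Real.sym (Real.+-identityʳ a)
coeffᵀ₀-+ (a ∷ f) (b ∷ g) = ≈-sym (⊕-≈ a b)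

coeffᵀ₀-* : ∀ f g → coeffᵀ (f *ᵀ g) 0 ≈ᴿ coeffᵀ f 0 ⊗ coeffᵀ g 0
coeffᵀ₀-* []      g       = Real.sym (Real.zeroˡ _)
coeffᵀ₀-* (a ∷ f) []      = Real.sym (Real.zeroʳ a)
coeffᵀ₀-* (a ∷ f) (b ∷ g) = ≈-trans (≈-sym (⊕-≈ (a *ᴿ b) 0ᴿ))
  (≈-trans (Real.+-identityʳ (a *ᴿ b)) (≈-sym (⊗-≈ a b)))

coeffᵀ₀-map : ∀ q f → coeffᵀ (map (q *ₗᴿ_) f) 0 ≈ᴿ fromℚ q ⊗ coeffᵀ f 0
coeffᵀ₀-map q []      = Real.sym (Real.zeroʳ (fromℚ q))
coeffᵀ₀-map q (a ∷ f) = ≈-sym (⊗-≈ (fromℚ q) a)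

module Restrict (Z : 𝔥⁰ → ℝ) (isZ : IsZ Z) (Zˢʰ : 𝔥¹ → ℝ[T]) (isReg : IsShuffleRegularization Z Zˢʰ) where
  open IsShuffleRegularization isReg
  open RingMorphisms.IsRingHomomorphism ring-homomorphism using (⟦⟧-cong; +-homo; *-homo; 1#-homo; 0#-homo)
  open LeftModuleMorphisms.IsLeftModuleHomomorphism ℚ-linear using (*ₗ-homo)
  open ≈ᴿ-Reasoning

  ζ₀ : 𝔥¹ → ℝ
  ζ₀ h = coeffᵀ (Zˢʰ h) 0

  ζ₀-≈ : ∀ h → Zˢʰ h [T≔ 0ᴿ ] ≈ᴿ ζ₀ h
  ζ₀-≈ h = coeffᵀ₀ (Zˢʰ h)

  word : ∀ {w} → Word¹ w → 𝔥¹
  word {w} p = [ 1ℚ , w ] , p ∷ []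

  -- The value 0 outside 𝔥¹ makes `ψ` total, so that sums over words need not carry membership
  -- proofs.
  ψ? : ∀ {w} → Dec (Word¹ w) → ℝ
  ψ? (yes p) = ζ₀ (word p)
  ψ? (no _)  = 0ᴿ

  ψ : Word → ℝ
  ψ w = ψ? (word¹? w)

  ζ₀-cong : ∀ g h → proj₁ g ≈ᴴ proj₁ h → ζ₀ g ≈ᴿ ζ₀ h
  ζ₀-cong g h g≈h = _≈ᵀ_.coeff-≈ (⟦⟧-cong {g} {h} g≈h) 0

  ψ-word : ∀ {w} (p : Word¹ w) → ψ w ≈ᴿ ζ₀ (word p)
  ψ-word {w} p = go (word¹? w)
    where
    go : (d : Dec (Word¹ w)) → ψ? d ≈ᴿ ζ₀ (word p)
    go (yes p′) = ζ₀-cong (word p′) (word p) (mk≈ᴴ λ _ → refl)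
    go (no ¬p)  = contradiction p ¬p

  expand : ∀ h (p : All (Word¹ ∘ proj₂) h) → ζ₀ (h , p) ≈ᴿ ⟨ ψ , h ⟩
  expand [] [] = _≈ᵀ_.coeff-≈ 0#-homo 0
  expand ((q , w) ∷ h) (pw ∷ p) = begin
    ζ₀ ((q , w) ∷ h , pw ∷ p)
      ≈⟨ ζ₀-cong ((q , w) ∷ h , pw ∷ p) _ (mk≈ᴴ λ v → cong (λ c → coeff v ((c , w) ∷ h)) (sym (*-identityʳ q))) ⟩
    ζ₀ (RawRing._+_ 𝔥¹-rawRing (q ⋆ word pw) (h , p))
      ≈⟨ _≈ᵀ_.coeff-≈ (+-homo (q ⋆ word pw) (h , p)) 0 ⟩
    coeffᵀ (Zˢʰ (q ⋆ word pw) +ᵀ Zˢʰ (h , p)) 0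
      ≈⟨ coeffᵀ₀-+ (Zˢʰ (q ⋆ word pw)) _ ⟩
    ζ₀ (q ⋆ word pw) ⊕ ζ₀ (h , p)
      ≈⟨ ⊕-cong (≈-trans (_≈ᵀ_.coeff-≈ (*ₗ-homo q (word pw)) 0) (≈-trans (coeffᵀ₀-map q (Zˢʰ (word pw)))
           (⊗-cong ≈-refl (≈-sym (ψ-word pw))))) (expand h p) ⟩
    fromℚ q ⊗ ψ w ⊕ ⟨ ψ , h ⟩ ∎
    where
    infixr 7 _⋆_
    _⋆_ = RawLeftModule._*ₗ_ 𝔥¹-rawModule

  shuffle : ∀ {v w} → Word¹ v → Word¹ w → ψ v ⊗ ψ w ≈ᴿ ⟨ ψ , v shʷ w ⟩
  shuffle {v} {w} p q = begin
    ψ v ⊗ ψ w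
      ≈⟨ ⊗-cong (ψ-word p) (ψ-word q) ⟩
    ζ₀ (word p) ⊗ ζ₀ (word q)
      ≈⟨ coeffᵀ₀-* (Zˢʰ (word p)) (Zˢʰ (word q)) ⟨
    coeffᵀ (Zˢʰ (word p) *ᵀ Zˢʰ (word q)) 0
      ≈⟨ _≈ᵀ_.coeff-≈ (*-homo (word p) (word q)) 0 ⟨
    ζ₀ (RawRing._*_ 𝔥¹-rawRing (word p) (word q))
      ≈⟨ ζ₀-cong (RawRing._*_ 𝔥¹-rawRing (word p) (word q)) (v shʷ w , Words.shʷ-word¹ p q)
           (mk≈ᴴ λ u → cong (coeff u) (unit (v shʷ w))) ⟩
    ζ₀ (v shʷ w , Words.shʷ-word¹ p q)
      ≈⟨ expand (v shʷ w) _ ⟩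
    ⟨ ψ , v shʷ w ⟩ ∎
    where
    scale : ∀ h → (1ℚ * 1ℚ) *ₗ h ≡ h
    scale []            = refl
    scale ((q , w) ∷ h) = cong₂ _∷_ (cong (_, w) (*-identityˡ q)) (scale h)
    unit : ∀ h → (((1ℚ * 1ℚ) *ₗ h) ++ []) ++ [] ≡ h
    unit h = trans (++-identityʳ _) (trans (++-identityʳ _) (scale h))

  isShuffleCharacter : ShuffleCharacter ψ
  isShuffleCharacter = record
    { ψ-ε  = ≈-trans (ψ-word one) (_≈ᵀ_.coeff-≈ 1#-homo 0)
    ; ψ-y  = ≈-trans (ψ-word (y· ε)) (≈-trans
        (ζ₀-cong (word (y· ε)) (z¹ [ 1+ 0 ]) (mk≈ᴴ λ _ → refl)) (_≈ᵀ_.coeff-≈ Zˢʰ[y]≈T 0))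
    ; ψ-sh = shuffle
    ; ψ-ζ  = λ k adm → begin
        ψ (zʷ k)
          ≈⟨ ψ-word (Words.foldl-word¹ k one) ⟩
        ζ₀ (z¹ k)
          ≈⟨ ζ₀-cong (z¹ k) (𝔥⁰⊂𝔥¹ (z⁰ k adm)) (mk≈ᴴ λ _ → refl) ⟩
        ζ₀ (𝔥⁰⊂𝔥¹ (z⁰ k adm))
          ≈⟨ _≈ᵀ_.coeff-≈ (extends (z⁰ k adm)) 0 ⟩
        Z (z⁰ k adm)
          ≈⟨ IsZ.Z[zₖ]≈ζ isZ k adm ⟩
        ζ k adm ∎
    }

  ζˢʰ-ψ : ∀ k → ζˢʰ Zˢʰ k ≈ᴿ ψ (zʷ k)
  ζˢʰ-ψ k = ≈-trans (ζ₀-≈ (z¹ k)) (≈-sym (ψ-word (Words.foldl-word¹ k one)))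

  ζ⋆ᴷʸ-ψ : ∀ k → ζ⋆ᴷʸ Zˢʰ k ≈ᴿ ⟨ ψ , proj₁ (X⋆-Poset.w⋆ k) ⟩
  ζ⋆ᴷʸ-ψ k = ≈-trans (ζ₀-≈ (X⋆-Poset.w⋆ k)) (expand _ (proj₂ (X⋆-Poset.w⋆ k)))

-- Linear extensions of X⋆

foldl-zʷ : ∀ w ks → foldl (λ v k → v · z k) w ks ≡ w · zʷ ks
foldl-zʷ w []       = refl
foldl-zʷ w (k ∷ ks) = begin
  foldl _ (w · z k) ks ≡⟨ foldl-zʷ (w · z k) ks ⟩
  (w · z k) · zʷ ks    ≡⟨ Words.·-assoc w (z k) (zʷ ks) ⟩
  w · (z k · zʷ ks)    ≡⟨ cong (w ·_) (trans (cong (_· zʷ ks) (sym (Words.ε· (z k)))) (sym (foldl-zʷ (ε · z k) ks))) ⟩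
  w · zʷ (k ∷ ks)      ∎
  where open ≡-Reasoning

zʷ-∷ : ∀ k ks → zʷ (k ∷ ks) ≡ z k · zʷ ks
zʷ-∷ k ks = trans (foldl-zʷ (ε · z k) ks) (cong (_· zʷ ks) (Words.ε· (z k)))

zʷ-word¹ : ∀ k → Word¹ (zʷ k)
zʷ-word¹ k = Words.foldl-word¹ k one

-- Linear orders of a 2-poset are listed from the top element down, so that the
-- last letter of the word comes first.
wd : ∀ {A : Set} → (A → Letter) → List A → Word
wd δ = foldr (λ p w → w ∙ δ p) ε

module _ {A : Set} (δ : A → Letter) where
  wd-++ : ∀ xs ys → wd δ (xs ++ ys) ≡ wd δ ys · wd δ xs
  wd-++ []       ys = refl
  wd-++ (x ∷ xs) ys = cong (_∙ δ x) (wd-++ xs ys)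

  wd-map : ∀ {B : Set} (f : B → A) xs → wd δ (map f xs) ≡ wd (δ ∘ f) xs
  wd-map f []       = refl
  wd-map f (x ∷ xs) = cong (_∙ δ (f x)) (wd-map f xs)

wd-cong : ∀ {A : Set} {δ δ′ : A → Letter} → (∀ p → δ p ≡ δ′ p) → ∀ xs → wd δ xs ≡ wd δ′ xs
wd-cong eq []       = refl
wd-cong eq (x ∷ xs) = cong₂ _∙_ (wd-cong eq xs) (eq x)

-- Shuffles of two lists

module _ {A B : Set} where

  lefts : List (A ⊎ B) → List A
  lefts []           = []
  lefts (inj₁ a ∷ l) = a ∷ lefts l
  lefts (inj₂ b ∷ l) = lefts l

  rights : List (A ⊎ B) → List B
  rights []           = []
  rights (inj₁ a ∷ l) = rights l
  rights (inj₂ b ∷ l) = b ∷ rights l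

  -- The clauses follow those of `_shʷ_`, with the last letter of a word at the head of the list, so
  -- that `wd-shuffles` is an equality of lists of terms.
  shuffles : List A → List B → List (List (A ⊎ B))
  shuffles []          ys          = [ map inj₂ ys ]
  shuffles xs@(_ ∷ _)  []          = [ map inj₁ xs ]
  shuffles xs@(x ∷ xs′) ys@(y ∷ ys′) = map (inj₁ x ∷_) (shuffles xs′ ys) ++ map (inj₂ y ∷_) (shuffles xs ys′)

  lefts-inj₁ : ∀ xs → lefts (map inj₁ xs) ≡ xs
  lefts-inj₁ []       = refl
  lefts-inj₁ (x ∷ xs) = cong (x ∷_) (lefts-inj₁ xs)

  rights-inj₁ : ∀ xs → rights (map inj₁ xs) ≡ []
  rights-inj₁ []       = refl
  rights-inj₁ (x ∷ xs) = rights-inj₁ xs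

  lefts-inj₂ : ∀ ys → lefts (map inj₂ ys) ≡ []
  lefts-inj₂ []       = refl
  lefts-inj₂ (y ∷ ys) = lefts-inj₂ ys

  rights-inj₂ : ∀ ys → rights (map inj₂ ys) ≡ ys
  rights-inj₂ []       = refl
  rights-inj₂ (y ∷ ys) = cong (y ∷_) (rights-inj₂ ys)

  lefts-++ : ∀ l l′ → lefts (l ++ l′) ≡ lefts l ++ lefts l′
  lefts-++ []           l′ = refl
  lefts-++ (inj₁ a ∷ l) l′ = cong (a ∷_) (lefts-++ l l′)
  lefts-++ (inj₂ b ∷ l) l′ = lefts-++ l l′

  rights-++ : ∀ l l′ → rights (l ++ l′) ≡ rights l ++ rights l′
  rights-++ []           l′ = refl
  rights-++ (inj₁ a ∷ l) l′ = rights-++ l l′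
  rights-++ (inj₂ b ∷ l) l′ = cong (b ∷_) (rights-++ l l′)

  rights≡[] : ∀ l → rights l ≡ [] → l ≡ map inj₁ (lefts l)
  rights≡[] []           _  = refl
  rights≡[] (inj₁ a ∷ l) eq = cong (inj₁ a ∷_) (rights≡[] l eq)

  lefts≡[] : ∀ l → lefts l ≡ [] → l ≡ map inj₂ (rights l)
  lefts≡[] []           _  = refl
  lefts≡[] (inj₂ b ∷ l) eq = cong (inj₂ b ∷_) (lefts≡[] l eq)

  ∈-lefts⁺ : ∀ {a l} → inj₁ a ∈ l → a ∈ lefts l
  ∈-lefts⁺ {l = inj₁ _ ∷ _} (here refl) = here refl
  ∈-lefts⁺ {l = inj₁ _ ∷ _} (there p)   = there (∈-lefts⁺ p)
  ∈-lefts⁺ {l = inj₂ _ ∷ _} (there p)   = ∈-lefts⁺ p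

  ∈-lefts⁻ : ∀ {a} l → a ∈ lefts l → inj₁ a ∈ l
  ∈-lefts⁻ (inj₁ _ ∷ l) (here refl) = here refl
  ∈-lefts⁻ (inj₁ _ ∷ l) (there p)   = there (∈-lefts⁻ l p)
  ∈-lefts⁻ (inj₂ _ ∷ l) p           = there (∈-lefts⁻ l p)

  ∈-rights⁺ : ∀ {b l} → inj₂ b ∈ l → b ∈ rights l
  ∈-rights⁺ {l = inj₂ _ ∷ _} (here refl) = here refl
  ∈-rights⁺ {l = inj₂ _ ∷ _} (there p)   = there (∈-rights⁺ p)
  ∈-rights⁺ {l = inj₁ _ ∷ _} (there p)   = ∈-rights⁺ p

  ∈-rights⁻ : ∀ {b} l → b ∈ rights l → inj₂ b ∈ l
  ∈-rights⁻ (inj₂ _ ∷ l) (here refl) = here refl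
  ∈-rights⁻ (inj₂ _ ∷ l) (there p)   = there (∈-rights⁻ l p)
  ∈-rights⁻ (inj₁ _ ∷ l) p           = there (∈-rights⁻ l p)

  ∈-shuffles⁻ : ∀ xs ys {l} → l ∈ shuffles xs ys → lefts l ≡ xs × rights l ≡ ys
  ∈-shuffles⁻ []       ys       (here refl) = lefts-inj₂ ys , rights-inj₂ ys
  ∈-shuffles⁻ (x ∷ xs) []       (here refl) = lefts-inj₁ (x ∷ xs) , rights-inj₁ (x ∷ xs)
  ∈-shuffles⁻ (x ∷ xs) (y ∷ ys) p with ∈-++⁻ (map (inj₁ x ∷_) (shuffles xs (y ∷ ys))) p
  ... | inj₁ q with ∈-map⁻ (inj₁ x ∷_) q
  ...   | _ , r , refl = let eq , eq′ = ∈-shuffles⁻ xs (y ∷ ys) r in cong (x ∷_) eq , eq′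
  ∈-shuffles⁻ (x ∷ xs) (y ∷ ys) p | inj₂ q with ∈-map⁻ (inj₂ y ∷_) q
  ...   | _ , r , refl = let eq , eq′ = ∈-shuffles⁻ (x ∷ xs) ys r in eq , cong (y ∷_) eq′

  ∈-shuffles⁺ : ∀ l → l ∈ shuffles (lefts l) (rights l)
  ∈-shuffles⁺ []           = here refl
  ∈-shuffles⁺ (inj₁ a ∷ l) with rights l in eq | ∈-shuffles⁺ l
  ... | []    | _ = here (cong (inj₁ a ∷_) (rights≡[] l eq))
  ... | _ ∷ _ | p = ∈-++⁺ˡ (∈-map⁺ (inj₁ a ∷_) p)
  ∈-shuffles⁺ (inj₂ b ∷ l) with lefts l in eq | ∈-shuffles⁺ l
  ... | []    | _ = here (cong (inj₂ b ∷_) (lefts≡[] l eq))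
  ... | x ∷ xs | p = ∈-++⁺ʳ (map (inj₁ x ∷_) (shuffles xs (b ∷ rights l))) (∈-map⁺ (inj₂ b ∷_) p)

  shuffles-unique : ∀ xs ys → Unique (shuffles xs ys)
  shuffles-unique []       ys       = [] ∷ []
  shuffles-unique (x ∷ xs) []       = [] ∷ []
  shuffles-unique (x ∷ xs) (y ∷ ys) = Unique.++⁺
    (Unique.map⁺ (λ { refl → refl }) (shuffles-unique xs (y ∷ ys)))
    (Unique.map⁺ (λ { refl → refl }) (shuffles-unique (x ∷ xs) ys))
    λ (p , q) → let _ , _ , eq  = ∈-map⁻ (inj₁ x ∷_) p
                    _ , _ , eq′ = ∈-map⁻ (inj₂ y ∷_) q
                in case trans (sym eq) eq′ of λ ()

  wd-shuffles : ∀ (δ : A → Letter) (δ′ : B → Letter) xs ys →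
                map (λ l → 1ℚ , wd [ δ , δ′ ]′ l) (shuffles xs ys) ≡ wd δ xs shʷ wd δ′ ys
  wd-shuffles δ δ′ []       ys       = cong (λ w → [ 1ℚ , w ]) (wd-map _ inj₂ ys)
  wd-shuffles δ δ′ (x ∷ xs) []       = cong (λ w → [ 1ℚ , w ∙ δ x ]) (wd-map _ inj₁ xs)
  wd-shuffles δ δ′ (x ∷ xs) (y ∷ ys) = trans (map-++ _ (map (inj₁ x ∷_) (shuffles xs (y ∷ ys))) _)
    (cong₂ _++_ (push (inj₁ x) (shuffles xs (y ∷ ys)) (wd-shuffles δ δ′ xs (y ∷ ys)))
                (push (inj₂ y) (shuffles (x ∷ xs) ys) (wd-shuffles δ δ′ (x ∷ xs) ys)))
    where
    push : ∀ p ls {h} → map (λ l → 1ℚ , wd [ δ , δ′ ]′ l) ls ≡ h →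
           map (λ l → 1ℚ , wd [ δ , δ′ ]′ l) (map (p ∷_) ls) ≡ h ∙ᴴ [ δ , δ′ ]′ p
    push p ls refl = trans (sym (map-∘ ls)) (map-∘ ls)

  insertions : List A → List (List B) → List (List (A ⊎ B))
  insertions xs = concatMap (shuffles xs)

  ∈-insertions⁻ : ∀ xs ls {l} → l ∈ insertions xs ls → lefts l ≡ xs × rights l ∈ ls
  ∈-insertions⁻ xs ls p =
    let ys , ys∈ls , q = find (∈-concatMap⁻ (shuffles xs) {xs = ls} p)
        eq , eq′ = ∈-shuffles⁻ xs ys q
    in eq , subst (_∈ ls) (sym eq′) ys∈ls

  ∈-insertions⁺ : ∀ xs ls {l} → lefts l ≡ xs → rights l ∈ ls → l ∈ insertions xs ls
  ∈-insertions⁺ xs ls {l} refl p = ∈-concatMap⁺ (shuffles xs) (lose p (∈-shuffles⁺ l))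

  insertions-unique : ∀ xs {ls} → Unique ls → Unique (insertions xs ls)
  insertions-unique xs {ls} u = Unique.concat⁺ (All.map⁺ (All.universal (shuffles-unique xs) ls))
    (AllPairs.map⁺ (AllPairs.map (λ {ys} {zs} ys≢zs {_} (p , q) →
      ys≢zs (trans (sym (proj₂ (∈-shuffles⁻ xs ys p))) (proj₂ (∈-shuffles⁻ xs zs q)))) u))

-- Lists run from the top down, so this places `p` above `q`. `Before p p` expresses a repetition,
-- which is how duplicates are excluded below.
data Before {A : Set} (p q : A) : List A → Set where
  here  : ∀ {l} → q ∈ l → Before p q (p ∷ l)
  there : ∀ {x l} → Before p q l → Before p q (x ∷ l)

before? : ∀ {A : Set} → DecidableEquality A → ∀ p q l → Dec (Before {A} p q l)
before? _≟_ p q [] = no λ ()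
before? _≟_ p q (x ∷ l) with before? _≟_ p q l
... | yes b = yes (there b)
... | no ¬b with p ≟ x
...   | no p≢x = no λ { (here _) → p≢x refl ; (there b) → ¬b b }
...   | yes refl = Dec.map′ here (λ { (here q∈l) → q∈l ; (there b) → contradiction b ¬b }) (q ∈? l)
  where open DecMembership _≟_ using (_∈?_)

before-map⁺ : ∀ {A B : Set} (f : A → B) {p q l} → Before p q l → Before (f p) (f q) (map f l)
before-map⁺ f (here q∈l) = here (∈-map⁺ f q∈l)
before-map⁺ f (there b)  = there (before-map⁺ f b)

module _ {A B : Set} where
  before-lefts⁺ : ∀ {p q : A} {l : List (A ⊎ B)} → Before (inj₁ p) (inj₁ q) l → Before p q (lefts l)
  before-lefts⁺ (here q∈l)               = here (∈-lefts⁺ q∈l)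
  before-lefts⁺ (there {x = inj₁ _} b)   = there (before-lefts⁺ b)
  before-lefts⁺ (there {x = inj₂ _} b)   = before-lefts⁺ b

  before-lefts⁻ : ∀ {p q : A} (l : List (A ⊎ B)) → Before p q (lefts l) → Before (inj₁ p) (inj₁ q) l
  before-lefts⁻ (inj₁ _ ∷ l) (here q∈l) = here (∈-lefts⁻ l q∈l)
  before-lefts⁻ (inj₁ _ ∷ l) (there b)  = there (before-lefts⁻ l b)
  before-lefts⁻ (inj₂ _ ∷ l) b          = there (before-lefts⁻ l b)

  before-rights⁺ : ∀ {p q : B} {l : List (A ⊎ B)} → Before (inj₂ p) (inj₂ q) l → Before p q (rights l)
  before-rights⁺ (here q∈l)             = here (∈-rights⁺ q∈l)
  before-rights⁺ (there {x = inj₁ _} b) = before-rights⁺ b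
  before-rights⁺ (there {x = inj₂ _} b) = there (before-rights⁺ b)

  before-rights⁻ : ∀ {p q : B} (l : List (A ⊎ B)) → Before p q (rights l) → Before (inj₂ p) (inj₂ q) l
  before-rights⁻ (inj₂ _ ∷ l) (here q∈l) = here (∈-rights⁻ l q∈l)
  before-rights⁻ (inj₂ _ ∷ l) (there b)  = there (before-rights⁻ l b)
  before-rights⁻ (inj₁ _ ∷ l) b          = there (before-rights⁻ l b)

  -- If the top τ of the second chain is not above the bottom β of the first, then no element of the
  -- second is above any element of the first, and the two form a single chain.
  stacked⁺ : ∀ {β τ} xs ys m → lefts {A} {B} m ≡ xs ∷ʳ β → rights m ≡ τ ∷ ys →
             ¬ Before (inj₂ τ) (inj₁ β) m → m ≡ map inj₁ (xs ∷ʳ β) ++ map inj₂ (τ ∷ ys)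
  stacked⁺ []       ys (inj₁ x ∷ m) eq eq′ ¬b with ∷-injective eq
  ... | refl , none = cong (inj₁ x ∷_) (trans (lefts≡[] m none) (cong (map inj₂) eq′))
  stacked⁺ (x ∷ xs) ys (inj₁ _ ∷ m) eq eq′ ¬b with ∷-injective eq
  ... | refl , eq″ = cong (inj₁ x ∷_) (stacked⁺ xs ys m eq″ eq′ (¬b ∘ there))
  stacked⁺ {β} xs   ys (inj₂ y ∷ m) eq eq′ ¬b with ∷-injective eq′
  ... | refl , _ = contradiction (here (∈-lefts⁻ m (subst (β ∈_) (sym eq) (∈-++⁺ʳ xs (here refl))))) ¬b

  stacked⁻ : ∀ {β : A} {τ : B} xs ys → ¬ Before (inj₂ τ) (inj₁ β) (map inj₁ xs ++ map inj₂ ys)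
  stacked⁻ (x ∷ xs) ys (there b) = stacked⁻ xs ys b
  stacked⁻ []       (y ∷ ys) (here q) = case ∈-map⁻ inj₂ q of λ ()
  stacked⁻ []       (y ∷ ys) (there b) = stacked⁻ [] ys b

  lefts-stacked : ∀ (xs : List A) (ys : List B) → lefts (map inj₁ xs ++ map inj₂ ys) ≡ xs
  lefts-stacked xs ys = trans (lefts-++ (map inj₁ xs) _)
    (trans (cong₂ _++_ (lefts-inj₁ xs) (lefts-inj₂ ys)) (++-identityʳ xs))

  rights-stacked : ∀ (xs : List A) (ys : List B) → rights (map inj₁ xs ++ map inj₂ ys) ≡ ys
  rights-stacked xs ys = trans (rights-++ (map inj₁ xs) _) (cong₂ _++_ (rights-inj₁ xs) (rights-inj₂ ys))

module _ {A B D : Set} where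
  -- Used when the chain in `A` is stacked on the first column `B`: the merged chain lives in
  -- `A ⊎ B`, and the remaining columns in `D`.
  assoc : A ⊎ (B ⊎ D) → (A ⊎ B) ⊎ D
  assoc (inj₁ a)        = inj₁ (inj₁ a)
  assoc (inj₂ (inj₁ b)) = inj₁ (inj₂ b)
  assoc (inj₂ (inj₂ d)) = inj₂ d

  assoc⁻¹ : (A ⊎ B) ⊎ D → A ⊎ (B ⊎ D)
  assoc⁻¹ (inj₁ (inj₁ a)) = inj₁ a
  assoc⁻¹ (inj₁ (inj₂ b)) = inj₂ (inj₁ b)
  assoc⁻¹ (inj₂ d)        = inj₂ (inj₂ d)

  assoc-assoc⁻¹ : ∀ p → assoc (assoc⁻¹ p) ≡ p
  assoc-assoc⁻¹ (inj₁ (inj₁ a)) = refl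
  assoc-assoc⁻¹ (inj₁ (inj₂ b)) = refl
  assoc-assoc⁻¹ (inj₂ d)        = refl

  assoc⁻¹-assoc : ∀ p → assoc⁻¹ (assoc p) ≡ p
  assoc⁻¹-assoc (inj₁ a)        = refl
  assoc⁻¹-assoc (inj₂ (inj₁ b)) = refl
  assoc⁻¹-assoc (inj₂ (inj₂ d)) = refl

  lefts-lefts : ∀ l → lefts (lefts (map assoc l)) ≡ lefts l
  lefts-lefts []                  = refl
  lefts-lefts (inj₁ a ∷ l)        = cong (a ∷_) (lefts-lefts l)
  lefts-lefts (inj₂ (inj₁ b) ∷ l) = lefts-lefts l
  lefts-lefts (inj₂ (inj₂ d) ∷ l) = lefts-lefts l

  rights-lefts : ∀ l → rights (lefts (map assoc l)) ≡ lefts (rights l)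
  rights-lefts []                  = refl
  rights-lefts (inj₁ a ∷ l)        = rights-lefts l
  rights-lefts (inj₂ (inj₁ b) ∷ l) = cong (b ∷_) (rights-lefts l)
  rights-lefts (inj₂ (inj₂ d) ∷ l) = rights-lefts l

  rights-assoc : ∀ l → rights (map assoc l) ≡ rights (rights l)
  rights-assoc []                  = refl
  rights-assoc (inj₁ a ∷ l)        = rights-assoc l
  rights-assoc (inj₂ (inj₁ b) ∷ l) = rights-assoc l
  rights-assoc (inj₂ (inj₂ d) ∷ l) = cong (d ∷_) (rights-assoc l)

  map-assoc-assoc⁻¹ : ∀ l → map assoc (map assoc⁻¹ l) ≡ l
  map-assoc-assoc⁻¹ []      = refl
  map-assoc-assoc⁻¹ (p ∷ l) = cong₂ _∷_ (assoc-assoc⁻¹ p) (map-assoc-assoc⁻¹ l)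

  map-assoc⁻¹-assoc : ∀ l → map assoc⁻¹ (map assoc l) ≡ l
  map-assoc⁻¹-assoc []      = refl
  map-assoc⁻¹-assoc (p ∷ l) = cong₂ _∷_ (assoc⁻¹-assoc p) (map-assoc⁻¹-assoc l)

-- Linear orders of the columns and their values

labelᶠ : ∀ {n} → Fin n → Letter
labelᶠ zero    = 𝑦
labelᶠ (suc _) = 𝑥

-- The elements of X⋆ as a nested sum, so that splitting off the first column is pattern matching.
Column : Index → Set
Column []       = ⊥
Column (k ∷ ks) = Fin (val k) ⊎ Column ks

label : ∀ ks → Column ks → Letter
label (k ∷ ks) = [ labelᶠ , label ks ]′

columnDec : ∀ ks → DecidableEquality (Column ks)
columnDec (k ∷ ks) = ⊎-≡-dec Fin._≟_ (columnDec ks)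

descending : ∀ n → List (Fin n)
descending zero    = []
descending (suc n) = map suc (descending n) ∷ʳ zero

top : ∀ k → Fin (val k)
top (1+ j) = fromℕ j

descending-top : ∀ k → ∃ λ l → descending (val k) ≡ top k ∷ l
descending-top (1+ zero)  = [] , refl
descending-top (1+ suc j) = let l , eq = descending-top (1+ j) in
  map suc l ∷ʳ zero , cong (λ m → map suc m ∷ʳ zero) eq

wd-descending : ∀ k → wd labelᶠ (descending (val k)) ≡ z k
wd-descending (1+ j) = trans (below j) (columns j)
  where
  X : ℕ → Word
  X n = wd (λ _ → 𝑥) (descending n)

  below : ∀ n → wd labelᶠ (descending (suc n)) ≡ (ε ∙ 𝑦) · X n
  below n = trans (wd-++ labelᶠ (map suc (descending n)) [ zero ]) (cong ((ε ∙ 𝑦) ·_) (wd-map labelᶠ suc (descending n)))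

  X-suc : ∀ n → X (suc n) ≡ (ε ∙ 𝑥) · X n
  X-suc n = trans (wd-++ (λ _ → 𝑥) (map suc (descending n)) [ zero ]) (cong ((ε ∙ 𝑥) ·_) (wd-map (λ _ → 𝑥) suc (descending n)))

  -- A word in 𝑥 alone grows in the same way at both ends.
  X-∙ : ∀ n → (ε ∙ 𝑥) · X n ≡ X n ∙ 𝑥
  X-∙ zero    = refl
  X-∙ (suc n) = trans (cong ((ε ∙ 𝑥) ·_) (trans (X-suc n) (X-∙ n))) (cong (_∙ 𝑥) (sym (X-suc n)))

  columns : ∀ n → (ε ∙ 𝑦) · X n ≡ z (1+ n)
  columns zero    = refl
  columns (suc n) = trans (cong ((ε ∙ 𝑦) ·_) (trans (X-suc n) (X-∙ n))) (cong (_∙ 𝑥) (columns n))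

-- β lies below the top element of the first column
Below : ∀ {A : Set} → A → ∀ ks → List (A ⊎ Column ks) → Set
Below β []       l = ⊤
Below β (k ∷ ks) l = Before (inj₂ (inj₁ (top k))) (inj₁ β) l

below? : ∀ {A : Set} → DecidableEquality A → ∀ β ks l → Dec (Below {A} β ks l)
below? _≟_ β []       l = yes tt
below? _≟_ β (k ∷ ks) l = before? (⊎-≡-dec _≟_ (columnDec (k ∷ ks))) _ _ l

mutual
  -- `xs` is a chain in an arbitrary type with bottom `β`. This generality is forced by the
  -- induction of `⟨⟩-chain`, which merges one column after another into the chain.
  ordersBelow : ∀ {A : Set} → DecidableEquality A → A → ∀ ks → List A → List (List (A ⊎ Column ks))
  ordersBelow _≟_ β ks xs = filter (below? _≟_ β ks) (insertions xs (orders ks))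

  orders : ∀ ks → List (List (Column ks))
  orders []       = [ [] ]
  orders (k ∷ ks) = ordersBelow Fin._≟_ zero ks (descending (val k))

mutual
  ordersBelow-unique : ∀ {A : Set} (_≟_ : DecidableEquality A) β ks xs → Unique (ordersBelow _≟_ β ks xs)
  ordersBelow-unique _≟_ β ks xs = Unique.filter⁺ (below? _≟_ β ks) (insertions-unique xs (orders-unique ks))

  orders-unique : ∀ ks → Unique (orders ks)
  orders-unique []       = [] ∷ []
  orders-unique (k ∷ ks) = ordersBelow-unique Fin._≟_ zero ks (descending (val k))

module _ {A : Set} (_≟_ : DecidableEquality A) (β : A) (ks : Index) (xs : List A) {l : List (A ⊎ Column ks)} where
  ∈-ordersBelow⁻ : l ∈ ordersBelow _≟_ β ks xs → lefts l ≡ xs × rights l ∈ orders ks × Below β ks l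
  ∈-ordersBelow⁻ p = let q , b = ∈-filter⁻ (below? _≟_ β ks) {xs = insertions xs (orders ks)} p
                         ll , r = ∈-insertions⁻ xs (orders ks) q in ll , r , b

  ∈-ordersBelow⁺ : lefts l ≡ xs → rights l ∈ orders ks → Below β ks l → l ∈ ordersBelow _≟_ β ks xs
  ∈-ordersBelow⁺ ll r = ∈-filter⁺ (below? _≟_ β ks) (∈-insertions⁺ xs (orders ks) ll r)

-- K ψ t ks is the value of the linear extensions of X⋆ ks together with a chain with
-- word zʷ t whose bottom element lies below the top of the first column.
K : (Word → ℝ) → Index → Index → ℝ
K ψ t []       = ψ (zʷ t)
K ψ t (k ∷ ks) = ψ (zʷ t) ⊗ K ψ [ k ] ks ⊕ ⊖ K ψ (k ∷ t) ks

words : ∀ {A : Set} → (A → Letter) → List (List A) → 𝔥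
words δ = map (λ l → 1ℚ , wd δ l)

⟨⟩-++ : ∀ ψ g h → ⟨ ψ , g ++ h ⟩ ≈ᴿ ⟨ ψ , g ⟩ ⊕ ⟨ ψ , h ⟩
⟨⟩-++ ψ []            h = Real.sym (Real.+-identityˡ _)
⟨⟩-++ ψ ((q , w) ∷ g) h = Real.trans (⊕-cong ≈-refl (⟨⟩-++ ψ g h)) (Real.sym (Real.+-assoc _ _ _))

⟨⟩-↭ : ∀ ψ {g h} → g ↭ h → ⟨ ψ , g ⟩ ≈ᴿ ⟨ ψ , h ⟩
⟨⟩-↭ ψ ↭.refl                         = ≈-refl
⟨⟩-↭ ψ (↭.prep _ p)                   = ⊕-cong ≈-refl (⟨⟩-↭ ψ p)
⟨⟩-↭ ψ (↭.swap (q , v) (q′ , w) p) = Real.trans (⊕-cong ≈-refl (⊕-cong ≈-refl (⟨⟩-↭ ψ p)))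
  (Real.trans (Real.sym (Real.+-assoc _ _ _)) (Real.trans (⊕-cong (Real.+-comm _ _) ≈-refl) (Real.+-assoc _ _ _)))
⟨⟩-↭ ψ (↭.trans p p′)                 = ≈-trans (⟨⟩-↭ ψ p) (⟨⟩-↭ ψ p′)

⟨⟩-filter : ∀ ψ {A : Set} (δ : A → Letter) {P : List A → Set} (P? : ∀ l → Dec (P l)) ls →
            ⟨ ψ , words δ ls ⟩ ≈ᴿ ⟨ ψ , words δ (filter P? ls) ⟩ ⊕ ⟨ ψ , words δ (filter (¬? ∘ P?) ls) ⟩
⟨⟩-filter ψ δ P? []       = Real.sym (Real.+-identityˡ _)
⟨⟩-filter ψ δ P? (l ∷ ls) with P? l
... | yes _ = Real.trans (⊕-cong ≈-refl (⟨⟩-filter ψ δ P? ls)) (Real.sym (Real.+-assoc _ _ _))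
... | no _  = Real.trans (⊕-cong ≈-refl (⟨⟩-filter ψ δ P? ls)) (Real.trans (Real.sym (Real.+-assoc _ _ _))
  (Real.trans (⊕-cong (Real.+-comm _ _) ≈-refl) (Real.+-assoc _ _ _)))

⟨⟩-one : ∀ (ψ : Word → ℝ) w → fromℚ 1ℚ ⊗ ψ w ≈ᴿ ψ w
⟨⟩-one ψ w = Real.*-identityˡ (ψ w)

unique-↭ : ∀ {A : Set} {xs ys : List A} → Unique xs → Unique ys →
           (∀ {x} → x ∈ xs → x ∈ ys) → (∀ {x} → x ∈ ys → x ∈ xs) → xs ↭ ys
unique-↭ u v to from = ∼bag⇒↭ (unique∧set⇒bag u v (mk⇔ to from))

module Chains {ψ} (char : ShuffleCharacter ψ) where
  open ShuffleCharacter char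
  open ≈ᴿ-Reasoning

  -- With no relation between the chain and the columns every interleaving is allowed, and the
  -- interleavings form a shuffle product.
  ⟨⟩-insertions : ∀ {A B : Set} (δ : A → Letter) (δ′ : B → Letter) xs ls →
                  Word¹ (wd δ xs) → All (Word¹ ∘ wd δ′) ls →
                  ⟨ ψ , words [ δ , δ′ ]′ (insertions xs ls) ⟩ ≈ᴿ ψ (wd δ xs) ⊗ ⟨ ψ , words δ′ ls ⟩
  ⟨⟩-insertions δ δ′ xs []       p []       = Real.sym (Real.zeroʳ _)
  ⟨⟩-insertions δ δ′ xs (l ∷ ls) p (q ∷ qs) = begin
    ⟨ ψ , words [ δ , δ′ ]′ (shuffles xs l ++ insertions xs ls) ⟩
      ≡⟨ cong ⟨ ψ ,_⟩ (map-++ _ (shuffles xs l) (insertions xs ls)) ⟩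
    ⟨ ψ , words [ δ , δ′ ]′ (shuffles xs l) ++ words [ δ , δ′ ]′ (insertions xs ls) ⟩
      ≈⟨ ⟨⟩-++ ψ (words [ δ , δ′ ]′ (shuffles xs l)) _ ⟩
    ⟨ ψ , words [ δ , δ′ ]′ (shuffles xs l) ⟩ ⊕ ⟨ ψ , words [ δ , δ′ ]′ (insertions xs ls) ⟩
      ≈⟨ ⊕-cong (≈-trans (Real.reflexive (cong ⟨ ψ ,_⟩ (wd-shuffles δ δ′ xs l))) (≈-sym (ψ-sh p q)))
                (⟨⟩-insertions δ δ′ xs ls p qs) ⟩
    ψ (wd δ xs) ⊗ ψ (wd δ′ l) ⊕ ψ (wd δ xs) ⊗ ⟨ ψ , words δ′ ls ⟩
      ≈⟨ ⊕-cong (⊗-cong ≈-refl (⟨⟩-one ψ (wd δ′ l))) ≈-refl ⟨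
    ψ (wd δ xs) ⊗ (fromℚ 1ℚ ⊗ ψ (wd δ′ l)) ⊕ ψ (wd δ xs) ⊗ ⟨ ψ , words δ′ ls ⟩
      ≈⟨ Real.distribˡ _ _ _ ⟨
    ψ (wd δ xs) ⊗ ⟨ ψ , words δ′ (l ∷ ls) ⟩ ∎

  orders-word¹ : ∀ ks → All (Word¹ ∘ wd (label ks)) (orders ks)
  orders-word¹ []       = one ∷ []
  orders-word¹ (k ∷ ks) = All.filter⁺ (below? Fin._≟_ zero ks) (All.concat⁺ (All.map⁺ (All.map
    (λ {l} p → All.map⁻ (subst (All (Word¹ ∘ proj₂)) (sym (wd-shuffles labelᶠ (label ks) (descending (val k)) l))
      (Words.shʷ-word¹ (subst Word¹ (sym (wd-descending k)) (Words.StartsY⇒Word¹ (Words.z-startsY k))) p)))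
    (orders-word¹ ks))))

  -- In an order that violates the relation, β lies above the top of column `k`, hence the whole
  -- chain lies above the whole column. The merged chain ends in the bottom `zero` of the column,
  -- which still has to lie below the top of the next one: the same problem with one column less.
  restack : ∀ {A : Set} (_≟_ : DecidableEquality A) xs β k ks → let a = xs ∷ʳ β ; d = descending (val k) in
    map (map assoc) (filter (¬? ∘ below? _≟_ β (k ∷ ks)) (insertions a (orders (k ∷ ks))))
      ↭ ordersBelow (⊎-≡-dec _≟_ Fin._≟_) (inj₂ zero) ks (map inj₁ a ++ map inj₂ d)
  restack {A} _≟_ xs β k ks = unique-↭
    (Unique.map⁺ (λ {l} {l′} eq → trans (sym (map-assoc⁻¹-assoc l)) (trans (cong (map assoc⁻¹) eq) (map-assoc⁻¹-assoc l′)))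
      (Unique.filter⁺ above? (insertions-unique a (orders-unique (k ∷ ks)))))
    (ordersBelow-unique dec (inj₂ zero) ks (map inj₁ a ++ map inj₂ d))
    to from
    where
    a = xs ∷ʳ β
    d = descending (val k)
    rest = proj₁ (descending-top k)
    d≡ : d ≡ top k ∷ rest
    d≡ = proj₂ (descending-top k)
    dec = ⊎-≡-dec _≟_ Fin._≟_
    above? = ¬? ∘ below? _≟_ β (k ∷ ks)
    source = insertions a (orders (k ∷ ks))
    target = ordersBelow dec (inj₂ zero) ks (map inj₁ a ++ map inj₂ d)

    unassoc : ∀ {D : Set} {p q} (l : List (A ⊎ (Fin (val k) ⊎ D))) → Before (assoc p) (assoc q) (map assoc l) → Before p q l
    unassoc {p = p} {q} l b = subst₂ (λ p q → Before p q l) (assoc⁻¹-assoc p) (assoc⁻¹-assoc q)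
      (subst (Before _ _) (map-assoc⁻¹-assoc l) (before-map⁺ assoc⁻¹ b))

    below-to : ∀ ks (l : List (A ⊎ Column (k ∷ ks))) → Below zero ks (rights l) → Below (inj₂ zero) ks (map assoc l)
    below-to []       l b = tt
    below-to (_ ∷ ks) l b = before-map⁺ assoc (before-rights⁻ l b)

    below-from : ∀ ks (l : List (A ⊎ Column (k ∷ ks))) → Below (inj₂ zero) ks (map assoc l) → Below zero ks (rights l)
    below-from []       l b = tt
    below-from (_ ∷ ks) l b = before-rights⁺ (unassoc l b)

    to : ∀ {l} → l ∈ map (map assoc) (filter above? source) → l ∈ target
    to p with ∈-map⁻ (map assoc) p
    ... | l , q , refl with ∈-filter⁻ above? {xs = source} q
    ...   | q′ , ¬b with ∈-insertions⁻ a (orders (k ∷ ks)) q′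
    ...     | la , r with ∈-ordersBelow⁻ Fin._≟_ zero ks d r
    ...       | ld , s , b = ∈-ordersBelow⁺ dec (inj₂ zero) ks _
      (trans (stacked⁺ xs rest (lefts (map assoc l)) (trans (lefts-lefts l) la) (trans (rights-lefts l) (trans ld d≡))
               λ b′ → ¬b (unassoc l (before-lefts⁻ (map assoc l) b′)))
             (cong (λ e → map inj₁ a ++ map inj₂ e) (sym d≡)))
      (subst (_∈ orders ks) (sym (rights-assoc l)) s)
      (below-to ks l b)

    from : ∀ {l} → l ∈ target → l ∈ map (map assoc) (filter above? source)
    from {l} p with ∈-ordersBelow⁻ dec (inj₂ zero) ks (map inj₁ a ++ map inj₂ d) p
    ... | ll , r , b = subst (_∈ _) l≡ (∈-map⁺ (map assoc) (∈-filter⁺ above?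
        (∈-insertions⁺ a (orders (k ∷ ks))
          (trans (sym (lefts-lefts l′)) (trans (cong (lefts ∘ lefts) l≡) (trans (cong lefts ll) (lefts-stacked a d))))
          (∈-ordersBelow⁺ Fin._≟_ zero ks d
            (trans (sym (rights-lefts l′)) (trans (cong (rights ∘ lefts) l≡) (trans (cong rights ll) (rights-stacked a d))))
            (subst (_∈ orders ks) (trans (cong rights (sym l≡)) (rights-assoc l′)) r)
            (below-from ks l′ (subst (Below (inj₂ zero) ks) (sym l≡) b))))
        λ b′ → stacked⁻ a d (subst (Before _ _) (trans (cong lefts l≡) ll) (before-lefts⁺ (before-map⁺ assoc b′)))))
      where
      l′ = map assoc⁻¹ l
      l≡ : map assoc l′ ≡ l
      l≡ = map-assoc-assoc⁻¹ l

  ⟨⟩-orders : ∀ k ks → ⟨ ψ , words (label (k ∷ ks)) (orders (k ∷ ks)) ⟩ ≈ᴿ K ψ [ k ] ks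

  -- The orders with β below the top are all insertions minus those of `restack`. The former give a
  -- product by `⟨⟩-insertions`, the latter a longer chain, and this is the recursion of `K`.
  ⟨⟩-chain : ∀ ks {A : Set} (_≟_ : DecidableEquality A) (δ : A → Letter) t {a} xs β → a ≡ xs ∷ʳ β → wd δ a ≡ zʷ t →
             ⟨ ψ , words [ δ , label ks ]′ (ordersBelow _≟_ β ks a) ⟩ ≈ᴿ K ψ t ks
  ⟨⟩-chain [] _≟_ δ t {a} xs β a≡ w≡ = begin
    ⟨ ψ , words δ⁺ (filter (below? _≟_ β []) (shuffles a [] ++ [])) ⟩
      ≡⟨ cong (λ ls → ⟨ ψ , words δ⁺ (filter (below? _≟_ β []) (ls ++ [])) ⟩) (alone a) ⟩
    fromℚ 1ℚ ⊗ ψ (wd δ⁺ (map inj₁ a)) ⊕ 0ᴿ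
      ≈⟨ ≈-trans (Real.+-identityʳ _) (⟨⟩-one ψ _) ⟩
    ψ (wd δ⁺ (map inj₁ a))
      ≡⟨ cong ψ (trans (wd-map _ inj₁ a) w≡) ⟩
    ψ (zʷ t) ∎
    where
    δ⁺ = [ δ , label [] ]′
    alone : ∀ {A B : Set} (a : List A) → shuffles {A} {B} a [] ≡ [ map inj₁ a ]
    alone []      = refl
    alone (_ ∷ _) = refl
  ⟨⟩-chain (k ∷ ks) {A} _≟_ δ t {a} xs β refl w≡ = begin
    f
      ≈⟨ Real.trans (Real.+-assoc f n (⊖ n)) (Real.trans (⊕-cong ≈-refl (Real.-‿inverseʳ n)) (Real.+-identityʳ f)) ⟨
    (f ⊕ n) ⊕ ⊖ n
      ≈⟨ ⊕-cong (⟨⟩-filter ψ δ⁺ (below? _≟_ β (k ∷ ks)) all) ≈-refl ⟨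
    ⟨ ψ , words δ⁺ all ⟩ ⊕ ⊖ n
      ≈⟨ ⊕-cong (≈-trans (⟨⟩-insertions δ (label (k ∷ ks)) a (orders (k ∷ ks)) (subst Word¹ (sym w≡) (zʷ-word¹ t)) (orders-word¹ (k ∷ ks)))
                  (⊗-cong (Real.reflexive (cong ψ w≡)) (⟨⟩-orders k ks)))
                (⊖-cong stacked) ⟩
    K ψ t (k ∷ ks) ∎
    where
    d′ = map suc (descending (ℕ⁺.pred k))
    δ⁺ : A ⊎ Column (k ∷ ks) → Letter
    δ⁺ = [ δ , label (k ∷ ks) ]′
    δ⁺⁺ = [ [ δ , labelᶠ ]′ , label ks ]′
    all = insertions a (orders (k ∷ ks))
    N = filter (¬? ∘ below? _≟_ β (k ∷ ks)) all
    f = ⟨ ψ , words δ⁺ (ordersBelow _≟_ β (k ∷ ks) a) ⟩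
    n = ⟨ ψ , words δ⁺ N ⟩

    relabel : ∀ l → wd δ⁺ l ≡ wd δ⁺⁺ (map assoc l)
    relabel l = trans (wd-cong (λ { (inj₁ _) → refl ; (inj₂ (inj₁ _)) → refl ; (inj₂ (inj₂ _)) → refl }) l) (sym (wd-map δ⁺⁺ assoc l))

    stacked : n ≈ᴿ K ψ (k ∷ t) ks
    stacked = begin
      n
        ≡⟨ cong ⟨ ψ ,_⟩ (trans (map-cong (λ l → cong (1ℚ ,_) (relabel l)) N) (map-∘ N)) ⟩
      ⟨ ψ , words δ⁺⁺ (map (map assoc) N) ⟩
        ≈⟨ ⟨⟩-↭ ψ (↭.map⁺ _ (restack _≟_ xs β k ks)) ⟩
      ⟨ ψ , words δ⁺⁺ (ordersBelow (⊎-≡-dec _≟_ Fin._≟_) (inj₂ zero) ks (map inj₁ a ++ map inj₂ (descending (val k)))) ⟩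
        ≈⟨ ⟨⟩-chain ks (⊎-≡-dec _≟_ Fin._≟_) [ δ , labelᶠ ]′ (k ∷ t) (map inj₁ a ++ map inj₂ d′) (inj₂ zero)
             (trans (cong (map inj₁ a ++_) (map-++ inj₂ d′ [ zero ])) (sym (++-assoc (map inj₁ a) _ _)))
             (trans (wd-++ [ δ , labelᶠ ]′ (map inj₁ a) _) (trans (cong₂ _·_
               (trans (wd-map [ δ , labelᶠ ]′ inj₂ (descending (val k))) (wd-descending k))
               (trans (wd-map [ δ , labelᶠ ]′ inj₁ a) w≡)) (sym (zʷ-∷ k t)))) ⟩
      K ψ (k ∷ t) ks ∎

  ⟨⟩-orders k ks = ⟨⟩-chain ks Fin._≟_ labelᶠ [ k ] (map suc (descending (ℕ⁺.pred k))) zero refl (trans (wd-descending k) (sym (Words.ε· (z k))))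

-- Agreement with the linear extensions that define `W`

before-∈ʳ : ∀ {A : Set} {p q : A} {l} → Before p q l → q ∈ l
before-∈ʳ (here q)  = there q
before-∈ʳ (there b) = there (before-∈ʳ b)

before-total : ∀ {A : Set} {p q : A} {l} → p ∈ l → q ∈ l → p ≢ q → Before p q l ⊎ Before q p l
before-total (here refl) (here refl) p≢q = contradiction refl p≢q
before-total (here refl) (there q)   p≢q = inj₁ (here q)
before-total (there p)   (here refl) p≢q = inj₂ (here p)
before-total (there p)   (there q)   p≢q = Sum.map there there (before-total p q p≢q)

before-antisym : ∀ {A : Set} {p q : A} {l} → Before p q l → Before q p l → Before p p l ⊎ Before q q l
before-antisym (here _)  (here p)   = inj₁ (here p)
before-antisym (here _)  (there b)  = inj₁ (here (before-∈ʳ b))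
before-antisym (there b) (here _)   = inj₂ (here (before-∈ʳ b))
before-antisym (there b) (there b′) = Sum.map there there (before-antisym b b′)

allPairs⇒before : ∀ {A : Set} {R : A → A → Set} {l} → AllPairs R l → ∀ {p q} → Before p q l → R p q
allPairs⇒before (r ∷ rs) (here q)  = All.lookup r q
allPairs⇒before (r ∷ rs) (there b) = allPairs⇒before rs b

before⇒allPairs : ∀ {A : Set} {R : A → A → Set} l → (∀ {p q} → Before p q l → R p q) → AllPairs R l
before⇒allPairs []      r = []
before⇒allPairs (x ∷ l) r = All.tabulate (r ∘ here) ∷ before⇒allPairs l (r ∘ there)

before-++ˡ : ∀ {A : Set} {p q : A} {l} m → Before p q l → Before p q (l ++ m)
before-++ˡ m (here q)  = here (∈-++⁺ˡ q)
before-++ˡ m (there b) = there (before-++ˡ m b)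

before-∷ʳ : ∀ {A : Set} {p q : A} {l} → p ∈ l → Before p q (l ∷ʳ q)
before-∷ʳ {l = x ∷ l} (here refl) = here (∈-++⁺ʳ l (here refl))
before-∷ʳ (there p)               = there (before-∷ʳ p)

before-reverse : ∀ {A : Set} {p q : A} {l} → Before p q l → Before q p (reverse l)
before-reverse {l = x ∷ l} (here q)  = subst (Before _ _) (sym (unfold-reverse x l)) (before-∷ʳ (Any.reverse⁺ q))
before-reverse {l = x ∷ l} (there b) = subst (Before _ _) (sym (unfold-reverse x l)) (before-++ˡ [ x ] (before-reverse b))

before-lookup⁻ : ∀ {A : Set} {n p q} (g : Vec A n) → Before p q (Vec.toList g) →
                 ∃ λ a → ∃ λ b → a Fin.< b × Vec.lookup g a ≡ p × Vec.lookup g b ≡ q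
before-lookup⁻ (x ∷ g) (here q)  =
  let q∈ = VecMembership.∈-toList⁻ q in zero , suc (VecAny.index q∈) , ℕ.s≤s ℕ.z≤n , refl , sym (VecAny.lookup-index q∈)
before-lookup⁻ (x ∷ g) (there b) = let i , j , i<j , eq , eq′ = before-lookup⁻ g b in
  suc i , suc j , ℕ.s≤s i<j , eq , eq′

before-lookup⁺ : ∀ {A : Set} {n} (g : Vec A n) {a b} → a Fin.< b → Before (Vec.lookup g a) (Vec.lookup g b) (Vec.toList g)
before-lookup⁺ (x ∷ g) {zero}  {suc b} _ = here (VecMembership.∈-toList⁺ (VecMembership.∈-lookup b g))
before-lookup⁺ (x ∷ g) {suc a} {suc b} (ℕ.s≤s l) = there (before-lookup⁺ g l)

sorted-unique : ∀ {n} {xs ys : List (Fin n)} → AllPairs Fin._>_ xs → AllPairs Fin._>_ ys →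
                (∀ {x} → x ∈ xs → x ∈ ys) → (∀ {x} → x ∈ ys → x ∈ xs) → xs ≡ ys
sorted-unique {xs = []}     {[]}     _ _ f g = refl
sorted-unique {xs = []}     {y ∷ ys} _ _ f g = case g (here refl) of λ ()
sorted-unique {xs = x ∷ xs} {[]}     _ _ f g = case f (here refl) of λ ()
sorted-unique {xs = x ∷ xs} {y ∷ ys} (p ∷ ps) (q ∷ qs) f g with f (here refl) | g (here refl)
... | here refl | _          = cong (x ∷_) (sorted-unique ps qs (tail p f) (tail q g))
  where
  tail : ∀ {as bs} → All (x Fin.>_) as → (∀ {a} → a ∈ x ∷ as → a ∈ x ∷ bs) → ∀ {a} → a ∈ as → a ∈ bs
  tail p f a∈ with f (there a∈)
  ... | here refl = contradiction (All.lookup p a∈) (ℕ.<-irrefl refl)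
  ... | there a∈′ = a∈′
... | there x∈  | here refl  = contradiction (All.lookup q x∈) (ℕ.<-irrefl refl)
... | there x∈  | there y∈   = contradiction (All.lookup q x∈) (ℕ.<-asym (All.lookup p y∈))

descending-sorted : ∀ n → AllPairs Fin._>_ (descending n)
descending-sorted zero    = []
descending-sorted (suc n) = AllPairs.++⁺ (AllPairs.map⁺ (AllPairs.map ℕ.s≤s (descending-sorted n))) ([] ∷ [])
  (All.map⁺ (All.universal (λ _ → ℕ.s≤s ℕ.z≤n ∷ []) (descending n)))

∈-descending : ∀ {n} (m : Fin n) → m ∈ descending n
∈-descending {suc n} zero    = ∈-++⁺ʳ (map suc (descending n)) (here refl)
∈-descending {suc n} (suc m) = ∈-++⁺ˡ (∈-map⁺ suc (∈-descending m))

length-descending : ∀ n → length (descending n) ≡ n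
length-descending zero    = refl
length-descending (suc n) = trans (length-++ (map suc (descending n))) (trans (ℕ.+-comm _ 1)
  (cong suc (trans (length-map suc (descending n)) (length-descending n))))

IsTop : ∀ ks → Column ks → Set
IsTop (k ∷ ks) c = c ≡ inj₁ (top k)

infix 4 _⊏_

-- Contains the generating relation (`⋖⇒⊏`) and is contained in its transitive closure (`⊏⇒≺`), so
-- it has the same linear extensions; unlike the closure it is given by recursion on the columns.
_⊏_ : ∀ {ks} → Column ks → Column ks → Set
_⊏_ {k ∷ ks} (inj₁ m) (inj₁ n) = m Fin.< n
_⊏_ {k ∷ ks} (inj₁ m) (inj₂ c) = m ≡ zero × IsTop ks c
_⊏_ {k ∷ ks} (inj₂ c) (inj₁ n) = ⊥
_⊏_ {k ∷ ks} (inj₂ c) (inj₂ d) = c ⊏ d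

record IsOrder ks (l : List (Column ks)) : Set where
  field
    complete   : ∀ c → c ∈ l
    distinct   : ∀ {c d} → Before c d l → c ≢ d
    compatible : ∀ {c d} → Before c d l → ¬ (c ⊏ d)
open IsOrder

order⇒∈ : ∀ ks {l} → IsOrder ks l → l ∈ orders ks
order⇒∈ []       {[]}    o = here refl
order⇒∈ (k ∷ ks) {l} o = ∈-ordersBelow⁺ Fin._≟_ zero ks (descending (val k))
    (sorted-unique (before⇒allPairs (lefts l) sorted) (descending-sorted (val k))
      (λ {m} _ → ∈-descending m) (λ {m} _ → ∈-lefts⁺ (complete o (inj₁ m))))
    (order⇒∈ ks record
      { complete   = λ c → ∈-rights⁺ (complete o (inj₂ c))
      ; distinct   = λ b eq → distinct o (before-rights⁻ l b) (cong inj₂ eq)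
      ; compatible = λ b → compatible o (before-rights⁻ l b) })
  (below ks l (complete o) (compatible o))
  where
  sorted : ∀ {m n} → Before m n (lefts l) → m Fin.> n
  sorted {m} {n} b with ℕ.<-cmp (toℕ m) (toℕ n)
  ... | tri< m<n _ _ = contradiction m<n (compatible o (before-lefts⁻ l b))
  ... | tri≈ _ m≡n _ = contradiction (cong inj₁ (Fin.toℕ-injective m≡n)) (distinct o (before-lefts⁻ l b))
  ... | tri> _ _ m>n = m>n
  below : ∀ ks (l : List (Fin (val k) ⊎ Column ks)) → (∀ c → c ∈ l) → (∀ {c d} → Before c d l → ¬ _⊏_ {k ∷ ks} c d) → Below zero ks l
  below []       l com cpt = tt
  below (k′ ∷ ks) l com cpt with before-total (com (inj₂ (inj₁ (top k′)))) (com (inj₁ zero)) (λ ())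
  ... | inj₁ b = b
  ... | inj₂ b = contradiction (refl , refl) (cpt b)

∈⇒order : ∀ ks {l} → l ∈ orders ks → IsOrder ks l
∈⇒order []       (here refl) = record { complete = λ () ; distinct = λ () ; compatible = λ () }
∈⇒order (k ∷ ks) {l} p with ∈-ordersBelow⁻ Fin._≟_ zero ks (descending (val k)) p
... | ll , r , below = record { complete = com ; distinct = dis ; compatible = cpt }
  where
  o = ∈⇒order ks r

  com : ∀ c → c ∈ l
  com (inj₁ m) = ∈-lefts⁻ l (subst (m ∈_) (sym ll) (∈-descending m))
  com (inj₂ c) = ∈-rights⁻ l (complete o c)

  sorted : ∀ {m n} → Before (inj₁ m) (inj₁ n) l → m Fin.> n
  sorted b = allPairs⇒before (descending-sorted (val k)) (subst (Before _ _) ll (before-lefts⁺ b))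

  dis : ∀ {c d} → Before c d l → c ≢ d
  dis {inj₁ m} {inj₁ n} b refl = ℕ.<-irrefl refl (sorted b)
  dis {inj₂ c} {inj₂ d} b refl = distinct o (before-rights⁺ b) refl

  top-first : ∀ ks (l : List (Fin (val k) ⊎ Column ks)) → Below zero ks l → ∀ {c} → IsTop ks c → Before (inj₂ c) (inj₁ zero) l
  top-first (k′ ∷ ks) l b refl = b

  cpt : ∀ {c d} → Before c d l → ¬ (c ⊏ d)
  cpt {inj₁ m} {inj₁ n} b m<n = ℕ.<-asym m<n (sorted b)
  cpt {inj₁ m} {inj₂ c} b (refl , t) with before-antisym b (top-first ks l below t)
  ... | inj₁ b′ = dis b′ refl
  ... | inj₂ b′ = dis b′ refl
  cpt {inj₂ c} {inj₂ d} b c⊏d = compatible o (before-rights⁺ b) c⊏d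

length-order : ∀ ks {l} → l ∈ orders ks → length l ≡ sum (map val ks)
length-order []       (here refl) = refl
length-order (k ∷ ks) {l} p with ∈-ordersBelow⁻ Fin._≟_ zero ks (descending (val k)) p
... | ll , r , _ = trans (split l) (cong₂ ℕ._+_ (trans (cong length ll) (length-descending (val k))) (length-order ks r))
  where
  split : ∀ {A B : Set} (l : List (A ⊎ B)) → length l ≡ length (lefts l) ℕ.+ length (rights l)
  split []           = refl
  split (inj₁ _ ∷ l) = cong suc (split l)
  split (inj₂ _ ∷ l) = trans (cong suc (split l)) (sym (ℕ.+-suc _ _))

column : ∀ ks → X⋆.Carrier ks → Column ks
column (k ∷ ks) (zero , m)  = inj₁ m
column (k ∷ ks) (suc i , m) = inj₂ (column ks (i , m))

position : ∀ ks → Column ks → X⋆.Carrier ks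
position (k ∷ ks) (inj₁ m) = zero , m
position (k ∷ ks) (inj₂ c) = let i , m = position ks c in suc i , m

column-position : ∀ ks c → column ks (position ks c) ≡ c
column-position (k ∷ ks) (inj₁ m) = refl
column-position (k ∷ ks) (inj₂ c) = cong inj₂ (column-position ks c)

position-column : ∀ ks p → position ks (column ks p) ≡ p
position-column (k ∷ ks) (zero , m)  = refl
position-column (k ∷ ks) (suc i , m) = cong (λ (i , m) → suc i , m) (position-column ks (i , m))

label-column : ∀ ks p → label ks (column ks p) ≡ X⋆.δ ks p
label-column (k ∷ ks) (zero , zero)   = refl
label-column (k ∷ ks) (zero , suc m)  = refl
label-column (k ∷ ks) (suc i , zero)  = label-column ks (i , zero)
label-column (k ∷ ks) (suc i , suc m) = label-column ks (i , suc m)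

⋖⇒⊏ : ∀ ks {p q} → X⋆._⋖_ ks p q → column ks p ⊏ column ks q
⋖⇒⊏ (k ∷ ks)      {zero , m}  {zero , n}        (inj₁ (_ , eq)) = ℕ.≤-reflexive (sym eq)
⋖⇒⊏ (k ∷ k′ ∷ ks) {zero , m}  {suc zero , n}    (inj₂ (_ , m≡0 , n≡)) =
  Fin.toℕ-injective m≡0 , cong inj₁ (Fin.toℕ-injective (ℕ.suc-injective (trans n≡ (cong suc (sym (Fin.toℕ-fromℕ _))))))
⋖⇒⊏ (k ∷ ks)      {suc i , m} {suc j , n}       (inj₁ (refl , eq)) = ⋖⇒⊏ ks (inj₁ (refl , eq))
⋖⇒⊏ (k ∷ ks)      {suc i , m} {suc j , n}       (inj₂ (eq , eqs))  = ⋖⇒⊏ ks (inj₂ (ℕ.suc-injective eq , eqs))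

⊏⇒≺ : ∀ ks {c d} → c ⊏ d → X⋆._≺_ ks (position ks c) (position ks d)
-- The recursion runs over the number of elements strictly between `m` and `n`.
⊏⇒≺ (k ∷ ks) {inj₁ m} {inj₁ n} m<n = climb (toℕ n ℕ.∸ suc (toℕ m)) n (sym (trans (sym (ℕ.+-suc _ _)) (ℕ.m∸n+n≡m m<n)))
  where
  climb : ∀ d (n : Fin (val k)) → toℕ n ≡ suc (d ℕ.+ toℕ m) → X⋆._≺_ (k ∷ ks) (zero , m) (zero , n)
  climb zero    n       eq = ⁺.[ inj₁ (refl , eq) ]
  climb (suc d) (suc n) eq = climb d (inject₁ n) (trans (Fin.toℕ-inject₁ n) (ℕ.suc-injective eq))
    ⁺.∷ʳ inj₁ (refl , cong suc (sym (Fin.toℕ-inject₁ n)))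
⊏⇒≺ (k ∷ k′ ∷ ks) {inj₁ zero} {inj₂ c} (refl , refl) = ⁺.[ inj₂ (refl , refl , cong suc (Fin.toℕ-fromℕ _)) ]
⊏⇒≺ (k ∷ ks) {inj₂ c} {inj₂ d} c⊏d = raise (⊏⇒≺ ks c⊏d)
  where
  raise⋖ : ∀ {p q} → X⋆._⋖_ ks p q → X⋆._⋖_ (k ∷ ks) (suc (proj₁ p) , proj₂ p) (suc (proj₁ q) , proj₂ q)
  raise⋖ (inj₁ (refl , eq)) = inj₁ (refl , eq)
  raise⋖ (inj₂ (eq , eqs))  = inj₂ (cong suc eq , eqs)
  raise : ∀ {p q} → X⋆._≺_ ks p q → X⋆._≺_ (k ∷ ks) (suc (proj₁ p) , proj₂ p) (suc (proj₁ q) , proj₂ q)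
  raise ⁺.[ r ]    = ⁺.[ raise⋖ r ]
  raise (r ⁺.∷ rs) = raise⋖ r ⁺.∷ raise rs

module LinearExtensions (k : Index) where
  open X⋆ k using (_⋖_; _≺_; δ) renaming (Carrier to P)
  open X⋆-Poset k using (X⋆-poset)
  open 2-Poset X⋆-poset using (IsLinearExtension; isLinearExtension?; elements; tuples; size; word; W)
  open IsOrder

  -- Reversed because tuples run from the bottom up and orders from the top down.
  list : ∀ {n} → Vec P n → List (Column k)
  list g = map (column k) (reverse (Vec.toList g))

  before-list⁻ : ∀ {n} (g : Vec P n) {c d} → Before c d (list g) → Before (position k d) (position k c) (Vec.toList g)
  before-list⁻ g b = subst (Before _ _) (reverse-involutive (Vec.toList g)) (before-reverse
    (subst (Before _ _) (trans (sym (map-∘ (reverse (Vec.toList g)))) (trans (map-cong (position-column k) _) (map-id _)))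
      (before-map⁺ (position k) b)))

  before-list⁺ : ∀ {n} (g : Vec P n) {p q} → Before q p (Vec.toList g) → Before (column k p) (column k q) (list g)
  before-list⁺ g b = before-map⁺ (column k) (before-reverse b)

  column-injective : ∀ {p q} → column k p ≡ column k q → p ≡ q
  column-injective {p} {q} eq = trans (sym (position-column k p)) (trans (cong (position k) eq) (position-column k q))

  extension⇒order : ∀ {n} (g : Vec P n) → IsLinearExtension g → IsOrder k (list g)
  extension⇒order g ((injective , surjective) , monotone) = record
    { complete   = λ c → let a , hit = surjective (position k c) in
        subst (_∈ list g) (column-position k c) (∈-map⁺ (column k) (Any.reverse⁺
          (subst (_∈ Vec.toList g) (hit refl) (VecMembership.∈-toList⁺ (VecMembership.∈-lookup a g)))))
    ; distinct   = λ b eq → let i , j , i<j , eqi , eqj = before-lookup⁻ g (before-list⁻ g b) in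
        ℕ.<-irrefl (cong toℕ (injective (trans eqi (trans (cong (position k) (sym eq)) (sym eqj))))) i<j
    ; compatible = λ b c⊏d → let i , j , i<j , eqi , eqj = before-lookup⁻ g (before-list⁻ g b) in
        ℕ.<-asym i<j (monotone j i (subst₂ _≺_ (sym eqj) (sym eqi) (⊏⇒≺ k c⊏d)))
    }

  order⇒extension : ∀ {n} (g : Vec P n) → IsOrder k (list g) → IsLinearExtension g
  order⇒extension {n} g o = (injective , λ p → let a , eq = hits p in a , λ { refl → eq }) , monotone
    where
    irrefl : ∀ {p} → ¬ (p ≺ p)
    irrefl = IsDecStrictPartialOrder.irrefl (2-Poset.isDecStrictPartialOrder X⋆-poset) refl

    hits : ∀ p → ∃ λ a → Vec.lookup g a ≡ p
    hits p with ∈-map⁻ (column k) (complete o (column k p))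
    ... | q , q∈ , eq = let p∈ = VecMembership.∈-toList⁻ {xs = g} (Any.reverse⁻ q∈) in
      VecAny.index p∈ , trans (sym (VecAny.lookup-index p∈)) (column-injective (sym eq))

    injective : ∀ {a b} → Vec.lookup g a ≡ Vec.lookup g b → a ≡ b
    injective {a} {b} eq with Fin.<-cmp a b
    ... | tri< a<b _ _ = contradiction (cong (column k) (sym eq)) (distinct o (before-list⁺ g (before-lookup⁺ g a<b)))
    ... | tri≈ _ a≡b _ = a≡b
    ... | tri> _ _ b<a = contradiction (cong (column k) eq) (distinct o (before-list⁺ g (before-lookup⁺ g b<a)))

    monotone⋖ : ∀ {p q} a b → Vec.lookup g a ≡ p → Vec.lookup g b ≡ q → p ⋖ q → a Fin.< b
    monotone⋖ a b refl refl p⋖q with Fin.<-cmp a b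
    ... | tri< a<b _ _ = a<b
    ... | tri≈ _ refl _ = contradiction ⁺.[ p⋖q ] irrefl
    ... | tri> _ _ b<a = contradiction (⋖⇒⊏ k p⋖q) (compatible o (before-list⁺ g (before-lookup⁺ g b<a)))

    monotone≺ : ∀ {p q} a b → Vec.lookup g a ≡ p → Vec.lookup g b ≡ q → p ≺ q → a Fin.< b
    monotone≺ a b eqa eqb ⁺.[ p⋖q ]      = monotone⋖ a b eqa eqb p⋖q
    -- The tuple is onto, so the intermediate element has a position `c`.
    monotone≺ a b eqa eqb (p⋖r ⁺.∷ r≺q) = let c , eqc = hits _ in
      ℕ.<-trans (monotone⋖ a c eqa eqc p⋖r) (monotone≺ c b eqc eqb r≺q)

    monotone : ∀ a b → Vec.lookup g a ≺ Vec.lookup g b → a Fin.< b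
    monotone a b = monotone≺ a b refl refl

  ∈-tuples : ∀ {n} (g : Vec P n) → g ∈ tuples n
  ∈-tuples []      = here refl
  ∈-tuples (p ∷ g) = ∈-cartesianProductWith⁺ _∷_ (subst (_∈ elements) (Inverse.strictlyInverseʳ (2-Poset.finite X⋆-poset) p)
    (∈-map⁺ _ (∈-allFin (Inverse.to (2-Poset.finite X⋆-poset) p)))) (∈-tuples g)

  tuples-unique : ∀ n → Unique (tuples n)
  tuples-unique zero    = [] ∷ []
  tuples-unique (suc n) = Unique.cartesianProductWith⁺ _∷_ (λ { refl → refl , refl })
    (Unique.map⁺ (λ {i} {j} eq → trans (sym (Inverse.strictlyInverseˡ F i)) (trans (cong (Inverse.to F) eq) (Inverse.strictlyInverseˡ F j)))
      (Unique.allFin⁺ size)) (tuples-unique n)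
    where F = 2-Poset.finite X⋆-poset

  toList-injective : ∀ {n} (g h : Vec P n) → Vec.toList g ≡ Vec.toList h → g ≡ h
  toList-injective []      []      eq = refl
  toList-injective (p ∷ g) (q ∷ h) eq = cong₂ _∷_ (∷-injectiveˡ eq) (toList-injective g h (∷-injectiveʳ eq))

  vector : ∀ {n} (l : List P) → length l ≡ n → ∃ λ (g : Vec P n) → Vec.toList g ≡ l
  vector l refl = Vec.fromList l , Vec.toList∘fromList l

  extensions↭orders : map list (filter isLinearExtension? (tuples size)) ↭ orders k
  extensions↭orders = unique-↭
    (Unique.map⁺ (λ {g} {h} eq → toList-injective g h (reverse-injective (map-injective column-injective eq)))
      (Unique.filter⁺ isLinearExtension? (tuples-unique size)))
    (orders-unique k) to from
    where
    to : ∀ {l} → l ∈ map list (filter isLinearExtension? (tuples size)) → l ∈ orders k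
    to p with ∈-map⁻ list p
    ... | g , q , refl = order⇒∈ k (extension⇒order g (proj₂ (∈-filter⁻ isLinearExtension? {xs = tuples size} q)))
    from : ∀ {l} → l ∈ orders k → l ∈ map list (filter isLinearExtension? (tuples size))
    from {l} p with vector (reverse (map (position k) l)) (trans (length-reverse (map (position k) l)) (trans (length-map (position k) l) (length-order k p)))
    ... | g , eq = subst (_∈ _) list≡ (∈-map⁺ list (∈-filter⁺ isLinearExtension? (∈-tuples g)
        (order⇒extension g (subst (IsOrder k) (sym list≡) (∈⇒order k p)))))
      where
      list≡ : list g ≡ l
      list≡ = trans (cong (map (column k)) (trans (cong reverse eq) (reverse-involutive _)))
        (trans (sym (map-∘ l)) (trans (map-cong (column-position k) l) (map-id l)))

  word-list : ∀ {n} (g : Vec P n) → word g ≡ wd (label k) (list g)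
  word-list g = begin
    foldl _∙_ ε (map δ (Vec.toList g))            ≡⟨ foldl-map _ δ ε (Vec.toList g) ⟩
    foldl (λ w p → w ∙ δ p) ε (Vec.toList g)      ≡⟨ reverse-foldr _ ε (Vec.toList g) ⟨
    wd δ (reverse (Vec.toList g))                 ≡⟨ wd-cong (label-column k) (reverse (Vec.toList g)) ⟨
    wd (label k ∘ column k) (reverse (Vec.toList g)) ≡⟨ wd-map (label k) (column k) (reverse (Vec.toList g)) ⟨
    wd (label k) (list g)                         ∎
    where open ≡-Reasoning

  W↭words : W ↭ words (label k) (orders k)
  W↭words = subst (_↭ words (label k) (orders k))
    (trans (sym (map-∘ (filter isLinearExtension? (tuples size))))
      (map-cong (λ g → cong (1ℚ ,_) (sym (word-list g))) _))
    (↭.map⁺ (λ l → 1ℚ , wd (label k) l) extensions↭orders)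

KY : (Word → ℝ) → Index → ℝ
KY ψ []       = 1ᴿ
KY ψ (k ∷ ks) = K ψ [ k ] ks

⟨⟩-w⋆ : ∀ {ψ} → ShuffleCharacter ψ → ∀ k → ⟨ ψ , proj₁ (X⋆-Poset.w⋆ k) ⟩ ≈ᴿ KY ψ k
⟨⟩-w⋆ {ψ} char k = ≈-trans (⟨⟩-↭ ψ (LinearExtensions.W↭words k)) (sum-orders k)
  where
  sum-orders : ∀ k → ⟨ ψ , words (label k) (orders k) ⟩ ≈ᴿ KY ψ k
  sum-orders []       = ≈-trans (Real.+-identityʳ _) (≈-trans (⟨⟩-one ψ ε) (ShuffleCharacter.ψ-ε char))
  sum-orders (k ∷ ks) = Chains.⟨⟩-orders char k ks

-- Coefficients of multiple polylogarithms

Σ≤ : (ℕ → ℚ) → ℕ → ℚ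
Σ≤ a zero    = a 0
Σ≤ a (suc n) = Σ≤ a n + a (suc n)

-- Antidiagonal sums over i + j = n serve both as Cauchy products and as truncations of double
-- series.
diag : (ℕ → ℕ → ℚ) → ℕ → ℚ
diag f zero    = f 0 0
diag f (suc n) = f 0 (suc n) + diag (f ∘ suc) n

-- The number n as a rational, in the form that makes `ι (suc n)` definitionally equal to `L n`.
ι : ℕ → ℚ
ι zero    = 0ℚ
ι (suc n) = L n

ι-suc : ∀ n → ι (suc n) ≡ ι n + 1ℚ
ι-suc zero    = refl
ι-suc (suc n) = L-suc n

ι-+ : ∀ m n → ι (m ℕ.+ n) ≡ ι m + ι n
ι-+ zero    n = sym (+-identityˡ (ι n))
ι-+ (suc m) n = trans (ι-suc (m ℕ.+ n)) (trans (cong (_+ 1ℚ) (ι-+ m n))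
  (trans (rearrange (ι m) (ι n)) (cong (_+ ι n) (sym (ι-suc m)))))
  where
  rearrange : ∀ a b → a + b + 1ℚ ≡ a + 1ℚ + b
  rearrange = solve-∀ ℚ-ring

+-interchange : ∀ a b c d → (a + b) + (c + d) ≡ (a + c) + (b + d)
+-interchange = solve-∀ ℚ-ring

Σ≤-cong : ∀ {a b} → (∀ n → a n ≡ b n) → ∀ n → Σ≤ a n ≡ Σ≤ b n
Σ≤-cong eq zero    = eq 0
Σ≤-cong eq (suc n) = cong₂ _+_ (Σ≤-cong eq n) (eq (suc n))

Σ≤-+ : ∀ a b n → Σ≤ (λ i → a i + b i) n ≡ Σ≤ a n + Σ≤ b n
Σ≤-+ a b zero    = refl
Σ≤-+ a b (suc n) = trans (cong (_+ (a (suc n) + b (suc n))) (Σ≤-+ a b n)) (+-interchange (Σ≤ a n) (Σ≤ b n) (a (suc n)) (b (suc n)))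

Σ≤-* : ∀ q a n → Σ≤ (λ i → q * a i) n ≡ q * Σ≤ a n
Σ≤-* q a zero    = refl
Σ≤-* q a (suc n) = trans (cong (_+ q * a (suc n)) (Σ≤-* q a n)) (sym (*-distribˡ-+ q (Σ≤ a n) (a (suc n))))

Σ≤-0 : ∀ n → Σ≤ (λ _ → 0ℚ) n ≡ 0ℚ
Σ≤-0 zero    = refl
Σ≤-0 (suc n) = trans (+-identityʳ _) (Σ≤-0 n)

Σ≤-front : ∀ a n → Σ≤ a (suc n) ≡ a 0 + Σ≤ (a ∘ suc) n
Σ≤-front a zero    = refl
Σ≤-front a (suc n) = trans (cong (_+ a (suc (suc n))) (Σ≤-front a n)) (+-assoc (a 0) _ _)

diag-cong : ∀ {f g} → (∀ i j → f i j ≡ g i j) → ∀ n → diag f n ≡ diag g n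
diag-cong eq zero    = eq 0 0
diag-cong eq (suc n) = cong₂ _+_ (eq 0 (suc n)) (diag-cong (λ i → eq (suc i)) n)

diag-+ : ∀ f g n → diag (λ i j → f i j + g i j) n ≡ diag f n + diag g n
diag-+ f g zero    = refl
diag-+ f g (suc n) = trans (cong (f 0 (suc n) + g 0 (suc n) +_) (diag-+ (f ∘ suc) (g ∘ suc) n))
  (+-interchange (f 0 (suc n)) (g 0 (suc n)) (diag (f ∘ suc) n) (diag (g ∘ suc) n))

diag-weight : ∀ (w : ℕ → ℚ) f n → diag (λ i j → w (i ℕ.+ j) * f i j) n ≡ w n * diag f n
diag-weight w f zero    = refl
diag-weight w f (suc n) = trans (cong (w (suc n) * f 0 (suc n) +_) (diag-weight (w ∘ suc) (f ∘ suc) n))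
  (sym (*-distribˡ-+ (w (suc n)) _ _))

diag-≤ : ∀ {f g} → (∀ i j → f i j ≤ g i j) → ∀ n → diag f n ≤ diag g n
diag-≤ le zero    = le 0 0
diag-≤ le (suc n) = +-mono-≤ (le 0 (suc n)) (diag-≤ (λ i → le (suc i)) n)

diag-0 : ∀ n → diag (λ _ _ → 0ℚ) n ≡ 0ℚ
diag-0 zero    = refl
diag-0 (suc n) = trans (+-identityˡ _) (diag-0 n)

diag-nonneg : ∀ {f} → (∀ i j → 0ℚ ≤ f i j) → ∀ n → 0ℚ ≤ diag f n
diag-nonneg {f} nn n = subst (_≤ diag f n) (diag-0 n) (diag-≤ nn n)

-- The Leibniz rule for t d/dt, which multiplies the coefficient of tⁿ by n.
diag-leibniz : ∀ f n → ι n * diag f n ≡ diag (λ i j → ι i * f i j) n + diag (λ i j → ι j * f i j) n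
diag-leibniz f n = trans (sym (diag-weight ι f n)) (trans
  (diag-cong (λ i j → trans (cong (_* f i j) (ι-+ i j)) (*-distribʳ-+ (f i j) (ι i) (ι j))) n) (diag-+ _ _ n))

diag-telescope : ∀ f e → (∀ i → f i 0 ≡ e i 0) → (∀ i j → f i (suc j) ≡ f i j + e i (suc j)) →
                 ∀ n → diag f (suc n) ≡ diag f n + diag e (suc n)
diag-telescope f e base inc zero    = trans (cong₂ _+_ (inc 0 0) (base 1)) (+-assoc (f 0 0) _ _)
diag-telescope f e base inc (suc n) = trans (cong₂ _+_ (inc 0 (suc n)) (diag-telescope (f ∘ suc) (e ∘ suc) (base ∘ suc) (inc ∘ suc) n))
  (+-interchange (f 0 (suc n)) (e 0 (suc (suc n))) (diag (f ∘ suc) n) (diag (e ∘ suc) (suc n)))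

-- `f` consists of the partial row sums of `e`, so both sides sum `e` over the triangle i + j ≤ n.
diag-Σ≤ : ∀ f e → (∀ i → f i 0 ≡ e i 0) → (∀ i j → f i (suc j) ≡ f i j + e i (suc j)) →
          ∀ n → diag f n ≡ Σ≤ (diag e) n
diag-Σ≤ f e base inc zero    = base 0
diag-Σ≤ f e base inc (suc n) = trans (diag-telescope f e base inc n) (cong (_+ diag e (suc n)) (diag-Σ≤ f e base inc n))

conv : (ℕ → ℚ) → (ℕ → ℚ) → ℕ → ℚ
conv a b = diag (λ i j → a i * b j)

conv-congˡ : ∀ {a a′} b → (∀ n → a n ≡ a′ n) → ∀ n → conv a b n ≡ conv a′ b n
conv-congˡ b eq = diag-cong (λ i j → cong (_* b j) (eq i))

conv-congʳ : ∀ a {b b′} → (∀ n → b n ≡ b′ n) → ∀ n → conv a b n ≡ conv a b′ n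
conv-congʳ a eq = diag-cong (λ i j → cong (a i *_) (eq j))

shift : (ℕ → ℚ) → ℕ → ℚ
shift a zero    = 0ℚ
shift a (suc n) = a n

conv-shift : ∀ a b n → conv (shift a) b (suc n) ≡ conv a b n
conv-shift a b n = trans (cong (_+ conv a b n) (*-zeroˡ (b (suc n)))) (+-identityˡ _)

-- `Σ≤` is multiplication of the generating function by 1/(1-t).
conv-Σ≤ : ∀ a b n → conv (Σ≤ a) b n ≡ Σ≤ (conv a b) n
conv-Σ≤ a b zero    = refl
conv-Σ≤ a b (suc n) = begin
  conv (Σ≤ a) b (suc n)
    ≡⟨ diag-cong (λ i j → trans (cong (_* b j) (split i)) (*-distribʳ-+ (b j) (shift (Σ≤ a) i) (a i))) (suc n) ⟩
  diag (λ i j → shift (Σ≤ a) i * b j + a i * b j) (suc n)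
    ≡⟨ diag-+ (λ i j → shift (Σ≤ a) i * b j) (λ i j → a i * b j) (suc n) ⟩
  conv (shift (Σ≤ a)) b (suc n) + conv a b (suc n)
    ≡⟨ cong (_+ conv a b (suc n)) (trans (conv-shift (Σ≤ a) b n) (conv-Σ≤ a b n)) ⟩
  Σ≤ (conv a b) (suc n) ∎
  where
  open ≡-Reasoning
  split : ∀ i → Σ≤ a i ≡ shift (Σ≤ a) i + a i
  split zero    = sym (+-identityˡ (a 0))
  split (suc i) = refl

-- Li_w(t) = ∑ (c w n) tⁿ

c : Word → ℕ → ℚ
c ε       zero    = 1ℚ
c ε       (suc n) = 0ℚ
c (w ∙ u) zero    = 0ℚ
c (w ∙ 𝑥) (suc n) = c w (suc n) * r n
c (w ∙ 𝑦) (suc n) = Σ≤ (c w) n * r n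

Σ≤-c-ε : ∀ n → Σ≤ (c ε) n ≡ 1ℚ
Σ≤-c-ε zero    = refl
Σ≤-c-ε (suc n) = trans (+-identityʳ _) (Σ≤-c-ε n)

cᴴ : 𝔥 → ℕ → ℚ
cᴴ []            n = 0ℚ
cᴴ ((q , w) ∷ h) n = q * c w n + cᴴ h n

cᴴ-++ : ∀ g h n → cᴴ (g ++ h) n ≡ cᴴ g n + cᴴ h n
cᴴ-++ []            h n = sym (+-identityˡ _)
cᴴ-++ ((q , w) ∷ g) h n = trans (cong (q * c w n +_) (cᴴ-++ g h n)) (sym (+-assoc (q * c w n) (cᴴ g n) (cᴴ h n)))

cᴴ-∙-zero : ∀ h u → cᴴ (h ∙ᴴ u) 0 ≡ 0ℚ
cᴴ-∙-zero []            u = refl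
cᴴ-∙-zero ((q , w) ∷ h) u = trans (cong₂ _+_ (*-zeroʳ q) (cᴴ-∙-zero h u)) refl

cᴴ-𝑥 : ∀ h n → cᴴ (h ∙ᴴ 𝑥) (suc n) ≡ cᴴ h (suc n) * r n
cᴴ-𝑥 []            n = sym (*-zeroˡ (r n))
cᴴ-𝑥 ((q , w) ∷ h) n = trans (cong (q * (c w (suc n) * r n) +_) (cᴴ-𝑥 h n)) (rearrange q (c w (suc n)) (cᴴ h (suc n)) (r n))
  where
  rearrange : ∀ q a b r → q * (a * r) + b * r ≡ (q * a + b) * r
  rearrange = solve-∀ ℚ-ring

cᴴ-𝑦 : ∀ h n → cᴴ (h ∙ᴴ 𝑦) (suc n) ≡ Σ≤ (cᴴ h) n * r n
cᴴ-𝑦 []            n = sym (trans (cong (_* r n) (Σ≤-0 n)) (*-zeroˡ (r n)))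
cᴴ-𝑦 ((q , w) ∷ h) n = trans (cong (q * (Σ≤ (c w) n * r n) +_) (cᴴ-𝑦 h n)) (trans (rearrange q (Σ≤ (c w) n) (Σ≤ (cᴴ h) n) (r n))
  (cong (_* r n) (sym (trans (Σ≤-+ (λ i → q * c w i) (cᴴ h) n) (cong (_+ Σ≤ (cᴴ h) n) (Σ≤-* q (c w) n))))))
  where
  rearrange : ∀ q a b r → q * (a * r) + b * r ≡ (q * a + b) * r
  rearrange = solve-∀ ℚ-ring

-- 1/n, the coefficients of Li₁, with value 0 at n = 0
recip : ℕ → ℚ
recip zero    = 0ℚ
recip (suc n) = r n

L*[a*r] : ∀ n a → L n * (a * r n) ≡ a
L*[a*r] n a = trans (rearrange (L n) a (r n)) (trans (cong (a *_) (L*r n)) (*-identityʳ a))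
  where
  rearrange : ∀ l a r → l * (a * r) ≡ a * (l * r)
  rearrange = solve-∀ ℚ-ring

divide-L : ∀ n a b → L n * a ≡ b → a ≡ b * r n
divide-L n a b refl = sym (trans (rearrange (L n) a (r n)) (trans (cong (a *_) (L*r n)) (*-identityʳ a)))
  where
  rearrange : ∀ l a r → l * a * r ≡ a * (l * r)
  rearrange = solve-∀ ℚ-ring

-- The product rule for A(t) Li₁(t): t d/dt takes A to the series of `b` and Li₁ to t/(1-t), which
-- accounts for `Σ≤ a n`.
conv-recip : ∀ a b n → (∀ i → ι i * a i ≡ b i) → L n * conv a recip (suc n) ≡ conv b recip (suc n) + Σ≤ a n
conv-recip a b n eq = trans (diag-leibniz (λ i j → a i * recip j) (suc n))
  (cong₂ _+_ (diag-cong (λ i j → trans (sym (*-assoc (ι i) (a i) (recip j))) (cong (_* recip j) (eq i))) (suc n))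
             (ones a n))
  where
  ones : ∀ a n → diag (λ i j → ι j * (a i * recip j)) (suc n) ≡ Σ≤ a n
  ones a zero    = trans (cong₂ _+_ (L*[a*r] 0 (a 0)) (*-zeroˡ (a 1 * 0ℚ))) (+-identityʳ (a 0))
  ones a (suc n) = trans (cong₂ _+_ (L*[a*r] (suc n) (a 0)) (ones (a ∘ suc) n)) (sym (Σ≤-front a n))

private
  assemble : ∀ n a x y → a ≡ (1ℚ * (x * r n) + 0ℚ) + y * r n → ∀ b → L n * b ≡ y + x → a ≡ b
  assemble n a x y eq b eq′ = trans eq (trans (rearrange x y (r n)) (sym (divide-L n b (y + x) eq′)))
    where
    rearrange : ∀ x y r → (1ℚ * (x * r) + 0ℚ) + y * r ≡ (y + x) * r
    rearrange = solve-∀ ℚ-ring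

-- The recursion of the shuffle on last letters is the product rule for t d/dt. Here t d/dt Li_{wy}
-- = t/(1-t) Li_w has the coefficients `shift (Σ≤ (c w))`.
cᴴ-sh-𝑦 : ∀ w → (∀ n → cᴴ ((ε ∙ 𝑦) shʷ w) n ≡ conv (c w) recip n) →
          ∀ n → cᴴ ((ε ∙ 𝑦) shʷ (w ∙ 𝑦)) n ≡ conv (c (w ∙ 𝑦)) recip n
cᴴ-sh-𝑦 w ih zero    = trans (cong (_+_ (1ℚ * 0ℚ)) (cᴴ-∙-zero ((ε ∙ 𝑦) shʷ w) 𝑦)) refl
cᴴ-sh-𝑦 w ih (suc n) = assemble n _ (Σ≤ (c (w ∙ 𝑦)) n) (Σ≤ (conv (c w) recip) n)
  (trans (cᴴ-++ ([ 1ℚ , w ∙ 𝑦 ∙ 𝑦 ]) (((ε ∙ 𝑦) shʷ w) ∙ᴴ 𝑦) (suc n)) (cong (1ℚ * c (w ∙ 𝑦 ∙ 𝑦) (suc n) + 0ℚ +_)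
    (trans (cᴴ-𝑦 ((ε ∙ 𝑦) shʷ w) n) (cong (_* r n) (Σ≤-cong ih n)))))
  (conv (c (w ∙ 𝑦)) recip (suc n))
  (trans (conv-recip (c (w ∙ 𝑦)) (shift (Σ≤ (c w))) n (λ { zero → refl ; (suc i) → L*[a*r] i (Σ≤ (c w) i) }))
    (cong (_+ Σ≤ (c (w ∙ 𝑦)) n) (trans (conv-shift (Σ≤ (c w)) recip n) (conv-Σ≤ (c w) recip n))))

-- Here t d/dt Li_{wx} = Li_w, which requires that Li_w vanish at 0.
cᴴ-sh-𝑥 : ∀ w → c w 0 ≡ 0ℚ → (∀ n → cᴴ ((ε ∙ 𝑦) shʷ w) n ≡ conv (c w) recip n) →
          ∀ n → cᴴ ((ε ∙ 𝑦) shʷ (w ∙ 𝑥)) n ≡ conv (c (w ∙ 𝑥)) recip n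
cᴴ-sh-𝑥 w c0 ih zero    = trans (cong (_+_ (1ℚ * 0ℚ)) (cᴴ-∙-zero ((ε ∙ 𝑦) shʷ w) 𝑥)) refl
cᴴ-sh-𝑥 w c0 ih (suc n) = assemble n _ (Σ≤ (c (w ∙ 𝑥)) n) (conv (c w) recip (suc n))
  (trans (cᴴ-++ ([ 1ℚ , w ∙ 𝑥 ∙ 𝑦 ]) (((ε ∙ 𝑦) shʷ w) ∙ᴴ 𝑥) (suc n)) (cong (1ℚ * c (w ∙ 𝑥 ∙ 𝑦) (suc n) + 0ℚ +_)
    (trans (cᴴ-𝑥 ((ε ∙ 𝑦) shʷ w) n) (cong (_* r n) (ih (suc n))))))
  (conv (c (w ∙ 𝑥)) recip (suc n))
  (conv-recip (c (w ∙ 𝑥)) (c w) n (λ { zero → sym c0 ; (suc i) → L*[a*r] i (c w (suc i)) }))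

c-startsY : ∀ v → c (ε ∙ 𝑦 · v) 0 ≡ 0ℚ
c-startsY ε       = refl
c-startsY (v ∙ u) = refl

-- Li₁ Li_w = Li_{y sh w}
cᴴ-sh : ∀ v n → cᴴ ((ε ∙ 𝑦) shʷ (ε ∙ 𝑦 · v)) n ≡ conv (c (ε ∙ 𝑦 · v)) recip n
cᴴ-sh ε = cᴴ-sh-𝑦 ε start
  where
  vanish : ∀ a n → (∀ i → a i ≡ 0ℚ) → conv a recip n ≡ 0ℚ
  vanish a n eq = trans (diag-cong (λ i j → trans (cong (_* recip j) (eq i)) (*-zeroˡ (recip j))) n) (diag-0 n)
  start : ∀ n → cᴴ ((ε ∙ 𝑦) shʷ ε) n ≡ conv (c ε) recip n
  start zero    = refl
  start (suc n) = trans (+-identityʳ _) (trans (*-identityˡ _) (trans (cong (_* r n) (Σ≤-c-ε n))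
    (sym (trans (cong (1ℚ * r n +_) (vanish (c ε ∘ suc) n (λ _ → refl))) (+-identityʳ _)))))
cᴴ-sh (v ∙ 𝑦) = cᴴ-sh-𝑦 (ε ∙ 𝑦 · v) (cᴴ-sh v)
cᴴ-sh (v ∙ 𝑥) = cᴴ-sh-𝑥 (ε ∙ 𝑦 · v) (c-startsY v) (cᴴ-sh v)

-- Complete homogeneous sums of reciprocals

1/-suc : ∀ n k → 1/ suc n ^ suc k ≡ r n * (1/ suc n ^ k)
1/-suc n k = sym (PartialSums./-* (suc n) (suc n ℕ.^ k) {{_}} {{ℕ.m^n≢0 (suc n) k}} {{ℕ.m^n≢0 (suc n) (suc k)}})

1/-one : ∀ n → 1/ suc n ^ 1 ≡ r n
1/-one n = trans (1/-suc n 0) (*-identityʳ (r n))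

r≤2r : ∀ n → r n ≤ r (suc n) + r (suc n)
r≤2r n = begin
  r n                               ≡⟨ r-telescope n ⟩
  r (suc n) + r n * r (suc n)       ≤⟨ +-monoʳ-≤ (r (suc n)) (Cauchy.*-monoʳ (r (suc n)) (r≥0 (suc n)) (PartialSums./-mono 1 (suc n) (s≤s z≤n))) ⟩
  r (suc n) + 1ℚ * r (suc n)        ≡⟨ cong (r (suc n) +_) (*-identityˡ (r (suc n))) ⟩
  r (suc n) + r (suc n)             ∎
  where open ≤-Reasoning

small-shift : ∀ {a} → Small a → Small (a ∘ suc)
small-shift sa e 0<e = let N , p = sa e 0<e in N , λ n l → p (suc n) (ℕ.m≤n⇒m≤1+n l)

small-≤ : ∀ {a b} → (∀ n → a n ≤ b n) → Small b → Small a
small-≤ le sb e 0<e = let N , p = sb e 0<e in N , λ n l → ≤-trans (le n) (p n l)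

0≤1 : 0ℚ ≤ 1ℚ
0≤1 = nonNegative⁻¹ 1ℚ

0≤4 : 0ℚ ≤ (1ℚ + 1ℚ) * (1ℚ + 1ℚ)
0≤4 = nonNegative⁻¹ _

-- `step a` pairs `a n` with 1/(n+1), while `h (suc j)` pairs `h j (suc n)` with it; hence tameness
-- is needed for shifted sequences.
tame-shift : ∀ {a} → Tame a → Tame (a ∘ suc)
tame-shift {a} t = record
  { nonneg     = nonneg ∘ suc
  ; sublinear  = small-≤ (λ n → ≤-trans (Cauchy.*-monoˡ (a (suc n)) (nonneg (suc n)) (r≤2r n))
                   (≤-reflexive (*-distribˡ-+ (a (suc n)) (r (suc n)) (r (suc n)))))
                   (small-+ (small-shift sublinear) (small-shift sublinear))
  -- The factor 4 is the square of the 2 in `r≤2r`.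
  ; tail       = λ n → 4ℚ * tail (suc n)
  ; tail-step  = tail-bound
  ; tail-small = small-* 4ℚ 0≤4 (small-shift tail-small)
  ; tail≥0     = λ n → 0≤-* 0≤4 (tail≥0 (suc n))
  }
  where
  open Tame t
  4ℚ = (1ℚ + 1ℚ) * (1ℚ + 1ℚ)
  open ≤-Reasoning
  tail-bound : ∀ n → a (suc n) * (r n * r n) + 4ℚ * tail (suc (suc n)) ≤ 4ℚ * tail (suc n)
  tail-bound n = begin
    a (suc n) * (r n * r n) + 4ℚ * tail (suc (suc n))
      ≤⟨ +-monoˡ-≤ (4ℚ * tail (suc (suc n))) (Cauchy.*-monoˡ (a (suc n)) (nonneg (suc n))
           (≤-trans (Cauchy.*-monoˡ (r n) (r≥0 n) (r≤2r n)) (Cauchy.*-monoʳ (y + y) (0≤-+ (r≥0 (suc n)) (r≥0 (suc n))) (r≤2r n)))) ⟩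
    a (suc n) * ((y + y) * (y + y)) + 4ℚ * tail (suc (suc n))
      ≡⟨ rearrange (a (suc n)) y (tail (suc (suc n))) ⟩
    4ℚ * (a (suc n) * (y * y) + tail (suc (suc n)))
      ≤⟨ Cauchy.*-monoˡ 4ℚ 0≤4 (tail-step (suc n)) ⟩
    4ℚ * tail (suc n) ∎
    where
    y = r (suc n)
    rearrange : ∀ a y t → a * ((y + y) * (y + y)) + (1ℚ + 1ℚ) * (1ℚ + 1ℚ) * t ≡ (1ℚ + 1ℚ) * (1ℚ + 1ℚ) * (a * (y * y) + t)
    rearrange = solve-∀ ℚ-ring

-- h j n is the complete homogeneous symmetric polynomial of degree j in 1, 1/2, …, 1/n.
h : ℕ → ℕ → ℚ
h zero    = λ _ → 1ℚ
h (suc j) = step (λ n → h j (suc n)) (1+ 0)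

h-suc : ∀ j n → h (suc j) (suc n) ≡ h (suc j) n + h j (suc n) * r n
h-suc j n = cong (λ t → h (suc j) n + h j (suc n) * t) (1/-one n)

h-tame : ∀ j → Tame (h j)
h-tame zero    = const-tame
h-tame (suc j) = step-tame (tame-shift (h-tame j)) (1+ 0)

h≥0 : ∀ j n → 0ℚ ≤ h j n
h≥0 j = Tame.nonneg (h-tame j)

-- For n ≥ 1 and up to the sign `sg j`, the coefficient of uʲ in ∫₀¹ tⁿ⁻¹ (1-t)ᵘ dt.
h/ : ℕ → ℕ → ℚ
h/ j zero    = 0ℚ
h/ j (suc n) = h j (suc n) * r n

h/≥0 : ∀ j n → 0ℚ ≤ h/ j n
h/≥0 j zero    = ≤-refl
h/≥0 j (suc n) = 0≤-* (h≥0 j (suc n)) (r≥0 n)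

h/-small : ∀ j → Small (λ n → h/ j (suc n))
h/-small j = Tame.sublinear (tame-shift (h-tame j))

-- G j M n = ∑_{1≤m≤M} h j (n+m) / (m (n+m))
G : ℕ → ℕ → ℕ → ℚ
G j zero    n = 0ℚ
G j (suc M) n = G j M n + h/ j (suc (n ℕ.+ M)) * r M

-- τ (j+1) M n = (j+1) h (j+1) n − n G j M n, in a form showing that it is nonnegative
-- and tends to 0 as M → ∞
τ : ℕ → ℕ → ℕ → ℚ
τ zero    M n       = 0ℚ
τ (suc j) M zero    = 0ℚ
τ (suc j) M (suc n) = τ (suc j) M n + τ j M (suc n) * r n + h/ j (suc n ℕ.+ M)

-- The degree j - 1, with 0 for j = 0; likewise `h⁻`. This lets `h-step` and `G-step` cover all j at
-- once.
G⁻ : ℕ → ℕ → ℕ → ℚ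
G⁻ zero    M n = 0ℚ
G⁻ (suc j) M n = G j M n

h⁻ : ℕ → ℕ → ℚ
h⁻ zero    n = 0ℚ
h⁻ (suc j) n = h j n

h-step : ∀ j n → h j (suc n) ≡ h j n + h⁻ j (suc n) * r n
h-step zero    n = sym (trans (cong (1ℚ +_) (*-zeroˡ (r n))) (+-identityʳ 1ℚ))
h-step (suc j) n = h-suc j n

G⁻-suc : ∀ j M n → G⁻ j (suc M) n ≡ G⁻ j M n + (h⁻ j (suc (n ℕ.+ M)) * r (n ℕ.+ M)) * r M
G⁻-suc zero    M n = sym (trans (+-identityˡ _) (trans (cong (_* r M) (*-zeroˡ (r (n ℕ.+ M)))) (*-zeroˡ (r M))))
G⁻-suc (suc j) M n = refl

private
  -- The partial fraction n/(m(n+m)) = 1/m - 1/(n+m) for m = M + 1.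
  shift-r : ∀ n M → (ι n * r M + 1ℚ) * r (n ℕ.+ M) ≡ r M
  shift-r n M = begin
    (ι n * r M + 1ℚ) * r (n ℕ.+ M)            ≡⟨ cong (λ t → (ι n * r M + t) * r (n ℕ.+ M)) (L*r M) ⟨
    (ι n * r M + L M * r M) * r (n ℕ.+ M)     ≡⟨ rearrange (ι n) (L M) (r M) (r (n ℕ.+ M)) ⟩
    r M * ((ι n + L M) * r (n ℕ.+ M))         ≡⟨ cong (λ t → r M * (t * r (n ℕ.+ M))) (ι-+ n (suc M)) ⟨
    r M * (ι (n ℕ.+ suc M) * r (n ℕ.+ M))     ≡⟨ cong (λ t → r M * (ι t * r (n ℕ.+ M))) (ℕ.+-suc n M) ⟩
    r M * (L (n ℕ.+ M) * r (n ℕ.+ M))         ≡⟨ cong (r M *_) (L*r (n ℕ.+ M)) ⟩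
    r M * 1ℚ                                  ≡⟨ *-identityʳ (r M) ⟩
    r M                                       ∎
    where
    open ≡-Reasoning
    rearrange : ∀ i l m p → (i * m + l * m) * p ≡ m * ((i + l) * p)
    rearrange = solve-∀ ℚ-ring

-- By partial fractions, n G_j(M, n) = ∑_{m≤M} h_j(n+m) (1/m - 1/(n+m)). In the difference from n to
-- n + 1 the parts with 1/m give G_{j-1}, because h_j grows by h_{j-1}(n+1+m)/(n+1+m), and the parts
-- h_j(n+m)/(n+m) telescope to the two boundary terms.
G-step : ∀ j M n → L n * G j M (suc n) + h/ j (suc n ℕ.+ M) ≡ ι n * G j M n + G⁻ j M (suc n) + h/ j (suc n)
G-step j zero n = begin
  L n * 0ℚ + h/ j (suc n ℕ.+ 0)    ≡⟨ cong (λ t → L n * 0ℚ + h/ j (suc t)) (ℕ.+-identityʳ n) ⟩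
  L n * 0ℚ + h/ j (suc n)          ≡⟨ cong (_+ h/ j (suc n)) (trans (*-zeroʳ (L n)) (sym (trans (cong₂ _+_ (*-zeroʳ (ι n)) (G⁻-zero j)) (+-identityˡ 0ℚ)))) ⟩
  ι n * 0ℚ + G⁻ j 0 (suc n) + h/ j (suc n) ∎
  where
  open ≡-Reasoning
  G⁻-zero : ∀ j → G⁻ j 0 (suc n) ≡ 0ℚ
  G⁻-zero zero    = refl
  G⁻-zero (suc j) = refl
G-step j (suc M) n = begin
  L n * (G j M (suc n) + H₁ * r₁ * r M) + h/ j (suc n ℕ.+ suc M)
    ≡⟨ cong (λ t → L n * (G j M (suc n) + H₁ * r₁ * r M) + h/ j (suc t)) (ℕ.+-suc n M) ⟩
  L n * (G j M (suc n) + H₁ * r₁ * r M) + H₁ * r₁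
    ≡⟨ expand (L n) (G j M (suc n)) H₁ r₁ (r M) ⟩
  L n * G j M (suc n) + H₁ * ((L n * r M + 1ℚ) * r₁)
    ≡⟨ cong₂ _+_ (isolate (L n * G j M (suc n)) _ _ (G-step j M n)) (cong₂ _*_ (h-step j p) (shift-r (suc n) M)) ⟩
  (ι n * G j M n + G⁻ j M (suc n) + h/ j (suc n) - H₀ * r₀) + (H₀ + H⁻ * r₁) * r M
    ≡⟨ cong ((ι n * G j M n + G⁻ j M (suc n) + h/ j (suc n) - H₀ * r₀) +_)
         (trans (*-distribʳ-+ (r M) H₀ (H⁻ * r₁)) (cong (λ t → H₀ * t + H⁻ * r₁ * r M) (sym (shift-r n M)))) ⟩
  (ι n * G j M n + G⁻ j M (suc n) + h/ j (suc n) - H₀ * r₀) + (H₀ * ((ι n * r M + 1ℚ) * r₀) + H⁻ * r₁ * r M)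
    ≡⟨ collect (ι n) (G j M n) (G⁻ j M (suc n)) (h/ j (suc n)) H₀ r₀ (r M) (H⁻ * r₁ * r M) ⟩
  ι n * (G j M n + H₀ * r₀ * r M) + (G⁻ j M (suc n) + H⁻ * r₁ * r M) + h/ j (suc n)
    ≡⟨ cong (λ t → ι n * (G j M n + H₀ * r₀ * r M) + t + h/ j (suc n)) (G⁻-suc j M (suc n)) ⟨
  ι n * G j (suc M) n + G⁻ j (suc M) (suc n) + h/ j (suc n) ∎
  where
  open ≡-Reasoning
  p = suc (n ℕ.+ M)
  H₀ = h j p
  H₁ = h j (suc p)
  H⁻ = h⁻ j (suc p)
  r₀ = r (n ℕ.+ M)
  r₁ = r p
  expand : ∀ l g H s m → l * (g + H * s * m) + H * s ≡ l * g + H * ((l * m + 1ℚ) * s)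
  expand = solve-∀ ℚ-ring
  isolate : ∀ a b d → a + b ≡ d → a ≡ d - b
  isolate a b d refl = sym (cancel a b)
    where
    cancel : ∀ a b → a + b - b ≡ a
    cancel = solve-∀ ℚ-ring
  collect : ∀ i g g⁻ q H s m e → (i * g + g⁻ + q - H * s) + (H * ((i * m + 1ℚ) * s) + e) ≡ i * (g + H * s * m) + (g⁻ + e) + q
  collect = solve-∀ ℚ-ring

divide-G-τ : ∀ j M n → ι (suc n) * G j M (suc n) + τ (suc j) M (suc n) ≡ ι (suc j) * h (suc j) (suc n) →
             G j M (suc n) + τ (suc j) M (suc n) * r n ≡ ι (suc j) * h/ (suc j) (suc n)
divide-G-τ j M n eq = begin
  G j M (suc n) + τ (suc j) M (suc n) * r n
    ≡⟨ cong (_+ τ (suc j) M (suc n) * r n) (trans (sym (*-identityˡ (G j M (suc n)))) (cong (_* G j M (suc n)) (sym (L*r n)))) ⟩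
  L n * r n * G j M (suc n) + τ (suc j) M (suc n) * r n
    ≡⟨ factor (L n) (r n) (G j M (suc n)) (τ (suc j) M (suc n)) ⟩
  (L n * G j M (suc n) + τ (suc j) M (suc n)) * r n
    ≡⟨ cong (_* r n) eq ⟩
  L j * h (suc j) (suc n) * r n
    ≡⟨ *-assoc (L j) (h (suc j) (suc n)) (r n) ⟩
  L j * (h (suc j) (suc n) * r n) ∎
  where
  open ≡-Reasoning
  factor : ∀ l r g t → l * r * g + t * r ≡ (l * g + t) * r
  factor = solve-∀ ℚ-ring

-- As M → ∞ this becomes ∑_m h_j(n+m)/(m(n+m)) = (j+1) h_{j+1}(n)/n for n ≥ 1, the coefficientwise
-- form of d/du (1-t)ᵘ = -Li₁(t) (1-t)ᵘ under the beta integral.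
G-τ : ∀ j M n → ι n * G j M n + τ (suc j) M n ≡ ι (suc j) * h (suc j) n
G-τ j M zero    = trans (+-identityʳ _) (trans (*-zeroˡ (G j M 0)) (sym (*-zeroʳ (L j))))
G-τ j M (suc n) = begin
  L n * G j M (suc n) + (τ (suc j) M n + τ j M (suc n) * r n + h/ j (suc n ℕ.+ M))
    ≡⟨ rearrange (L n * G j M (suc n)) (τ (suc j) M n) (τ j M (suc n) * r n) (h/ j (suc n ℕ.+ M)) ⟩
  (L n * G j M (suc n) + h/ j (suc n ℕ.+ M)) + (τ (suc j) M n + τ j M (suc n) * r n)
    ≡⟨ cong (_+ (τ (suc j) M n + τ j M (suc n) * r n)) (G-step j M n) ⟩
  (ι n * G j M n + G⁻ j M (suc n) + h/ j (suc n)) + (τ (suc j) M n + τ j M (suc n) * r n)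
    ≡⟨ rearrange′ (ι n * G j M n) (G⁻ j M (suc n)) (h/ j (suc n)) (τ (suc j) M n) (τ j M (suc n) * r n) ⟩
  (ι n * G j M n + τ (suc j) M n) + ((G⁻ j M (suc n) + τ j M (suc n) * r n) + h/ j (suc n))
    ≡⟨ cong₂ (λ s t → s + (t + h/ j (suc n))) (G-τ j M n) (previous j) ⟩
  L j * h (suc j) n + (ι j * (h j (suc n) * r n) + h j (suc n) * r n)
    ≡⟨ cong (λ t → t * h (suc j) n + (ι j * (h j (suc n) * r n) + h j (suc n) * r n)) (ι-suc j) ⟩
  (ι j + 1ℚ) * h (suc j) n + (ι j * (h j (suc n) * r n) + h j (suc n) * r n)
    ≡⟨ collect (ι j) (h (suc j) n) (h j (suc n) * r n) ⟩
  (ι j + 1ℚ) * (h (suc j) n + h j (suc n) * r n)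
    ≡⟨ cong₂ _*_ (ι-suc j) (h-suc j n) ⟨
  L j * h (suc j) (suc n) ∎
  where
  open ≡-Reasoning
  rearrange : ∀ a b c d → a + (b + c + d) ≡ (a + d) + (b + c)
  rearrange = solve-∀ ℚ-ring
  rearrange′ : ∀ a b c d e → (a + b + c) + (d + e) ≡ (a + d) + ((b + e) + c)
  rearrange′ = solve-∀ ℚ-ring
  collect : ∀ i x y → (i + 1ℚ) * x + (i * y + y) ≡ (i + 1ℚ) * (x + y)
  collect = solve-∀ ℚ-ring
  previous : ∀ j → G⁻ j M (suc n) + τ j M (suc n) * r n ≡ ι j * (h j (suc n) * r n)
  previous zero    = trans (+-identityˡ _) (trans (*-zeroˡ (r n)) (sym (*-zeroˡ (1ℚ * r n))))
  previous (suc j) = divide-G-τ j M n (G-τ j M (suc n))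

τ≥0 : ∀ j M n → 0ℚ ≤ τ j M n
τ≥0 zero    M n       = ≤-refl
τ≥0 (suc j) M zero    = ≤-refl
τ≥0 (suc j) M (suc n) = 0≤-+ (0≤-+ (τ≥0 (suc j) M n) (0≤-* (τ≥0 j M (suc n)) (r≥0 n))) (h/≥0 j (suc n ℕ.+ M))

small-0 : Small (λ _ → 0ℚ)
small-0 e 0<e = 0 , λ _ _ → <⇒≤ 0<e

τ-small : ∀ j n → Small (λ M → τ j M n)
τ-small zero    n       = small-0
τ-small (suc j) zero    = small-0
τ-small (suc j) (suc n) = small-+ (small-+ (τ-small (suc j) n)
    (small-≡ (λ M → *-comm (τ j M (suc n)) (r n)) (small-* (r n) (r≥0 n) (τ-small j (suc n)))))
  (offset n)
  where
  offset : ∀ n → Small (λ M → h/ j (suc n ℕ.+ M))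
  offset n e 0<e = let N , p = h/-small j e 0<e in N , λ M l → p (n ℕ.+ M) (ℕ.≤-trans l (ℕ.m≤n+m M n))

G≥0 : ∀ j M n → 0ℚ ≤ G j M n
G≥0 j zero    n = ≤-refl
G≥0 j (suc M) n = 0≤-+ (G≥0 j M n) (0≤-* (h/≥0 j (suc (n ℕ.+ M))) (r≥0 M))

-- Tannery's theorem along antidiagonals

diag-below : ∀ {b f} → (∀ i j → f i j ≤ b i) → ∀ n → diag f n ≤ Σ≤ b n
diag-below le zero            = le 0 0
diag-below {b} le (suc n) = ≤-trans (+-mono-≤ (le 0 (suc n)) (diag-below {b ∘ suc} (le ∘ suc) n)) (≤-reflexive (sym (Σ≤-front b n)))

-- A far antidiagonal meets each of the rows 0,...,m far out, where `f i` is close to `b i`; the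
-- other rows contribute at least 0.
diag-above : ∀ {b f} → (∀ i j → 0ℚ ≤ f i j) → (∀ i → Small (λ j → b i - f i j)) →
             ∀ m e → 0ℚ < e → ∃ λ N → ∀ n → N ℕ.≤ n → Σ≤ b m ≤ diag f n + e
diag-above {b} {f} nn small zero e 0<e = let N , p = small 0 e 0<e in suc N , λ { (suc n) (s≤s l) → begin
    b 0                                        ≡⟨ cancel (b 0) (f 0 (suc n)) ⟩
    f 0 (suc n) + (b 0 - f 0 (suc n))          ≤⟨ +-monoʳ-≤ (f 0 (suc n)) (p (suc n) (ℕ.m≤n⇒m≤1+n l)) ⟩
    f 0 (suc n) + e                            ≡⟨ cong (_+ e) (+-identityʳ (f 0 (suc n))) ⟨
    f 0 (suc n) + 0ℚ + e                       ≤⟨ +-monoˡ-≤ e (+-monoʳ-≤ (f 0 (suc n)) (diag-nonneg (nn ∘ suc) n)) ⟩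
    f 0 (suc n) + diag (f ∘ suc) n + e         ∎ }
  where
  open ≤-Reasoning
  cancel : ∀ a b → a ≡ b + (a - b)
  cancel = solve-∀ ℚ-ring
diag-above {b} {f} nn small (suc m) e 0<e =
  let δ , 0<δ , δ+δ≡e = Cauchy.halve e 0<e
      M , p = small 0 δ 0<δ
      N , q = diag-above {b ∘ suc} {f ∘ suc} (nn ∘ suc) (small ∘ suc) m δ 0<δ
  in suc (M ℕ.⊔ N) , λ { (suc n) (s≤s l) → begin
    Σ≤ b (suc m)                                              ≡⟨ Σ≤-front b m ⟩
    b 0 + Σ≤ (b ∘ suc) m                                      ≤⟨ +-monoʳ-≤ (b 0) (q n (ℕ.m⊔n≤o⇒n≤o M N l)) ⟩
    b 0 + (diag (f ∘ suc) n + δ)                              ≡⟨ cancel (b 0) (f 0 (suc n)) (diag (f ∘ suc) n) δ ⟩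
    (f 0 (suc n) + diag (f ∘ suc) n + δ) + (b 0 - f 0 (suc n)) ≤⟨ +-monoʳ-≤ (f 0 (suc n) + diag (f ∘ suc) n + δ) (p (suc n) (ℕ.m≤n⇒m≤1+n (ℕ.m⊔n≤o⇒m≤o M N l))) ⟩
    (f 0 (suc n) + diag (f ∘ suc) n + δ) + δ                  ≡⟨ trans (+-assoc (f 0 (suc n) + diag (f ∘ suc) n) δ δ) (cong (f 0 (suc n) + diag (f ∘ suc) n +_) δ+δ≡e) ⟩
    f 0 (suc n) + diag (f ∘ suc) n + e                        ∎ }
  where
  open ≤-Reasoning
  cancel : ∀ a b d e → a + (d + e) ≡ (b + d + e) + (a - b)
  cancel = solve-∀ ℚ-ring

∣∣<-intro : ∀ {p e} → - e < p → p < e → ∣ p ∣ < e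
∣∣<-intro {p} {e} lo hi with ∣ p ∣ | ∣p∣≡p∨∣p∣≡-p p
... | _ | inj₁ refl = hi
... | _ | inj₂ refl = subst (- p <_) (neg-involutive e) (neg-antimono-< lo)
  where
  neg-involutive : ∀ p → - (- p) ≡ p
  neg-involutive = solve-∀ ℚ-ring

<-from-∣∣ : ∀ p q {e} → ∣ p - q ∣ < e → p < q + e
<-from-∣∣ p q {e} lt = subst (_< q + e) (cancel p q) (+-monoʳ-< q (≤-<-trans (p≤∣p∣ (p - q)) lt))
  where
  cancel : ∀ p q → q + (p - q) ≡ p
  cancel = solve-∀ ℚ-ring

-- `diag-below` bounds `Σ≤ b m` from below by the antidiagonal sum at the same m, and `diag-above`
-- bounds it from above by one much farther out.
tannery : ∀ {b f α} → (∀ i j → 0ℚ ≤ f i j) → (∀ i j → f i j ≤ b i) → (∀ i → Small (λ j → b i - f i j)) →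
          diag f ⟶ α → Σ≤ b ⟶ α
tannery {b} {f} {α} nn le small (lim (mkNull err)) = lim (mkNull λ e 0<e →
  let η , 0<η , η+η≡e = Cauchy.halve e 0<e
      δ , 0<δ , δ+δ≡η = Cauchy.halve η 0<η
      N₁ , close  = err δ 0<δ
      N₂ , cauchy = isCauchy α δ 0<δ
      -- The upper bound spends δ three times: on the rows up to m, on the convergence of the
      -- antidiagonal sums at n, and on passing from n to m in `approx α`.
      3δ<e = subst₂ _<_ (+-identityʳ (δ + δ + δ)) (trans (+-assoc (δ + δ) δ δ) (trans (cong₂ _+_ δ+δ≡η δ+δ≡η) η+η≡e))
               (+-monoʳ-< (δ + δ + δ) 0<δ)
      δ<e = <-trans (subst (_< δ + δ) (+-identityʳ δ) (+-monoʳ-< δ 0<δ)) (subst (_< e) (sym δ+δ≡η)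
              (subst (η <_) η+η≡e (subst (_< η + η) (+-identityʳ η) (+-monoʳ-< η 0<η))))
  in N₁ ℕ.⊔ N₂ , λ m l →
    let N₃ , above = diag-above {b} {f} nn small m δ 0<δ
        n  = N₁ ℕ.⊔ (N₂ ℕ.⊔ N₃)
        l₁ = ℕ.m≤m⊔n N₁ (N₂ ℕ.⊔ N₃)
        l₂ = ℕ.≤-trans (ℕ.m≤m⊔n N₂ N₃) (ℕ.m≤n⊔m N₁ (N₂ ℕ.⊔ N₃))
        l₃ = ℕ.≤-trans (ℕ.m≤n⊔m N₂ N₃) (ℕ.m≤n⊔m N₁ (N₂ ℕ.⊔ N₃))
        m₁ = ℕ.m⊔n≤o⇒m≤o N₁ N₂ l
        m₂ = ℕ.m⊔n≤o⇒n≤o N₁ N₂ l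
    in ∣∣<-intro
      (<-trans (neg-antimono-< δ<e) (lower (approx α m) (Σ≤ b m) δ
        (<-≤-trans (<-from-∣∣ (approx α m) (diag f m) (subst (_< δ) (swap (diag f m) (approx α m)) (close m m₁))) (+-monoˡ-≤ δ (diag-below {b} {f} le m)))))
      (<-trans (upper (approx α m) (Σ≤ b m) δ (≤-<-trans (above n l₃)
        (subst (diag f n + δ <_) (regroup (approx α m) δ) (+-monoˡ-< δ
          (<-trans (<-from-∣∣ (diag f n) (approx α n) (close n l₁)) (+-monoˡ-< δ (<-from-∣∣ (approx α n) (approx α m) (cauchy n m l₂ m₂)))))))) 3δ<e))
  where
  swap : ∀ p q → ∣ p - q ∣ ≡ ∣ q - p ∣
  swap p q = trans (sym (∣-p∣≡∣p∣ (p - q))) (cong ∣_∣ (flip p q))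
    where
    flip : ∀ p q → - (p - q) ≡ q - p
    flip = solve-∀ ℚ-ring
  regroup : ∀ a d → a + d + d + d ≡ a + (d + d + d)
  regroup = solve-∀ ℚ-ring
  lower : ∀ a s d → a < s + d → - d < s - a
  lower a s d lt = subst₂ _<_ (e₁ a d) (e₂ a s d) (+-monoˡ-< (- a - d) lt)
    where
    e₁ : ∀ a d → a + (- a - d) ≡ - d
    e₁ = solve-∀ ℚ-ring
    e₂ : ∀ a s d → (s + d) + (- a - d) ≡ s - a
    e₂ = solve-∀ ℚ-ring
  upper : ∀ a s d → s < a + (d + d + d) → s - a < d + d + d
  upper a s d lt = subst (s - a <_) (e₁ a (d + d + d)) (+-monoˡ-< (- a) lt)
    where
    e₁ : ∀ a d → (a + d) - a ≡ d
    e₁ = solve-∀ ℚ-ring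

-- Shuffle regularized values as limits

c-z : ∀ w k n → c (w · z k) (suc n) ≡ Σ≤ (c w) n * (1/ suc n ^ val k)
c-z w (1+ zero)  n = cong (Σ≤ (c w) n *_) (sym (1/-one n))
c-z w (1+ suc j) n = trans (cong (_* r n) (c-z w (1+ j) n)) (trans (rearrange (Σ≤ (c w) n) (1/ suc n ^ suc j) (r n))
  (cong (Σ≤ (c w) n *_) (sym (1/-suc n (suc j)))))
  where
  rearrange : ∀ a b r → a * b * r ≡ a * (r * b)
  rearrange = solve-∀ ℚ-ring

c-z-zero : ∀ w k → c (w · z k) 0 ≡ 0ℚ
c-z-zero w (1+ zero)  = refl
c-z-zero w (1+ suc j) = refl

ζ≤-c : ∀ k n → ζ≤ k n ≡ Σ≤ (c (zʷ k)) n
ζ≤-c k = go k (λ _ → 1ℚ) ε (λ n → sym (Σ≤-c-ε n))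
  where
  step-c : ∀ a w k → (∀ n → a n ≡ Σ≤ (c w) n) → ∀ n → step a k n ≡ Σ≤ (c (w · z k)) n
  step-c a w k eq zero    = sym (c-z-zero w k)
  step-c a w k eq (suc n) = cong₂ _+_ (step-c a w k eq n)
    (trans (cong (_* (1/ suc n ^ val k)) (eq n)) (sym (c-z w k n)))

  go : ∀ ks a w → (∀ n → a n ≡ Σ≤ (c w) n) → ∀ n → foldl step a ks n ≡ Σ≤ (c (foldl (λ v k → v · z k) w ks)) n
  go []       a w eq n = eq n
  go (k ∷ ks) a w eq n = go ks (step a k) (w · z k) (step-c a w k eq) n

zʷ-∷ʳ : ∀ ks k → zʷ (ks ∷ʳ k) ≡ zʷ ks · z k
zʷ-∷ʳ ks k = foldl-∷ʳ (λ w k → w · z k) ε k ks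

last-z : ∀ v → ∃ λ ks → ∃ λ k → zʷ (ks ∷ʳ k) ≡ ε ∙ 𝑦 · v
last-z ε       = [] , 1+ 0 , refl
last-z (v ∙ 𝑥) = let ks , k , eq = last-z v in ks , 1+ suc (ℕ⁺.pred k) ,
  trans (zʷ-∷ʳ ks (1+ suc (ℕ⁺.pred k))) (cong (_∙ 𝑥) (trans (sym (zʷ-∷ʳ ks k)) eq))
last-z (v ∙ 𝑦) = let ks , k , eq = last-z v in ks ∷ʳ k , 1+ 0 ,
  trans (zʷ-∷ʳ (ks ∷ʳ k) (1+ 0)) (cong (_∙ 𝑦) eq)

admissible-z : ∀ v → ∃ λ k → Admissible k × zʷ k ≡ (ε ∙ 𝑦 · v) ∙ 𝑥
admissible-z v = let ks , k , eq = last-z v ; k⁺ = 1+ suc (ℕ⁺.pred k) in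
  ks ∷ʳ k⁺ , last≥2 ks (s≤s (s≤s z≤n)) ,
  trans (zʷ-∷ʳ ks k⁺) (cong (_∙ 𝑥) (trans (sym (zʷ-∷ʳ ks k)) eq))

infixl 6 _∙𝑦^_

_∙𝑦^_ : Word → ℕ → Word
w ∙𝑦^ zero  = w
w ∙𝑦^ suc j = (w ∙𝑦^ j) ∙ 𝑦

sg : ℕ → ℚ
sg zero    = 1ℚ
sg (suc j) = - sg j

sg² : ∀ j → sg j * sg j ≡ 1ℚ
sg² zero    = refl
sg² (suc j) = trans (square (sg j)) (sg² j)
  where
  square : ∀ s → - s * - s ≡ s * s
  square = solve-∀ ℚ-ring

c≥0 : ∀ w n → 0ℚ ≤ c w n
c≥0 ε       zero    = 0≤1
c≥0 ε       (suc n) = ≤-refl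
c≥0 (w ∙ u) zero    = ≤-refl
c≥0 (w ∙ 𝑥) (suc n) = 0≤-* (c≥0 w (suc n)) (r≥0 n)
c≥0 (w ∙ 𝑦) (suc n) = 0≤-* (Σ≥0 n) (r≥0 n)
  where
  Σ≥0 : ∀ n → 0ℚ ≤ Σ≤ (c w) n
  Σ≥0 zero    = c≥0 w 0
  Σ≥0 (suc n) = 0≤-+ (Σ≥0 n) (c≥0 w (suc n))

-- As n → ∞, reg (c v) j n tends to the coefficient of uʲ in ∫₀¹ Li_v(t) (1-t)ᵘ dt/t.
reg : (ℕ → ℚ) → ℕ → ℕ → ℚ
reg a j n = sg j * Σ≤ (λ i → a i * h/ j i) n

⟶-scale : ∀ {a s} q → a ⟶ s → (λ n → q * a n) ⟶ fromℚ q ⊗ s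
⟶-scale q a⟶s = ⟶-⊗ (⟶-const q) a⟶s

⟨⟩-∙ : ∀ ψ h u → ⟨ ψ , h ∙ᴴ u ⟩ ≡ ⟨ (λ w → ψ (w ∙ u)) , h ⟩
⟨⟩-∙ ψ []            u = refl
⟨⟩-∙ ψ ((q , w) ∷ h) u = cong (fromℚ q ⊗ ψ (w ∙ u) ⊕_) (⟨⟩-∙ ψ h u)

opaque
  unfolding _⊕_

  fromℚ-suc : ∀ j s → s ⊕ fromℚ (ι (suc j)) ⊗ s ≈ᴿ fromℚ (ι (suc (suc j))) ⊗ s
  fromℚ-suc j s = pointwise λ n → trans (one+ (ι (suc j)) (approx s n)) (cong (_* approx s n) (sym (ι-suc (suc j))))
    where
    one+ : ∀ i s → s + i * s ≡ (i + 1ℚ) * s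
    one+ = solve-∀ ℚ-ring

  solve-last : ∀ j s t → fromℚ (ι (suc j)) ⊗ s ⊕ t ≈ᴿ 0ᴿ → t ≈ᴿ ⊖ (fromℚ (ι (suc j)) ⊗ s)
  solve-last j s t eq = ≈-trans (pointwise λ n → cancel (ι (suc j) * approx s n) (approx t n))
    (≈-trans (⊕-cong eq (≈-refl {⊖ (fromℚ (ι (suc j)) ⊗ s)})) (Real.+-identityˡ _))
    where
    cancel : ∀ a t → t ≡ (a + t) + - a
    cancel = solve-∀ ℚ-ring

  rescale : ∀ j i s → fromℚ (sg (suc j) * r i) ⊗ (fromℚ (sg j) ⊗ ⊖ (fromℚ (ι (suc i)) ⊗ s)) ≈ᴿ s
  rescale j i s = pointwise λ n → trans (rearrange (sg j) (r i) (L i) (approx s n))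
    (trans (cong₂ (λ a b → a * b * approx s n) (sg² j) (L*r i)) (trans (cong (_* approx s n) (*-identityˡ 1ℚ)) (*-identityˡ (approx s n))))
    where
    rearrange : ∀ s r l x → (- s * r) * (s * - (l * x)) ≡ (s * s) * (l * r) * x
    rearrange = solve-∀ ℚ-ring

module Regularization {ψ} (char : ShuffleCharacter ψ) where
  open ShuffleCharacter char
  open ≈ᴿ-Reasoning

  -- Inserting y after the last x gives the same word in each of the j + 1 places; inserting it
  -- earlier leaves the tail x yʲ intact. `F` is arbitrary because the induction absorbs trailing
  -- letters into it.
  sh-∙𝑦^ : ∀ (F : Word → ℝ) w j → ⟨ F , (ε ∙ 𝑦) shʷ (w ∙ 𝑥 ∙𝑦^ j) ⟩ ≈ᴿ
           fromℚ (ι (suc j)) ⊗ F (w ∙ 𝑥 ∙𝑦^ suc j) ⊕ ⟨ (λ v → F (v ∙ 𝑥 ∙𝑦^ j)) , (ε ∙ 𝑦) shʷ w ⟩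
  sh-∙𝑦^ F w zero    = ⊕-cong ≈-refl (Real.reflexive (⟨⟩-∙ F ((ε ∙ 𝑦) shʷ w) 𝑥))
  sh-∙𝑦^ F w (suc j) = begin
    fromℚ 1ℚ ⊗ F (w ∙ 𝑥 ∙𝑦^ suc (suc j)) ⊕ ⟨ F , ((ε ∙ 𝑦) shʷ (w ∙ 𝑥 ∙𝑦^ j)) ∙ᴴ 𝑦 ⟩
      ≈⟨ ⊕-cong (Real.*-identityˡ _) (Real.reflexive (⟨⟩-∙ F ((ε ∙ 𝑦) shʷ (w ∙ 𝑥 ∙𝑦^ j)) 𝑦)) ⟩
    F (w ∙ 𝑥 ∙𝑦^ suc (suc j)) ⊕ ⟨ (λ v → F (v ∙ 𝑦)) , (ε ∙ 𝑦) shʷ (w ∙ 𝑥 ∙𝑦^ j) ⟩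
      ≈⟨ ⊕-cong ≈-refl (sh-∙𝑦^ (λ v → F (v ∙ 𝑦)) w j) ⟩
    F (w ∙ 𝑥 ∙𝑦^ suc (suc j)) ⊕ (fromℚ (ι (suc j)) ⊗ F (w ∙ 𝑥 ∙𝑦^ suc (suc j)) ⊕ rest)
      ≈⟨ Real.+-assoc _ _ _ ⟨
    (F (w ∙ 𝑥 ∙𝑦^ suc (suc j)) ⊕ fromℚ (ι (suc j)) ⊗ F (w ∙ 𝑥 ∙𝑦^ suc (suc j))) ⊕ rest
      ≈⟨ ⊕-cong (fromℚ-suc j _) ≈-refl ⟩
    fromℚ (ι (suc (suc j))) ⊗ F (w ∙ 𝑥 ∙𝑦^ suc (suc j)) ⊕ rest ∎
    where rest = ⟨ (λ v → F (v ∙ 𝑥 ∙𝑦^ suc j)) , (ε ∙ 𝑦) shʷ w ⟩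

  word¹-∙𝑦^ : ∀ v j → Word¹ ((ε ∙ 𝑦 · v) ∙ 𝑥 ∙𝑦^ j)
  word¹-∙𝑦^ v j = Words.StartsY⇒Word¹ (starts j)
    where
    starts : ∀ j → Words.StartsY ((ε ∙ 𝑦 · v) ∙ 𝑥 ∙𝑦^ j)
    starts zero    = v ∙ 𝑥 , refl
    starts (suc j) = let w , eq = starts j in w ∙ 𝑦 , cong (_∙ 𝑦) eq

  -- from 0 = ψ(y) ψ(v x y^j) = ψ(y sh v x y^j)
  ψ-∙𝑦^ : ∀ v j → ⟨ (λ w → ψ (w ∙ 𝑥 ∙𝑦^ j)) , (ε ∙ 𝑦) shʷ (ε ∙ 𝑦 · v) ⟩
                ≈ᴿ ⊖ (fromℚ (ι (suc j)) ⊗ ψ ((ε ∙ 𝑦 · v) ∙ 𝑥 ∙𝑦^ suc j))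
  ψ-∙𝑦^ v j = solve-last j _ _ (begin
    fromℚ (ι (suc j)) ⊗ ψ ((ε ∙ 𝑦 · v) ∙ 𝑥 ∙𝑦^ suc j) ⊕ ⟨ (λ w → ψ (w ∙ 𝑥 ∙𝑦^ j)) , (ε ∙ 𝑦) shʷ (ε ∙ 𝑦 · v) ⟩
      ≈⟨ sh-∙𝑦^ ψ (ε ∙ 𝑦 · v) j ⟨
    ⟨ ψ , (ε ∙ 𝑦) shʷ ((ε ∙ 𝑦 · v) ∙ 𝑥 ∙𝑦^ j) ⟩
      ≈⟨ ψ-sh (y· ε) (word¹-∙𝑦^ v j) ⟨
    ψ (ε ∙ 𝑦) ⊗ ψ ((ε ∙ 𝑦 · v) ∙ 𝑥 ∙𝑦^ j)
      ≈⟨ ⊗-cong ψ-y ≈-refl ⟩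
    0ᴿ ⊗ ψ ((ε ∙ 𝑦 · v) ∙ 𝑥 ∙𝑦^ j)
      ≈⟨ Real.zeroˡ _ ⟩
    0ᴿ ∎)

  reg-list : ∀ j → (∀ v → reg (c (ε ∙ 𝑦 · v)) j ⟶ ψ ((ε ∙ 𝑦 · v) ∙ 𝑥 ∙𝑦^ j)) →
             ∀ h → All (Words.StartsY ∘ proj₂) h → reg (cᴴ h) j ⟶ ⟨ (λ w → ψ (w ∙ 𝑥 ∙𝑦^ j)) , h ⟩
  reg-list j reg-word []            []                 = ⟶-cong (λ n → sym (trans
    (cong (sg j *_) (trans (Σ≤-cong (λ i → *-zeroˡ (h/ j i)) n) (Σ≤-0 n))) (*-zeroʳ (sg j)))) (⟶-const 0ℚ)
  reg-list j reg-word ((q , _) ∷ h) ((v , refl) ∷ all) = ⟶-cong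
    (λ n → split n) (⟶-⊕ (⟶-scale q (reg-word v)) (reg-list j reg-word h all))
    where
    w = ε ∙ 𝑦 · v
    split : ∀ n → q * reg (c w) j n + reg (cᴴ h) j n ≡ reg (cᴴ ((q , w) ∷ h)) j n
    split n = trans (rearrange q (sg j) (Σ≤ (λ i → c w i * h/ j i) n) (Σ≤ (λ i → cᴴ h i * h/ j i) n))
      (cong (sg j *_) (sym (trans (Σ≤-cong (λ i → distribute q (c w i) (cᴴ h i) (h/ j i)) n)
        (trans (Σ≤-+ (λ i → q * (c w i * h/ j i)) (λ i → cᴴ h i * h/ j i) n)
          (cong (_+ Σ≤ (λ i → cᴴ h i * h/ j i) n) (Σ≤-* q (λ i → c w i * h/ j i) n))))))
      where
      rearrange : ∀ q s a b → q * (s * a) + s * b ≡ s * (q * a + b)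
      rearrange = solve-∀ ℚ-ring
      distribute : ∀ q a b t → (q * a + b) * t ≡ q * (a * t) + b * t
      distribute = solve-∀ ℚ-ring

  -- By `cᴴ-sh` the first series is a double series with terms c_i/m · h_j(i+m)/(i+m), summed along
  -- antidiagonals. Summing over m first turns row i into (j+1) c_i h_{j+1}(i)/i by `G-τ`, and the
  -- terms are nonnegative.
  exchange : ∀ v j {α} → Σ≤ (λ n → cᴴ ((ε ∙ 𝑦) shʷ (ε ∙ 𝑦 · v)) n * h/ j n) ⟶ α →
             Σ≤ (λ n → c (ε ∙ 𝑦 · v) n * (ι (suc j) * h/ (suc j) n)) ⟶ α
  exchange v j lim-A = tannery {b} {f} (λ i M → 0≤-* (c≥0 w i) (G≥0 j M i)) f≤b small
    (⟶-cong (λ n → sym (trans (diag-Σ≤ f e base inc n) (Σ≤-cong collapse n))) lim-A)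
    where
    w = ε ∙ 𝑦 · v
    b : ℕ → ℚ
    b i = c w i * (ι (suc j) * h/ (suc j) i)
    -- `e` holds the terms of the double series, `f` the partial sums of its rows, and `b` the
    -- limits of the rows.
    f e : ℕ → ℕ → ℚ
    f i M = c w i * G j M i
    e i M = h/ j (i ℕ.+ M) * (c w i * recip M)

    base : ∀ i → f i 0 ≡ e i 0
    base i = sym (trans (cong (h/ j (i ℕ.+ 0) *_) (*-zeroʳ (c w i))) (trans (*-zeroʳ (h/ j (i ℕ.+ 0))) (sym (*-zeroʳ (c w i)))))
    inc : ∀ i M → f i (suc M) ≡ f i M + e i (suc M)
    inc i M = trans (rearrange (c w i) (G j M i) (h/ j (suc (i ℕ.+ M))) (r M))
      (cong (λ t → f i M + h/ j t * (c w i * r M)) (sym (ℕ.+-suc i M)))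
      where
      rearrange : ∀ a g h r → a * (g + h * r) ≡ a * g + h * (a * r)
      rearrange = solve-∀ ℚ-ring
    collapse : ∀ n → diag e n ≡ cᴴ ((ε ∙ 𝑦) shʷ w) n * h/ j n
    collapse n = trans (diag-weight (h/ j) (λ i M → c w i * recip M) n)
      (trans (*-comm (h/ j n) _) (cong (_* h/ j n) (sym (cᴴ-sh v n))))

    gap : ∀ i M → b (suc i) - f (suc i) M ≡ (c w (suc i) * r i) * τ (suc j) M (suc i)
    gap i M = trans (cong (λ t → c w (suc i) * t - f (suc i) M) (sym (divide-G-τ j M i (G-τ j M (suc i)))))
      (rearrange (c w (suc i)) (G j M (suc i)) (τ (suc j) M (suc i)) (r i))
      where
      rearrange : ∀ a g t r → a * (g + t * r) - a * g ≡ (a * r) * t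
      rearrange = solve-∀ ℚ-ring
    gap₀ : ∀ M → b 0 - f 0 M ≡ 0ℚ
    gap₀ M = trans (cong (λ t → t * (ι (suc j) * 0ℚ) - t * G j M 0) (c-startsY v)) (rearrange (ι (suc j) * 0ℚ) (G j M 0))
      where
      rearrange : ∀ a b → 0ℚ * a - 0ℚ * b ≡ 0ℚ
      rearrange = solve-∀ ℚ-ring
    small : ∀ i → Small (λ M → b i - f i M)
    small zero    = small-≡ gap₀ small-0
    small (suc i) = small-≡ (gap i) (small-* (c w (suc i) * r i) (0≤-* (c≥0 w (suc i)) (r≥0 i)) (τ-small (suc j) (suc i)))
    f≤b : ∀ i M → f i M ≤ b i
    f≤b i M = subst₂ _≤_ (+-identityˡ (f i M)) (cancel (b i) (f i M)) (+-monoˡ-≤ (f i M) (gap≥0 i))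
      where
      cancel : ∀ b f → (b - f) + f ≡ b
      cancel = solve-∀ ℚ-ring
      gap≥0 : ∀ i → 0ℚ ≤ b i - f i M
      gap≥0 zero    = ≤-reflexive (sym (gap₀ M))
      gap≥0 (suc i) = subst (0ℚ ≤_) (sym (gap i M)) (0≤-* (0≤-* (c≥0 w (suc i)) (r≥0 i)) (τ≥0 (suc j) M (suc i)))

  -- For j = 0 the word is admissible and `reg` is a truncated zeta value. In the step the
  -- hypothesis is applied to the words of y sh w, w = `ε ∙ 𝑦 · v`: `exchange` produces j + 1 times
  -- the sum for j + 1, `ψ-∙𝑦^` produces -(j+1) ψ(w x y^{j+1}), and the common factor is divided
  -- out.
  reg-word : ∀ j v → reg (c (ε ∙ 𝑦 · v)) j ⟶ ψ ((ε ∙ 𝑦 · v) ∙ 𝑥 ∙𝑦^ j)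
  reg-word zero    v = let k , adm , eq = admissible-z v in
    ⟶-cong (λ n → trans (ζ≤-c k n) (trans (cong (λ w → Σ≤ (c w) n) eq)
        (trans (Σ≤-cong (coefficient) n) (sym (*-identityˡ _)))))
      (⟶-resp (⟶-approx (ζ k adm)) (≈-trans (≈-sym (ψ-ζ k adm)) (Real.reflexive (cong ψ eq))))
    where
    w = ε ∙ 𝑦 · v
    coefficient : ∀ n → c (w ∙ 𝑥) n ≡ c w n * h/ 0 n
    coefficient zero    = sym (*-zeroʳ (c w 0))
    coefficient (suc n) = cong (c w (suc n) *_) (sym (*-identityˡ (r n)))
  reg-word (suc j) v = ⟶-resp
    (⟶-cong (λ n → trans (cong (λ t → sg (suc j) * r j * t) (trans (Σ≤-cong (λ i → comm (c w i) (ι (suc j)) (h/ (suc j) i)) n) (Σ≤-* (ι (suc j)) (λ i → c w i * h/ (suc j) i) n)))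
        (trans (rearrange (sg (suc j)) (r j) (L j) (Σ≤ (λ i → c w i * h/ (suc j) i) n)) (trans (cong (_* reg (c w) (suc j) n) (L*r j)) (*-identityˡ _))))
      (⟶-scale (sg (suc j) * r j) (exchange v j
        (⟶-cong (λ n → trans (sym (*-assoc (sg j) (sg j) _)) (trans (cong (_* Σ≤ (λ i → cᴴ ((ε ∙ 𝑦) shʷ w) i * h/ j i) n) (sg² j)) (*-identityˡ _)))
          (⟶-scale (sg j) (reg-list j (reg-word j) ((ε ∙ 𝑦) shʷ w) (Words.sh-startsY ε v)))))))
    (≈-trans (⊗-cong ≈-refl (⊗-cong ≈-refl (ψ-∙𝑦^ v j))) (rescale j j _))
    where
    w = ε ∙ 𝑦 · v
    comm : ∀ a i h → a * (i * h) ≡ i * (a * h)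
    comm = solve-∀ ℚ-ring
    rearrange : ∀ s r l x → s * r * (l * x) ≡ l * r * (s * x)
    rearrange = solve-∀ ℚ-ring

-- The convolution algebra of functions of indices

-- (f ✶ g)(k) = ∑ f(k₁,…,kᵢ) g(kᵢ₊₁,…,kᵣ)
convolve : ∀ {A : Set} → (A → A → A) → (A → A → A) → (Index → A) → (Index → A) → Index → A
convolve _+′_ _*′_ f g []       = f [] *′ g []
convolve _+′_ _*′_ f g (k ∷ ks) = (f [] *′ g (k ∷ ks)) +′ convolve _+′_ _*′_ (f ∘ (k ∷_)) g ks

infixl 7 _✶_

_✶_ : (Index → ℚ) → (Index → ℚ) → Index → ℚ
_✶_ = convolve _+_ _*_

✶-cong : ∀ {f f′ g g′} → (∀ k → f k ≡ f′ k) → (∀ k → g k ≡ g′ k) → ∀ k → (f ✶ g) k ≡ (f′ ✶ g′) k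
✶-cong p q []       = cong₂ _*_ (p []) (q [])
✶-cong p q (k ∷ ks) = cong₂ _+_ (cong₂ _*_ (p []) (q (k ∷ ks))) (✶-cong (p ∘ (k ∷_)) q ks)

-- The shape `a * f l + f′ l` is that of `(f ✶ g) (k ∷ l)` as a function of `l`, as it arises in
-- `✶-assoc`.
✶-linearˡ : ∀ a f f′ g k → ((λ l → a * f l + f′ l) ✶ g) k ≡ a * (f ✶ g) k + (f′ ✶ g) k
✶-linearˡ a f f′ g []       = rearrange a (f []) (f′ []) (g [])
  where
  rearrange : ∀ a x y z → (a * x + y) * z ≡ a * (x * z) + y * z
  rearrange = solve-∀ ℚ-ring
✶-linearˡ a f f′ g (k ∷ ks) = trans (cong ((a * f [] + f′ []) * g (k ∷ ks) +_) (✶-linearˡ a (f ∘ (k ∷_)) (f′ ∘ (k ∷_)) g ks))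
  (rearrange a (f []) (f′ []) (g (k ∷ ks)) (((f ∘ (k ∷_)) ✶ g) ks) (((f′ ∘ (k ∷_)) ✶ g) ks))
  where
  rearrange : ∀ a x y z s t → (a * x + y) * z + (a * s + t) ≡ a * (x * z + s) + (y * z + t)
  rearrange = solve-∀ ℚ-ring

✶-+ʳ : ∀ f g g′ k → (f ✶ (λ l → g l + g′ l)) k ≡ (f ✶ g) k + (f ✶ g′) k
✶-+ʳ f g g′ []       = *-distribˡ-+ (f []) (g []) (g′ [])
✶-+ʳ f g g′ (k ∷ ks) = trans (cong (f [] * (g (k ∷ ks) + g′ (k ∷ ks)) +_) (✶-+ʳ (f ∘ (k ∷_)) g g′ ks))
  (rearrange (f []) (g (k ∷ ks)) (g′ (k ∷ ks)) (((f ∘ (k ∷_)) ✶ g) ks) (((f ∘ (k ∷_)) ✶ g′) ks))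
  where
  rearrange : ∀ x y z s t → x * (y + z) + (s + t) ≡ (x * y + s) + (x * z + t)
  rearrange = solve-∀ ℚ-ring

✶-zeroˡ : ∀ {f} g → (∀ k → f k ≡ 0ℚ) → ∀ k → (f ✶ g) k ≡ 0ℚ
✶-zeroˡ g z []       = trans (cong (_* g []) (z [])) (*-zeroˡ (g []))
✶-zeroˡ g z (k ∷ ks) = trans (cong₂ _+_ (trans (cong (_* g (k ∷ ks)) (z [])) (*-zeroˡ (g (k ∷ ks)))) (✶-zeroˡ g (z ∘ (k ∷_)) ks)) (+-identityˡ 0ℚ)

✶-assoc : ∀ f g h k → ((f ✶ g) ✶ h) k ≡ (f ✶ (g ✶ h)) k
✶-assoc f g h []       = *-assoc (f []) (g []) (h [])
✶-assoc f g h (k ∷ ks) = trans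
  (cong (f [] * g [] * h (k ∷ ks) +_) (trans (✶-linearˡ (f []) (g ∘ (k ∷_)) ((f ∘ (k ∷_)) ✶ g) h ks)
    (cong (f [] * ((g ∘ (k ∷_)) ✶ h) ks +_) (✶-assoc (f ∘ (k ∷_)) g h ks))))
  (rearrange (f []) (g []) (h (k ∷ ks)) (((g ∘ (k ∷_)) ✶ h) ks) (((f ∘ (k ∷_)) ✶ (g ✶ h)) ks))
  where
  rearrange : ∀ x y z s t → x * y * z + (x * s + t) ≡ x * (y * z + s) + t
  rearrange = solve-∀ ℚ-ring

✶-scalarˡ : ∀ f g → (∀ k ks → f (k ∷ ks) ≡ 0ℚ) → ∀ k → (f ✶ g) k ≡ f [] * g k
✶-scalarˡ f g z []       = refl
✶-scalarˡ f g z (k ∷ ks) = trans (cong (f [] * g (k ∷ ks) +_) (✶-zeroˡ g (z k) ks)) (+-identityʳ _)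

η : Index → ℚ
η []      = 1ℚ
η (_ ∷ _) = 0ℚ

η-∷ʳ : ∀ ks k → η (ks ∷ʳ k) ≡ 0ℚ
η-∷ʳ []      k = refl
η-∷ʳ (_ ∷ _) k = refl

✶-identityˡ : ∀ f k → (η ✶ f) k ≡ f k
✶-identityˡ f k = trans (✶-scalarˡ η f (λ _ _ → refl) k) (*-identityˡ (f k))

✶-snoc : ∀ f g ks k → (f ✶ g) (ks ∷ʳ k) ≡ f (ks ∷ʳ k) * g [] + (f ✶ (λ l → g (l ∷ʳ k))) ks
✶-snoc f g []       k = +-comm (f [] * g [ k ]) _
✶-snoc f g (x ∷ ks) k = trans (cong (f [] * g (x ∷ ks ∷ʳ k) +_) (✶-snoc (f ∘ (x ∷_)) g ks k))
  (rearrange (f [] * g (x ∷ ks ∷ʳ k)) (f (x ∷ ks ∷ʳ k) * g []) (((f ∘ (x ∷_)) ✶ (λ l → g (l ∷ʳ k))) ks))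
  where
  rearrange : ∀ a b c → a + (b + c) ≡ b + (a + c)
  rearrange = solve-∀ ℚ-ring

-- R f(k₁,…,kᵣ) = (-1)ʳ f(kᵣ,…,k₁)
R : (Index → ℚ) → Index → ℚ
R f []       = f []
R f (k ∷ ks) = - R (λ l → f (l ∷ʳ k)) ks

R-cong : ∀ {f g} → (∀ k → f k ≡ g k) → ∀ k → R f k ≡ R g k
R-cong eq []       = eq []
R-cong eq (k ∷ ks) = cong -_ (R-cong (λ l → eq (l ∷ʳ k)) ks)

R-zero : ∀ {f} → (∀ k → f k ≡ 0ℚ) → ∀ k → R f k ≡ 0ℚ
R-zero z []       = z []
R-zero z (k ∷ ks) = cong -_ (R-zero (λ l → z (l ∷ʳ k)) ks)

R-linear : ∀ a f g k → R (λ l → f l * a + g l) k ≡ R f k * a + R g k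
R-linear a f g []       = refl
R-linear a f g (k ∷ ks) = trans (cong -_ (R-linear a (λ l → f (l ∷ʳ k)) (λ l → g (l ∷ʳ k)) ks)) (rearrange (R (λ l → f (l ∷ʳ k)) ks) a (R (λ l → g (l ∷ʳ k)) ks))
  where
  rearrange : ∀ x a y → - (x * a + y) ≡ - x * a + - y
  rearrange = solve-∀ ℚ-ring

-- Reversal exchanges initial and final segments, and the signs of the two segments multiply.
R-✶ : ∀ f g k → R (f ✶ g) k ≡ (R g ✶ R f) k
R-✶ f g []       = *-comm (f []) (g [])
R-✶ f g (k ∷ ks) = begin
  - R (λ l → (f ✶ g) (l ∷ʳ k)) ks
    ≡⟨ cong -_ (R-cong (λ l → ✶-snoc f g l k) ks) ⟩
  - R (λ l → f (l ∷ʳ k) * g [] + (f ✶ (λ l → g (l ∷ʳ k))) l) ks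
    ≡⟨ cong -_ (R-linear (g []) (λ l → f (l ∷ʳ k)) (f ✶ (λ l → g (l ∷ʳ k))) ks) ⟩
  - (R (λ l → f (l ∷ʳ k)) ks * g [] + R (f ✶ (λ l → g (l ∷ʳ k))) ks)
    ≡⟨ cong (λ t → - (R (λ l → f (l ∷ʳ k)) ks * g [] + t)) (R-✶ f (λ l → g (l ∷ʳ k)) ks) ⟩
  - (R (λ l → f (l ∷ʳ k)) ks * g [] + (R (λ l → g (l ∷ʳ k)) ✶ R f) ks)
    ≡⟨ rearrange (R (λ l → f (l ∷ʳ k)) ks) (g []) _ _ (negate (R (λ l → g (l ∷ʳ k))) (R f) ks) ⟩
  g [] * - R (λ l → f (l ∷ʳ k)) ks + ((λ l → - R (λ l → g (l ∷ʳ k)) l) ✶ R f) ks ∎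
  where
  open ≡-Reasoning
  rearrange : ∀ x a y z → z ≡ - y → - (x * a + y) ≡ a * - x + z
  rearrange x a y z refl = solve x a y
    where
    solve : ∀ x a y → - (x * a + y) ≡ a * - x + - y
    solve = solve-∀ ℚ-ring
  negate : ∀ f g k → ((λ l → - f l) ✶ g) k ≡ - (f ✶ g) k
  negate f g []       = sym (neg-distribˡ-* (f []) (g []))
  negate f g (k ∷ ks) = trans (cong (- f [] * g (k ∷ ks) +_) (negate (f ∘ (k ∷_)) g ks)) (collect (f []) (g (k ∷ ks)) _)
    where
    collect : ∀ a b t → - a * b + - t ≡ - (a * b + t)
    collect = solve-∀ ℚ-ring

-- C f(k) = ∑ f over the contractions of k
C⁺ : (Index → ℚ) → ℕ⁺ → Index → ℚ
C⁺ f k []       = f [ k ]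
C⁺ f k (l ∷ ls) = C⁺ (f ∘ (k ∷_)) l ls + C⁺ f (k +⁺ l) ls

C : (Index → ℚ) → Index → ℚ
C f []       = f []
C f (k ∷ ks) = C⁺ f k ks

C⁺-cong : ∀ {f g} → (∀ k → f k ≡ g k) → ∀ k ks → C⁺ f k ks ≡ C⁺ g k ks
C⁺-cong eq k []       = eq [ k ]
C⁺-cong eq k (l ∷ ls) = cong₂ _+_ (C⁺-cong (eq ∘ (k ∷_)) l ls) (C⁺-cong eq (k +⁺ l) ls)

C-cong : ∀ {f g} → (∀ k → f k ≡ g k) → ∀ k → C f k ≡ C g k
C-cong eq []       = eq []
C-cong eq (k ∷ ks) = C⁺-cong eq k ks

C⁺-linear : ∀ a f g k ks → C⁺ (λ l → a * f l + g l) k ks ≡ a * C⁺ f k ks + C⁺ g k ks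
C⁺-linear a f g k []       = refl
C⁺-linear a f g k (l ∷ ls) = trans (cong₂ _+_ (C⁺-linear a (f ∘ (k ∷_)) (g ∘ (k ∷_)) l ls) (C⁺-linear a f g (k +⁺ l) ls)) (rearrange a _ _ _ _)
  where
  rearrange : ∀ a x y z w → (a * x + y) + (a * z + w) ≡ a * (x + z) + (y + w)
  rearrange = solve-∀ ℚ-ring

C⁺-zero : ∀ {f} → (∀ k ks → f (k ∷ ks) ≡ 0ℚ) → ∀ k ks → C⁺ f k ks ≡ 0ℚ
C⁺-zero z k []       = z k []
C⁺-zero z k (l ∷ ls) = trans (cong₂ _+_ (C⁺-zero (λ x xs → z k (x ∷ xs)) l ls) (C⁺-zero z (k +⁺ l) ls)) (+-identityˡ 0ℚ)

-- A cut of a contraction lies at a comma, so it comes from a cut of the index followed by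
-- contractions of the two pieces. The first term collects the cuts with empty first piece.
C⁺-✶ : ∀ f g k ks → C⁺ (f ✶ g) k ks ≡ f [] * C⁺ g k ks + (C⁺ f k ✶ C g) ks
C⁺-✶ f g k []       = refl
C⁺-✶ f g k (l ∷ ls) = begin
  C⁺ (λ m → f [] * g (k ∷ m) + ((f ∘ (k ∷_)) ✶ g) m) l ls + C⁺ (f ✶ g) (k +⁺ l) ls
    ≡⟨ cong₂ _+_ (trans (C⁺-linear (f []) (g ∘ (k ∷_)) ((f ∘ (k ∷_)) ✶ g) l ls)
                   (cong (f [] * C⁺ (g ∘ (k ∷_)) l ls +_) (C⁺-✶ (f ∘ (k ∷_)) g l ls)))
                 (C⁺-✶ f g (k +⁺ l) ls) ⟩
  (f [] * C⁺ (g ∘ (k ∷_)) l ls + (f [ k ] * C⁺ g l ls + (C⁺ (f ∘ (k ∷_)) l ✶ C g) ls))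
    + (f [] * C⁺ g (k +⁺ l) ls + (C⁺ f (k +⁺ l) ✶ C g) ls)
    ≡⟨ rearrange (f []) _ (f [ k ] * C⁺ g l ls) _ _ _ _ (split ls) ⟩
  f [] * C⁺ g k (l ∷ ls) + (C⁺ f k ✶ C g) (l ∷ ls) ∎
  where
  open ≡-Reasoning
  split : ∀ ls → ((λ m → C⁺ (f ∘ (k ∷_)) l m + C⁺ f (k +⁺ l) m) ✶ C g) ls
               ≡ (C⁺ (f ∘ (k ∷_)) l ✶ C g) ls + (C⁺ f (k +⁺ l) ✶ C g) ls
  split ls = trans (✶-cong {g = C g} (λ m → cong (_+ C⁺ f (k +⁺ l) m) (sym (*-identityˡ (C⁺ (f ∘ (k ∷_)) l m)))) (λ _ → refl) ls)
    (trans (✶-linearˡ 1ℚ (C⁺ (f ∘ (k ∷_)) l) (C⁺ f (k +⁺ l)) (C g) ls)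
      (cong (_+ (C⁺ f (k +⁺ l) ✶ C g) ls) (*-identityˡ ((C⁺ (f ∘ (k ∷_)) l ✶ C g) ls))))
  rearrange : ∀ a x y s z t w → w ≡ s + t → (a * x + (y + s)) + (a * z + t) ≡ a * (x + z) + (y + w)
  rearrange a x y s z t w refl = solve a x y s z t
    where
    solve : ∀ a x y s z t → (a * x + (y + s)) + (a * z + t) ≡ a * (x + z) + (y + (s + t))
    solve = solve-∀ ℚ-ring

C-✶ : ∀ f g k → C (f ✶ g) k ≡ (C f ✶ C g) k
C-✶ f g []       = refl
C-✶ f g (k ∷ ks) = C⁺-✶ f g k ks

-- Truncated multiple zeta values as ordered products of the factors η + λₙ

pw : ℕ → ℕ⁺ → ℚ
pw n k = 1/ suc n ^ val k

pw-+⁺ : ∀ n k l → pw n (k +⁺ l) ≡ pw n k * pw n l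
pw-+⁺ n k l = go (val k)
  where
  go : ∀ i → 1/ suc n ^ (i ℕ.+ val l) ≡ (1/ suc n ^ i) * (1/ suc n ^ val l)
  go zero    = sym (*-identityˡ _)
  go (suc i) = trans (1/-suc n (i ℕ.+ val l)) (trans (cong (r n *_) (go i))
    (trans (sym (*-assoc (r n) (1/ suc n ^ i) (1/ suc n ^ val l))) (cong (_* (1/ suc n ^ val l)) (sym (1/-suc n i)))))

-- λ is `pw n` on indices of length one and 0 elsewhere; the third function is the geometric series
-- ∑ λʲ.
η+λ η-λ [η-λ]⁻¹ : ℕ → Index → ℚ
η+λ n []          = 1ℚ
η+λ n (k ∷ [])    = pw n k
η+λ n (_ ∷ _ ∷ _) = 0ℚ
η-λ n []          = 1ℚ
η-λ n (k ∷ [])    = - pw n k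
η-λ n (_ ∷ _ ∷ _) = 0ℚ
[η-λ]⁻¹ n []       = 1ℚ
[η-λ]⁻¹ n (k ∷ ks) = pw n k * [η-λ]⁻¹ n ks

[η-λ]-inverse : ∀ n k → (η-λ n ✶ [η-λ]⁻¹ n) k ≡ η k
[η-λ]-inverse n []       = refl
[η-λ]-inverse n (k ∷ ks) = trans (cong (1ℚ * [η-λ]⁻¹ n (k ∷ ks) +_) (✶-scalarˡ (η-λ n ∘ (k ∷_)) ([η-λ]⁻¹ n) (λ _ _ → refl) ks))
  (cancel (pw n k) ([η-λ]⁻¹ n ks))
  where
  cancel : ∀ p m → 1ℚ * (p * m) + - p * m ≡ 0ℚ
  cancel = solve-∀ ℚ-ring

R-η+λ : ∀ n k → R (η+λ n) k ≡ η-λ n k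
R-η+λ n []           = refl
R-η+λ n (k ∷ [])     = refl
R-η+λ n (k ∷ l ∷ ks) = trans (neg-involutive _) (R-zero (λ m → two m l k) ks)
  where
  neg-involutive : ∀ p → - (- p) ≡ p
  neg-involutive = solve-∀ ℚ-ring
  two : ∀ ks k l → η+λ n ((ks ∷ʳ k) ∷ʳ l) ≡ 0ℚ
  two []           k l = refl
  two (_ ∷ [])     k l = refl
  two (_ ∷ _ ∷ _)  k l = refl

-- On a nonempty index only the contraction to a single entry survives, and `pw n` is multiplicative
-- in the exponent.
C-η+λ : ∀ n k → C (η+λ n) k ≡ [η-λ]⁻¹ n k
C-η+λ n []       = refl
C-η+λ n (k ∷ ks) = go k ks
  where
  go : ∀ k ks → C⁺ (η+λ n) k ks ≡ pw n k * [η-λ]⁻¹ n ks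
  go k []       = sym (*-identityʳ (pw n k))
  go k (l ∷ ls) = trans (cong₂ _+_ (C⁺-zero (λ _ _ → refl) l ls) (go (k +⁺ l) ls))
    (trans (+-identityˡ _) (trans (cong (_* [η-λ]⁻¹ n ls) (pw-+⁺ n k l)) (*-assoc (pw n k) (pw n l) ([η-λ]⁻¹ n ls))))

P : ℕ → Index → ℚ
P n k = ζ≤ k n

P-zero : ∀ k → P 0 k ≡ η k
P-zero k with initLast k
... | []       = refl
... | ks ∷ʳ′ l = trans (cong (λ f → f 0) (foldl-∷ʳ step (λ _ → 1ℚ) l ks)) (sym (η-∷ʳ ks l))

-- The largest summation variable is either n + 1 or at most n.
P-suc : ∀ n k → P (suc n) k ≡ (P n ✶ η+λ n) k
P-suc n k with initLast k
... | []       = refl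
... | ks ∷ʳ′ l = begin
  ζ≤ (ks ∷ʳ l) (suc n)
    ≡⟨ cong (λ f → f (suc n)) (foldl-∷ʳ step (λ _ → 1ℚ) l ks) ⟩
  step (ζ≤ ks) l n + ζ≤ ks n * pw n l
    ≡⟨ cong₂ _+_ (cong (λ f → f n) (foldl-∷ʳ step (λ _ → 1ℚ) l ks)) (last (P n) ks) ⟨
  ζ≤ (ks ∷ʳ l) n + (P n ✶ (λ m → η+λ n (m ∷ʳ l))) ks
    ≡⟨ cong (_+ (P n ✶ (λ m → η+λ n (m ∷ʳ l))) ks) (*-identityʳ (ζ≤ (ks ∷ʳ l) n)) ⟨
  ζ≤ (ks ∷ʳ l) n * 1ℚ + (P n ✶ (λ m → η+λ n (m ∷ʳ l))) ks
    ≡⟨ ✶-snoc (P n) (η+λ n) ks l ⟨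
  (P n ✶ η+λ n) (ks ∷ʳ l) ∎
  where
  open ≡-Reasoning
  long : ∀ x ks → η+λ n (x ∷ ks ∷ʳ l) ≡ 0ℚ
  long x []      = refl
  long x (_ ∷ _) = refl
  last : ∀ f ks → (f ✶ (λ m → η+λ n (m ∷ʳ l))) ks ≡ f ks * pw n l
  last f []       = refl
  last f (x ∷ ks) = trans (cong₂ _+_ (trans (cong (f [] *_) (long x ks)) (*-zeroʳ (f []))) (last (f ∘ (x ∷_)) ks)) (+-identityˡ _)

-- The new right factor η + λ becomes a left factor η - λ under `R` and a right factor (η - λ)⁻¹
-- under `C`, which leaves the product for the previous n in between.
R-P-C-P : ∀ n k → (R (P n) ✶ C (P n)) k ≡ η k
R-P-C-P zero    k = trans (✶-cong (λ l → trans (R-cong P-zero l) (R-η l)) (λ l → trans (C-cong P-zero l) (C-η l)) k) (✶-identityˡ η k)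
  where
  R-η : ∀ k → R η k ≡ η k
  R-η []       = refl
  R-η (k ∷ ks) = cong -_ (R-zero (λ l → η-∷ʳ l k) ks)
  C-η : ∀ k → C η k ≡ η k
  C-η []       = refl
  C-η (k ∷ ks) = C⁺-zero (λ _ _ → refl) k ks
R-P-C-P (suc n) k = begin
  (R (P (suc n)) ✶ C (P (suc n))) k
    ≡⟨ ✶-cong (λ l → trans (R-cong (P-suc n) l) (trans (R-✶ (P n) (η+λ n) l) (✶-cong (R-η+λ n) (λ _ → refl) l)))
              (λ l → trans (C-cong (P-suc n) l) (trans (C-✶ (P n) (η+λ n) l) (✶-cong {f = C (P n)} (λ _ → refl) (C-η+λ n) l))) k ⟩
  ((η-λ n ✶ R (P n)) ✶ (C (P n) ✶ [η-λ]⁻¹ n)) k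
    ≡⟨ ✶-assoc (η-λ n) (R (P n)) (C (P n) ✶ [η-λ]⁻¹ n) k ⟩
  (η-λ n ✶ (R (P n) ✶ (C (P n) ✶ [η-λ]⁻¹ n))) k
    ≡⟨ ✶-cong {f = η-λ n} (λ _ → refl) (λ l → trans (sym (✶-assoc (R (P n)) (C (P n)) ([η-λ]⁻¹ n) l))
         (trans (✶-cong (R-P-C-P n) (λ _ → refl) l) (✶-identityˡ ([η-λ]⁻¹ n) l))) k ⟩
  (η-λ n ✶ [η-λ]⁻¹ n) k
    ≡⟨ [η-λ]-inverse n k ⟩
  η k ∎
  where open ≡-Reasoning

-- Truncated shuffle regularized values

-- on a is supported on the powers of the index (1), with value a n at the n-th power.
on : (ℕ → ℚ) → Index → ℚ
on a []                = a 0
on a ((1+ zero) ∷ ks)  = on (a ∘ suc) ks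
on a ((1+ suc _) ∷ ks) = 0ℚ

on-cong : ∀ {a b} → (∀ n → a n ≡ b n) → ∀ k → on a k ≡ on b k
on-cong eq []                = eq 0
on-cong eq ((1+ zero) ∷ ks)  = on-cong (eq ∘ suc) ks
on-cong eq ((1+ suc _) ∷ ks) = refl

on-linear : ∀ q a b k → q * on a k + on b k ≡ on (λ n → q * a n + b n) k
on-linear q a b []                = refl
on-linear q a b ((1+ zero) ∷ ks)  = on-linear q (a ∘ suc) (b ∘ suc) ks
on-linear q a b ((1+ suc _) ∷ ks) = trans (+-identityʳ _) (*-zeroʳ q)

on-neg : ∀ a k → - on a k ≡ on (λ n → - a n) k
on-neg a []                = refl
on-neg a ((1+ zero) ∷ ks)  = on-neg (a ∘ suc) ks
on-neg a ((1+ suc _) ∷ ks) = refl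

on-✶ : ∀ a b k → (on a ✶ on b) k ≡ on (conv a b) k
on-✶ a b []                = refl
on-✶ a b ((1+ zero) ∷ ks)  = trans (cong (a 0 * on (b ∘ suc) ks +_) (on-✶ (a ∘ suc) b ks)) (on-linear (a 0) (b ∘ suc) (conv (a ∘ suc) b) ks)
on-✶ a b ((1+ suc _) ∷ ks) = trans (cong₂ _+_ (*-zeroʳ (a 0)) (✶-zeroˡ (on b) (λ _ → refl) ks)) (+-identityˡ 0ℚ)

R-on : ∀ a k → R (on a) k ≡ on (λ n → sg n * a n) k
R-on a []                = sym (*-identityˡ (a 0))
R-on a ((1+ zero) ∷ ks)  = trans (cong -_ (trans (R-cong (snoc-one a) ks) (R-on (a ∘ suc) ks)))
  (trans (on-neg _ ks) (on-cong (λ n → neg-distribˡ-* (sg n) (a (suc n))) ks))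
  where
  snoc-one : ∀ a l → on a (l ∷ʳ (1+ zero)) ≡ on (a ∘ suc) l
  snoc-one a []               = refl
  snoc-one a ((1+ zero) ∷ l)  = snoc-one (a ∘ suc) l
  snoc-one a ((1+ suc _) ∷ l) = refl
R-on a ((1+ suc j) ∷ ks) = cong -_ (R-zero (snoc-big a) ks)
  where
  snoc-big : ∀ a l → on a (l ∷ʳ (1+ suc j)) ≡ 0ℚ
  snoc-big a []               = refl
  snoc-big a ((1+ zero) ∷ l)  = snoc-big (a ∘ suc) l
  snoc-big a ((1+ suc _) ∷ l) = refl

-- Every plus sign creates an entry at least 2, where `on a` vanishes.
C-on : ∀ a k → C (on a) k ≡ on a k
C-on a []       = refl
C-on a (k ∷ ks) = go a k ks
  where
  big : ∀ a i ks → C⁺ (on a) (1+ suc i) ks ≡ 0ℚ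
  big a i []       = refl
  big a i (l ∷ ls) = trans (cong₂ _+_ (C⁺-zero (λ _ _ → refl) l ls) (big a _ ls)) (+-identityˡ 0ℚ)
  go : ∀ a k ks → C⁺ (on a) k ks ≡ on a (k ∷ ks)
  go a (1+ zero)  []       = refl
  go a (1+ zero)  (l ∷ ls) = trans (cong₂ _+_ (go (a ∘ suc) l ls) (big a _ ls)) (+-identityʳ _)
  go a (1+ suc i) ks       = big a i ks

-- The coefficients of ∏_{i≤n} (1 + u/i)⁻¹.
h± : ℕ → ℕ → ℚ
h± n j = sg j * h j n

-- E n is the convolution inverse of the part of P n supported on the powers of (1).
E : ℕ → Index → ℚ
E n = on (h± n)

-- The truncation of the shuffle regularized multiple zeta values
s : ℕ → Index → ℚ
s n = P n ✶ E n

E-zero : ∀ k → E 0 k ≡ η k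
E-zero []                = refl
E-zero ((1+ zero) ∷ ks)  = zero-on ks
  where
  zero-on : ∀ ks → on (h± 0 ∘ suc) ks ≡ 0ℚ
  zero-on ks = trans (on-cong (λ j → *-zeroʳ (sg (suc j))) ks) (on-0 ks)
    where
    on-0 : ∀ ks → on (λ _ → 0ℚ) ks ≡ 0ℚ
    on-0 []                = refl
    on-0 ((1+ zero) ∷ ks)  = on-0 ks
    on-0 ((1+ suc _) ∷ ks) = refl
E-zero ((1+ suc _) ∷ ks) = refl

-- the increment of s n, before convolving with P n
X : ℕ → Index → ℚ
X n []                  = 0ℚ
X n ((1+ zero) ∷ ks)    = 0ℚ
X n (k@(1+ suc _) ∷ ks) = pw n k * E (suc n) ks

h±-suc : ∀ n j → h± (suc n) (suc j) + r n * h± (suc n) j ≡ h± n (suc j)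
h±-suc n j = trans (cong (λ t → - sg j * t + r n * (sg j * h j (suc n))) (h-suc j n)) (rearrange (sg j) (h (suc j) n) (h j (suc n)) (r n))
  where
  rearrange : ∀ s a b r → - s * (a + b * r) + r * (s * b) ≡ - s * a
  rearrange = solve-∀ ℚ-ring

-- On the indices (1,...,1) the factor acts as 1 + u/(n+1), which takes `E (suc n)` back to `E n`.
-- The remaining values start with an entry at least 2, so the divergent contributions have
-- cancelled.
η+λ-E : ∀ n k → (η+λ n ✶ E (suc n)) k ≡ E n k + X n k
η+λ-E n []       = refl
η+λ-E n (k ∷ ks) = trans (cong (1ℚ * E (suc n) (k ∷ ks) +_) (✶-scalarˡ (η+λ n ∘ (k ∷_)) (E (suc n)) (λ _ _ → refl) ks)) (split k)
  where
  split : ∀ k → 1ℚ * E (suc n) (k ∷ ks) + pw n k * E (suc n) ks ≡ E n (k ∷ ks) + X n (k ∷ ks)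
  split (1+ zero)  = trans (cong₂ _+_ (*-identityˡ (on (h± (suc n) ∘ suc) ks)) (cong (_* E (suc n) ks) (1/-one n)))
    (trans (+-comm (on (h± (suc n) ∘ suc) ks) _) (trans (on-linear (r n) (h± (suc n)) (h± (suc n) ∘ suc) ks)
      (trans (on-cong (λ j → trans (+-comm (r n * h± (suc n) j) _) (h±-suc n j)) ks) (sym (+-identityʳ _)))))
  split (1+ suc i) = cong (_+ pw n (1+ suc i) * E (suc n) ks) (*-zeroʳ 1ℚ)

s-zero : ∀ k → s 0 k ≡ η k
s-zero k = trans (✶-cong P-zero E-zero k) (✶-identityˡ η k)

s-suc : ∀ n k → s (suc n) k ≡ s n k + (P n ✶ X n) k
s-suc n k = begin
  (P (suc n) ✶ E (suc n)) k
    ≡⟨ ✶-cong {g = E (suc n)} (P-suc n) (λ _ → refl) k ⟩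
  ((P n ✶ η+λ n) ✶ E (suc n)) k
    ≡⟨ ✶-assoc (P n) (η+λ n) (E (suc n)) k ⟩
  (P n ✶ (η+λ n ✶ E (suc n))) k
    ≡⟨ ✶-cong {f = P n} (λ _ → refl) (η+λ-E n) k ⟩
  (P n ✶ (λ l → E n l + X n l)) k
    ≡⟨ ✶-+ʳ (P n) (E n) (X n) k ⟩
  s n k + (P n ✶ X n) k ∎
  where open ≡-Reasoning

ones : ℕ → Index
ones b = replicate b (1+ 0)

-- The cases that regularization treats differently: powers of y, and a nonempty admissible index
-- followed by ones.
data TrailingOnes : Index → Set where
  only-ones : ∀ b → TrailingOnes (ones b)
  then-ones : ∀ l i b → TrailingOnes (l ++ (1+ suc i) ∷ ones b)

trailing-ones : ∀ k → TrailingOnes k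
trailing-ones []       = only-ones 0
trailing-ones (k ∷ ks) with trailing-ones ks
trailing-ones ((1+ zero)  ∷ _) | only-ones b     = only-ones (suc b)
trailing-ones ((1+ suc i) ∷ _) | only-ones b     = then-ones [] i b
trailing-ones (k ∷ _)          | then-ones l i b = then-ones (k ∷ l) i b

✶-X-ones : ∀ f n b → (f ✶ X n) (ones b) ≡ 0ℚ
✶-X-ones f n zero    = *-zeroʳ (f [])
✶-X-ones f n (suc b) = trans (cong₂ _+_ (*-zeroʳ (f [])) (✶-X-ones (f ∘ ((1+ 0) ∷_)) n b)) (+-identityˡ 0ℚ)

on-ones : ∀ a b → on a (ones b) ≡ a b
on-ones a zero    = refl
on-ones a (suc b) = on-ones (a ∘ suc) b

on-big : ∀ a l i b → on a (l ++ (1+ suc i) ∷ ones b) ≡ 0ℚ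
on-big a []               i b = refl
on-big a ((1+ zero) ∷ l)  i b = on-big (a ∘ suc) l i b
on-big a ((1+ suc _) ∷ l) i b = refl

-- Only the cut just before the last entry at least 2 contributes: a later cut leaves only ones for
-- `X n`, and an earlier one leaves an entry at least 2 for `E (suc n)` or a leading 1.
✶-X : ∀ f n l i b → (f ✶ X n) (l ++ (1+ suc i) ∷ ones b) ≡ f l * (pw n (1+ suc i) * h± (suc n) b)
✶-X f n []      i b = trans (cong₂ _+_ (cong (λ t → f [] * (pw n (1+ suc i) * t)) (on-ones (h± (suc n)) b))
  (✶-X-ones (f ∘ ((1+ suc i) ∷_)) n b)) (+-identityʳ _)
✶-X f n (k ∷ l) i b = trans (cong₂ _+_ (trans (cong (f [] *_) (vanish k)) (*-zeroʳ (f []))) (✶-X (f ∘ (k ∷_)) n l i b)) (+-identityˡ _)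
  where
  vanish : ∀ k → X n (k ∷ l ++ (1+ suc i) ∷ ones b) ≡ 0ℚ
  vanish (1+ zero)  = refl
  vanish (1+ suc j) = trans (cong (pw n (1+ suc j) *_) (on-big (h± (suc n)) l i b)) (*-zeroʳ (pw n (1+ suc j)))

s-only-ones : ∀ n b → s n (ones b) ≡ η (ones b)
s-only-ones zero    b = s-zero (ones b)
s-only-ones (suc n) b = trans (s-suc n (ones b)) (trans (cong₂ _+_ (s-only-ones n b) (✶-X-ones (P n) n b)) (+-identityʳ _))

s-then-ones : ∀ n l i b → s n (l ++ (1+ suc i) ∷ ones b) ≡ reg (c (zʷ l · z (1+ i))) b n
s-then-ones zero    l i b = trans (s-zero (l ++ (1+ suc i) ∷ ones b)) (trans (nonempty l)
  (sym (trans (cong (sg b *_) (*-zeroʳ (c (zʷ l · z (1+ i)) 0))) (*-zeroʳ (sg b)))))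
  where
  nonempty : ∀ l → η (l ++ (1+ suc i) ∷ ones b) ≡ 0ℚ
  nonempty []      = refl
  nonempty (_ ∷ _) = refl
s-then-ones (suc n) l i b = begin
  s (suc n) (l ++ (1+ suc i) ∷ ones b)
    ≡⟨ s-suc n (l ++ (1+ suc i) ∷ ones b) ⟩
  s n (l ++ (1+ suc i) ∷ ones b) + (P n ✶ X n) (l ++ (1+ suc i) ∷ ones b)
    ≡⟨ cong₂ _+_ (s-then-ones n l i b) (✶-X (P n) n l i b) ⟩
  sg b * S + ζ≤ l n * ((1/ suc n ^ suc (suc i)) * (sg b * h b (suc n)))
    ≡⟨ cong₂ (λ p q → sg b * S + p * (q * (sg b * h b (suc n)))) (ζ≤-c l n) (1/-suc n (suc i)) ⟩
  sg b * S + Σ≤ (c (zʷ l)) n * (r n * (1/ suc n ^ suc i) * (sg b * h b (suc n)))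
    ≡⟨ rearrange (sg b) S (Σ≤ (c (zʷ l)) n) (r n) (1/ suc n ^ suc i) (h b (suc n)) ⟩
  sg b * (S + Σ≤ (c (zʷ l)) n * (1/ suc n ^ suc i) * (h b (suc n) * r n))
    ≡⟨ cong (λ t → sg b * (S + t * (h b (suc n) * r n))) (c-z (zʷ l) (1+ i) n) ⟨
  reg (c (zʷ l · z (1+ i))) b (suc n) ∎
  where
  open ≡-Reasoning
  S = Σ≤ (λ m → c (zʷ l · z (1+ i)) m * h/ b m) n
  rearrange : ∀ g s a r p h → g * s + a * (r * p * (g * h)) ≡ g * (s + a * p * (h * r))
  rearrange = solve-∀ ℚ-ring

foldl-ones : ∀ w b → foldl (λ w k → w · z k) w (ones b) ≡ w ∙𝑦^ b
foldl-ones w zero    = refl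
foldl-ones w (suc b) = trans (foldl-ones (w ∙ 𝑦) b) (∙𝑦-∙𝑦^ w b)
  where
  ∙𝑦-∙𝑦^ : ∀ w b → (w ∙ 𝑦) ∙𝑦^ b ≡ w ∙𝑦^ suc b
  ∙𝑦-∙𝑦^ w zero    = refl
  ∙𝑦-∙𝑦^ w (suc b) = cong (_∙ 𝑦) (∙𝑦-∙𝑦^ w b)

zʷ-ones : ∀ b → zʷ (ones b) ≡ ε ∙𝑦^ b
zʷ-ones = foldl-ones ε

zʷ-then-ones : ∀ l i b → zʷ (l ++ (1+ suc i) ∷ ones b) ≡ (zʷ l · z (1+ i)) ∙ 𝑥 ∙𝑦^ b
zʷ-then-ones l i b = trans (foldl-++ (λ w k → w · z k) ε l ((1+ suc i) ∷ ones b)) (foldl-ones ((zʷ l · z (1+ i)) ∙ 𝑥) b)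

-- the coefficients of ∏_{i≤n} (1 - u²/i²)⁻¹
Y : ℕ → ℕ → ℚ
Y n = conv (λ j → h j n) (h± n)

-- The inner factors `R (P n) ✶ C (P n)` cancel. Of the outer ones, `R` removes the signs from `E n`
-- and `C` leaves it alone.
R-s-C-s : ∀ n k → (R (s n) ✶ C (s n)) k ≡ on (Y n) k
R-s-C-s n k = begin
  (R (s n) ✶ C (s n)) k
    ≡⟨ ✶-cong (λ l → trans (R-✶ (P n) (E n) l) (✶-cong {g = R (P n)} R-E (λ _ → refl) l))
              (λ l → trans (C-✶ (P n) (E n) l) (✶-cong {f = C (P n)} (λ _ → refl) (C-on (h± n)) l)) k ⟩
  ((H ✶ R (P n)) ✶ (C (P n) ✶ E n)) k
    ≡⟨ ✶-assoc H (R (P n)) (C (P n) ✶ E n) k ⟩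
  (H ✶ (R (P n) ✶ (C (P n) ✶ E n))) k
    ≡⟨ ✶-cong {f = H} (λ _ → refl) (λ l → trans (sym (✶-assoc (R (P n)) (C (P n)) (E n) l))
         (trans (✶-cong {g = E n} (R-P-C-P n) (λ _ → refl) l) (✶-identityˡ (E n) l))) k ⟩
  (H ✶ E n) k
    ≡⟨ on-✶ (λ j → h j n) (h± n) k ⟩
  on (Y n) k ∎
  where
  open ≡-Reasoning
  H = on (λ j → h j n)
  R-E : ∀ l → R (E n) l ≡ H l
  R-E l = trans (R-on (h± n) l) (on-cong (λ j → trans (sym (*-assoc (sg j) (sg j) (h j n))) (trans (cong (_* h j n) (sg² j)) (*-identityˡ (h j n)))) l)

module Limits {ψ} (char : ShuffleCharacter ψ) where
  open ShuffleCharacter char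
  open Regularization char
  open ≈ᴿ-Reasoning

  -- From y sh yᵇ = (b+1) y^{b+1} and ψ(y) = 0.
  ψ-𝑦^ : ∀ b → ψ (ε ∙𝑦^ suc b) ≈ᴿ 0ᴿ
  ψ-𝑦^ b = cancel (begin
    fromℚ (ι (suc b)) ⊗ ψ (ε ∙𝑦^ suc b)
      ≈⟨ sh-𝑦^ ψ b ⟨
    ⟨ ψ , (ε ∙ 𝑦) shʷ (ε ∙𝑦^ b) ⟩
      ≈⟨ ψ-sh (y· ε) (word¹ b) ⟨
    ψ (ε ∙ 𝑦) ⊗ ψ (ε ∙𝑦^ b)
      ≈⟨ ⊗-cong ψ-y ≈-refl ⟩
    0ᴿ ⊗ ψ (ε ∙𝑦^ b)
      ≈⟨ Real.zeroˡ _ ⟩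
    0ᴿ ∎)
    where
    word¹ : ∀ b → Word¹ (ε ∙𝑦^ b)
    word¹ b = subst Word¹ (zʷ-ones b) (Words.foldl-word¹ (ones b) one)

    sh-𝑦^ : ∀ (F : Word → ℝ) b → ⟨ F , (ε ∙ 𝑦) shʷ (ε ∙𝑦^ b) ⟩ ≈ᴿ fromℚ (ι (suc b)) ⊗ F (ε ∙𝑦^ suc b)
    sh-𝑦^ F zero    = Real.+-identityʳ _
    sh-𝑦^ F (suc b) = ≈-trans (⊕-cong (Real.*-identityˡ _) (≈-trans (Real.reflexive (⟨⟩-∙ F ((ε ∙ 𝑦) shʷ (ε ∙𝑦^ b)) 𝑦))
      (sh-𝑦^ (λ v → F (v ∙ 𝑦)) b))) (fromℚ-suc b _)

    cancel : fromℚ (ι (suc b)) ⊗ ψ (ε ∙𝑦^ suc b) ≈ᴿ 0ᴿ → ψ (ε ∙𝑦^ suc b) ≈ᴿ 0ᴿ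
    cancel eq = begin
      ψ (ε ∙𝑦^ suc b)                                                 ≈⟨ Real.*-identityˡ _ ⟨
      1ᴿ ⊗ ψ (ε ∙𝑦^ suc b)                                            ≈⟨ ⊗-cong (pointwise (λ n → trans (sym (L*r b)) (trans (*-comm (L b) (r b)) (sym (⊗-approx (fromℚ (r b)) (fromℚ (L b)) n))))) ≈-refl ⟩
      (fromℚ (r b) ⊗ fromℚ (L b)) ⊗ ψ (ε ∙𝑦^ suc b)                   ≈⟨ Real.*-assoc _ _ _ ⟩
      fromℚ (r b) ⊗ (fromℚ (L b) ⊗ ψ (ε ∙𝑦^ suc b))                   ≈⟨ ⊗-cong ≈-refl eq ⟩
      fromℚ (r b) ⊗ 0ᴿ                                                ≈⟨ Real.zeroʳ _ ⟩
      0ᴿ                                                              ∎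

  s⟶ψ : ∀ k → (λ n → s n k) ⟶ ψ (zʷ k)
  s⟶ψ k with trailing-ones k
  ... | only-ones zero    = ⟶-cong (λ n → sym (s-only-ones n 0)) (⟶-resp (⟶-const 1ℚ) (≈-sym ψ-ε))
  ... | only-ones (suc b) = ⟶-cong (λ n → sym (s-only-ones n (suc b)))
    (⟶-resp (⟶-const 0ℚ) (≈-sym (≈-trans (Real.reflexive (cong ψ (zʷ-ones (suc b)))) (ψ-𝑦^ b))))
  ... | then-ones l i b with Words.Word¹-· (Words.foldl-word¹ l one) (Words.z-startsY (1+ i))
  ...   | v , eq = ⟶-cong (λ n → sym (trans (s-then-ones n l i b) (cong (λ w → reg (c w) b n) eq)))
    (⟶-resp (reg-word b v) (Real.reflexive (cong ψ (sym (trans (zʷ-then-ones l i b) (cong (λ w → w ∙ 𝑥 ∙𝑦^ b) eq))))))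

-- The generating function ∏ (1 - u²/i²)⁻¹

-- multiplication of a generating function by 1 + q u
times : ℚ → (ℕ → ℚ) → ℕ → ℚ
times q a zero    = a 0
times q a (suc n) = a (suc n) + q * a n

times-cong : ∀ q {a b} → (∀ n → a n ≡ b n) → ∀ n → times q a n ≡ times q b n
times-cong q eq zero    = eq 0
times-cong q eq (suc n) = cong₂ (λ x y → x + q * y) (eq (suc n)) (eq n)

-- A power series with constant term 1 is not a zero divisor.
times-injective : ∀ q {a b} → (∀ n → times q a n ≡ times q b n) → ∀ n → a n ≡ b n
times-injective q eq zero    = eq 0
times-injective q {a} {b} eq (suc n) = cancel (a (suc n)) (b (suc n)) (q * a n)
  (trans (eq (suc n)) (cong (λ t → b (suc n) + q * t) (sym (times-injective q eq n))))
  where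
  cancel : ∀ x y z → x + z ≡ y + z → x ≡ y
  cancel x y z eq = trans (undo x z) (trans (cong (_- z) eq) (sym (undo y z)))
    where
    undo : ∀ x z → x ≡ x + z - z
    undo = solve-∀ ℚ-ring

times-shift : ∀ q a n → times q a n ≡ a n + q * shift a n
times-shift q a zero    = sym (trans (cong (a 0 +_) (*-zeroʳ q)) (+-identityʳ (a 0)))
times-shift q a (suc n) = refl

conv-shiftʳ : ∀ a b n → conv a (shift b) (suc n) ≡ conv a b n
conv-shiftʳ a b zero    = trans (cong (a 0 * b 0 +_) (*-zeroʳ (a 1))) (+-identityʳ _)
conv-shiftʳ a b (suc n) = cong (a 0 * b (suc n) +_) (conv-shiftʳ (a ∘ suc) b n)

conv-linearˡ : ∀ q a a′ b n → conv (λ i → a i + q * a′ i) b n ≡ conv a b n + q * conv a′ b n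
conv-linearˡ q a a′ b n = trans (diag-cong (λ i j → rearrange q (a i) (a′ i) (b j)) n)
  (trans (diag-+ (λ i j → a i * b j) (λ i j → q * (a′ i * b j)) n) (cong (conv a b n +_) (diag-weight (λ _ → q) (λ i j → a′ i * b j) n)))
  where
  rearrange : ∀ q x y z → (x + q * y) * z ≡ x * z + q * (y * z)
  rearrange = solve-∀ ℚ-ring

conv-linearʳ : ∀ q a b b′ n → conv a (λ i → b i + q * b′ i) n ≡ conv a b n + q * conv a b′ n
conv-linearʳ q a b b′ n = trans (diag-cong (λ i j → rearrange q (a i) (b j) (b′ j)) n)
  (trans (diag-+ (λ i j → a i * b j) (λ i j → q * (a i * b′ j)) n) (cong (conv a b n +_) (diag-weight (λ _ → q) (λ i j → a i * b′ j) n)))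
  where
  rearrange : ∀ q x y z → x * (y + q * z) ≡ x * y + q * (x * z)
  rearrange = solve-∀ ℚ-ring

times-conv : ∀ q a b n → times q (conv a b) n ≡ conv (times q a) b n
times-conv q a b zero    = refl
times-conv q a b (suc n) = sym (trans (conv-congˡ b (times-shift q a) (suc n)) (trans (conv-linearˡ q a (shift a) b (suc n))
  (cong (λ t → conv a b (suc n) + q * t) (conv-shift a b n))))

times-convʳ : ∀ q a b n → times q (conv a b) n ≡ conv a (times q b) n
times-convʳ q a b zero    = refl
times-convʳ q a b (suc n) = sym (trans (conv-congʳ a (times-shift q b) (suc n)) (trans (conv-linearʳ q a b (shift b) (suc n))
  (cong (λ t → conv a b (suc n) + q * t) (conv-shiftʳ a b n))))

Y-suc : ∀ n m → times (- r n) (times (r n) (Y (suc n))) m ≡ Y n m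
Y-suc n m = begin
  times (- r n) (times (r n) (Y (suc n))) m
    ≡⟨ times-cong (- r n) (times-convʳ (r n) (λ j → h j (suc n)) (h± (suc n))) m ⟩
  times (- r n) (conv (λ j → h j (suc n)) (times (r n) (h± (suc n)))) m
    ≡⟨ times-conv (- r n) (λ j → h j (suc n)) (times (r n) (h± (suc n))) m ⟩
  conv (times (- r n) (λ j → h j (suc n))) (times (r n) (h± (suc n))) m
    ≡⟨ trans (conv-congˡ (times (r n) (h± (suc n))) h-back m) (conv-congʳ (λ j → h j n) h±-back m) ⟩
  Y n m ∎
  where
  open ≡-Reasoning
  cancel : ∀ a b r → (a + b * r) + - r * b ≡ a
  cancel = solve-∀ ℚ-ring
  h-back : ∀ j → times (- r n) (λ j → h j (suc n)) j ≡ h j n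
  h-back zero    = refl
  h-back (suc j) = trans (cong (_+ - r n * h j (suc n)) (h-suc j n)) (cancel (h (suc j) n) (h j (suc n)) (r n))
  h±-back : ∀ j → times (r n) (h± (suc n)) j ≡ h± n j
  h±-back zero    = refl
  h±-back (suc j) = h±-suc n j

r² : ℕ → ℚ
r² n = r n * r n

-- y i n is the complete homogeneous symmetric polynomial of degree i in 1, 1/2², …, 1/n².
y : ℕ → ℕ → ℚ
y zero    n       = 1ℚ
y (suc i) zero    = 0ℚ
y (suc i) (suc n) = y (suc i) n + r² n * y i (suc n)

double : ℕ → ℕ
double zero    = zero
double (suc n) = suc (suc (double n))

Y-0 : ∀ n → Y n 0 ≡ 1ℚ
Y-0 n = refl

Y-1 : ∀ n → Y n 1 ≡ 0ℚ
Y-1 n = cancel (h 1 n)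
  where
  cancel : ∀ a → 1ℚ * (- 1ℚ * a) + a * (1ℚ * 1ℚ) ≡ 0ℚ
  cancel = solve-∀ ℚ-ring

-- From (1 - u/(n+1)) (1 + u/(n+1)) = 1 - u²/(n+1)²; the recursion preserves parity, hence `Y-even`
-- and `Y-odd`.
Y-2+ : ∀ n m → Y (suc n) (suc (suc m)) ≡ Y n (suc (suc m)) + r² n * Y (suc n) m
Y-2+ n m = trans (expand (Y (suc n) (suc (suc m))) (Y (suc n) (suc m)) (Y (suc n) m) (r n)) (cong (_+ r² n * Y (suc n) m) (Y-suc n (suc (suc m))))
  where
  expand : ∀ a b c r → a ≡ ((a + r * b) + - r * (b + r * c)) + (r * r) * c
  expand = solve-∀ ℚ-ring

Y-zero : ∀ m → Y 0 (suc m) ≡ 0ℚ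
Y-zero m = trans (cong₂ _+_ (trans (*-identityˡ (h± 0 (suc m))) (*-zeroʳ (sg (suc m))))
    (trans (diag-cong (λ i j → *-zeroˡ (h± 0 j)) m) (diag-0 m))) (+-identityˡ 0ℚ)

Y-even : ∀ n i → Y n (double i) ≡ y i n
Y-even n       zero    = Y-0 n
Y-even zero    (suc i) = Y-zero (suc (double i))
Y-even (suc n) (suc i) = trans (Y-2+ n (double i)) (cong₂ (λ a b → a + r² n * b) (Y-even n (suc i)) (Y-even (suc n) i))

Y-odd : ∀ n i → Y n (suc (double i)) ≡ 0ℚ
Y-odd n       zero    = Y-1 n
Y-odd zero    (suc i) = Y-zero (suc (suc (double i)))
Y-odd (suc n) (suc i) = trans (Y-2+ n (suc (double i))) (trans (cong₂ (λ a b → a + r² n * b) (Y-odd n (suc i)) (Y-odd (suc n) i))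
  (trans (+-identityˡ _) (*-zeroʳ (r² n))))

even : ℕ → ℕ⁺
even i = 1+ suc (double i)

-- p i n = ∑_{1≤m≤n} 1/m^{2i+2}
p : ℕ → ℕ → ℚ
p i = ζ≤ [ even i ]

r²^ : ℕ → ℕ → ℚ
r²^ n zero    = 1ℚ
r²^ n (suc i) = r² n * r²^ n i

1/-even : ∀ n i → 1/ suc n ^ double i ≡ r²^ n i
1/-even n zero    = refl
1/-even n (suc i) = trans (1/-suc n (suc (double i))) (trans (cong (r n *_) (1/-suc n (double i)))
  (trans (sym (*-assoc (r n) (r n) _)) (cong (r² n *_) (1/-even n i))))

p-suc : ∀ i n → p i (suc n) ≡ p i n + r²^ n (suc i)
p-suc i n = cong (p i n +_) (trans (*-identityˡ _) (1/-even n (suc i)))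

-- The logarithmic derivative of ∏ (1 - u/i²)⁻¹, one factor at a time: multiplication by 1 - t u
-- with t = 1/(n+1)² takes the series of `y′` to that for n and the geometric series `g` to the
-- constant t, and it is injective.
newton : ∀ n i → ι (suc i) * y (suc i) n ≡ conv (λ a → p a n) (λ b → y b n) i
newton zero    i = trans (*-zeroʳ (L i)) (sym (trans (diag-cong (λ a b → *-zeroˡ (y b 0)) i) (diag-0 i)))
newton (suc n) i = times-injective (- t) eq i
  where
  open ≡-Reasoning
  t = r² n
  y′ Dy′ g : ℕ → ℚ
  y′ i = y i (suc n)
  Dy′ i = ι (suc i) * y (suc i) (suc n)
  g a = r²^ n (suc a)

  y-back : ∀ i → times (- t) y′ i ≡ y i n
  y-back zero    = refl
  y-back (suc i) = cancel (y (suc i) n) t (y i (suc n))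
    where
    cancel : ∀ a t b → (a + t * b) + - t * b ≡ a
    cancel = solve-∀ ℚ-ring

  Dy-back : ∀ i → times (- t) Dy′ i ≡ ι (suc i) * y (suc i) n + t * y′ i
  Dy-back zero    = expand (y 1 n) t
    where
    expand : ∀ a t → 1ℚ * (a + t * 1ℚ) ≡ 1ℚ * a + t * 1ℚ
    expand = solve-∀ ℚ-ring
  Dy-back (suc i) = trans (cong (λ l → l * y′ (suc (suc i)) + - t * (ι (suc i) * y′ (suc i))) (ι-suc (suc i)))
    (trans (expand (ι (suc i)) (y (suc (suc i)) n) t (y′ (suc i))) (cong (λ l → l * y (suc (suc i)) n + t * y′ (suc i)) (sym (ι-suc (suc i)))))
    where
    expand : ∀ l a t b → (l + 1ℚ) * (a + t * b) + - t * (l * b) ≡ (l + 1ℚ) * a + t * b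
    expand = solve-∀ ℚ-ring

  geometric : ∀ a → times (- t) g a ≡ t * c ε a
  geometric zero    = refl
  geometric (suc a) = cancel t (g a)
    where
    cancel : ∀ t a → t * a + - t * a ≡ t * 0ℚ
    cancel = solve-∀ ℚ-ring

  conv-unit : ∀ b i → conv (λ a → t * c ε a) b i ≡ t * b i
  conv-unit b zero    = cong (_* b 0) (*-identityʳ t)
  conv-unit b (suc i) = trans (cong₂ _+_ (cong (_* b (suc i)) (*-identityʳ t))
    (trans (diag-cong (λ i j → trans (cong (_* b j) (*-zeroʳ t)) (*-zeroˡ (b j))) i) (diag-0 i))) (+-identityʳ _)

  eq : ∀ i → times (- t) Dy′ i ≡ times (- t) (conv (λ a → p a (suc n)) y′) i
  eq i = begin
    times (- t) Dy′ i
      ≡⟨ Dy-back i ⟩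
    ι (suc i) * y (suc i) n + t * y′ i
      ≡⟨ cong₂ _+_ (newton n i) (sym (trans (conv-congˡ y′ geometric i) (conv-unit y′ i))) ⟩
    conv (λ a → p a n) (λ b → y b n) i + conv (times (- t) g) y′ i
      ≡⟨ cong (conv (λ a → p a n) (λ b → y b n) i +_) (trans (sym (times-conv (- t) g y′ i)) (trans (times-convʳ (- t) g y′ i) (conv-congʳ g y-back i))) ⟩
    conv (λ a → p a n) (λ b → y b n) i + conv g (λ b → y b n) i
      ≡⟨ cong (conv (λ a → p a n) (λ b → y b n) i +_) (*-identityˡ _) ⟨
    conv (λ a → p a n) (λ b → y b n) i + 1ℚ * conv g (λ b → y b n) i
      ≡⟨ conv-linearˡ 1ℚ (λ a → p a n) g (λ b → y b n) i ⟨
    conv (λ a → p a n + 1ℚ * g a) (λ b → y b n) i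
      ≡⟨ conv-congˡ (λ b → y b n) (λ a → trans (p-suc a n) (cong (p a n +_) (sym (*-identityˡ (g a))))) i ⟨
    conv (λ a → p a (suc n)) (λ b → y b n) i
      ≡⟨ trans (times-convʳ (- t) (λ a → p a (suc n)) y′ i) (conv-congʳ (λ a → p a (suc n)) y-back i) ⟨
    times (- t) (conv (λ a → p a (suc n)) y′) i ∎

-- Williams' formula for ζ(2k)

diag-cong′ : ∀ {f g} n → (∀ i j → i ℕ.+ j ≡ n → f i j ≡ g i j) → diag f n ≡ diag g n
diag-cong′ zero    eq = eq 0 0 refl
diag-cong′ (suc n) eq = cong₂ _+_ (eq 0 (suc n) refl) (diag-cong′ n (λ i j e → eq (suc i) j (cong suc e)))

diag-last : ∀ f n → diag f (suc n) ≡ diag (λ i j → f i (suc j)) n + f (suc n) 0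
diag-last f zero    = refl
diag-last f (suc n) = trans (cong (f 0 (suc (suc n)) +_) (diag-last (f ∘ suc) n)) (sym (+-assoc (f 0 (suc (suc n))) _ _))

diag-comm : ∀ f n → diag f n ≡ diag (λ i j → f j i) n
diag-comm f zero    = refl
diag-comm f (suc n) = trans (diag-last f n) (trans (+-comm _ (f (suc n) 0)) (cong (f (suc n) 0 +_) (diag-comm (λ i j → f i (suc j)) n)))

diag-scale : ∀ q f n → diag (λ i j → q * f i j) n ≡ q * diag f n
diag-scale q f n = diag-weight (λ _ → q) f n

Σ≤-diag : ∀ a n → diag (λ i _ → a i) n ≡ Σ≤ a n
Σ≤-diag a zero    = refl
Σ≤-diag a (suc n) = trans (cong (a 0 +_) (Σ≤-diag (a ∘ suc) n)) (sym (Σ≤-front a n))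

2ℚ 3ℚ 4ℚ 5ℚ : ℚ
2ℚ = 1ℚ + 1ℚ
3ℚ = 2ℚ + 1ℚ
4ℚ = 2ℚ + 2ℚ
5ℚ = 4ℚ + 1ℚ

ι-double : ∀ n → ι (double n) ≡ ι n + ι n
ι-double zero    = refl
ι-double (suc n) = trans (ι-suc (suc (double n))) (trans (cong (_+ 1ℚ) (trans (ι-suc (double n)) (cong (_+ 1ℚ) (ι-double n))))
  (trans (rearrange (ι n)) (cong₂ _+_ (sym (ι-suc n)) (sym (ι-suc n)))))
  where
  rearrange : ∀ a → ((a + a) + 1ℚ) + 1ℚ ≡ (a + 1ℚ) + (a + 1ℚ)
  rearrange = solve-∀ ℚ-ring

-- For 1-based a = i + 1, b = i + m + 2: the index of b + a
opp : ℕ → ℕ → ℕ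
opp i m = m ℕ.+ double (suc i)

-- 1/(b² - a²)
κ : ℕ → ℕ → ℚ
κ i m = r m * r (opp i m)

L-opp : ∀ i m → L (opp i m) ≡ L m + 2ℚ * L i
L-opp i m = trans (ι-suc (opp i m)) (trans (cong (_+ 1ℚ) (trans (ι-+ m (double (suc i))) (cong (ι m +_) (ι-double (suc i)))))
  (trans (rearrange (ι m) (L i)) (cong (_+ 2ℚ * L i) (sym (ι-suc m)))))
  where
  rearrange : ∀ a b → (a + (b + b)) + 1ℚ ≡ (a + 1ℚ) + (1ℚ + 1ℚ) * b
  rearrange = solve-∀ ℚ-ring

L-top : ∀ i m → L (suc (i ℕ.+ m)) ≡ L i + L m
L-top i m = trans (cong ι (sym (cong suc (ℕ.+-suc i m)))) (ι-+ (suc i) (suc m))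

-- identities between reciprocals are proved after multiplying out by L
κ-fraction : ∀ i m n → i ℕ.+ m ≡ n → κ i m * (r² i - r² (suc n)) ≡ r² i * r² (suc n)
κ-fraction i m n refl = begin
  rm * ro * (a * a - b * b)
    ≡⟨ cong₂ (λ s t → rm * ro * (s - t)) (pad a b (L (suc n)) (L*r (suc n))) (trans (pad b a (L i) (L*r i)) (cong₂ _*_ (*-comm b b) refl)) ⟩
  rm * ro * ((a * a) * (b * L (suc n) * (b * L (suc n))) - (b * b) * (a * L i * (a * L i)))
    ≡⟨ cong (λ t → rm * ro * ((a * a) * (b * t * (b * t)) - (b * b) * (a * L i * (a * L i)))) (L-top i m) ⟩
  rm * ro * ((a * a) * (b * (L i + L m) * (b * (L i + L m))) - (b * b) * (a * L i * (a * L i)))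
    ≡⟨ factor rm ro a b (L i) (L m) ⟩
  a * a * (b * b) * ((L m * rm) * ((L m + 2ℚ * L i) * ro))
    ≡⟨ cong (λ t → a * a * (b * b) * ((L m * rm) * (t * ro))) (L-opp i m) ⟨
  a * a * (b * b) * ((L m * rm) * (L (opp i m) * ro))
    ≡⟨ cong₂ (λ s t → a * a * (b * b) * (s * t)) (L*r m) (L*r (opp i m)) ⟩
  a * a * (b * b) * (1ℚ * 1ℚ)
    ≡⟨ *-identityʳ _ ⟩
  a * a * (b * b) ∎
  where
  open ≡-Reasoning
  a = r i
  b = r (suc n)
  rm = r m
  ro = r (opp i m)
  pad : ∀ x y l → l * y ≡ 1ℚ → x * x ≡ (x * x) * (y * l * (y * l))
  pad x y l eq = sym (trans (cong (λ t → x * x * (t * t)) (trans (*-comm y l) eq)) (*-identityʳ (x * x)))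
  factor : ∀ rm ro a b i m → rm * ro * ((a * a) * (b * (i + m) * (b * (i + m))) - (b * b) * (a * i * (a * i)))
                           ≡ a * a * (b * b) * ((m * rm) * ((m + (1ℚ + 1ℚ) * i) * ro))
  factor = solve-∀ ℚ-ring

-- Because (b + a) + (b - a) = 2b, with b = n + 2.
κ-split : ∀ i m n → i ℕ.+ m ≡ n → 2ℚ * κ i m ≡ r (suc n) * (r m + r (opp i m))
κ-split i m n refl = begin
  2ℚ * (rm * ro)
    ≡⟨ *-identityʳ _ ⟨
  2ℚ * (rm * ro) * 1ℚ
    ≡⟨ cong (2ℚ * (rm * ro) *_) (L*r (suc n)) ⟨
  2ℚ * (rm * ro) * (L (suc n) * r (suc n))
    ≡⟨ cong (λ t → 2ℚ * (rm * ro) * (t * r (suc n))) (L-top i m) ⟩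
  2ℚ * (rm * ro) * ((L i + L m) * r (suc n))
    ≡⟨ factor rm ro (r (suc n)) (L i) (L m) ⟩
  r (suc n) * (rm * ((L m + 2ℚ * L i) * ro) + ro * (L m * rm))
    ≡⟨ cong (λ t → r (suc n) * (rm * (t * ro) + ro * (L m * rm))) (L-opp i m) ⟨
  r (suc n) * (rm * (L (opp i m) * ro) + ro * (L m * rm))
    ≡⟨ cong₂ (λ s t → r (suc n) * (rm * s + ro * t)) (L*r (opp i m)) (L*r m) ⟩
  r (suc n) * (rm * 1ℚ + ro * 1ℚ)
    ≡⟨ cong₂ (λ s t → r (suc n) * (s + t)) (*-identityʳ rm) (*-identityʳ ro) ⟩
  r (suc n) * (rm + ro) ∎
  where
  open ≡-Reasoning
  rm = r m
  ro = r (opp i m)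
  factor : ∀ rm ro t i m → (1ℚ + 1ℚ) * (rm * ro) * ((i + m) * t) ≡ t * (rm * ((m + (1ℚ + 1ℚ) * i) * ro) + ro * (m * rm))
  factor = solve-∀ ℚ-ring

-- Because (b + a) - (b - a) = 2a.
κ-difference : ∀ i m → r i * (r m - r (opp i m)) ≡ 2ℚ * κ i m
κ-difference i m = begin
  a * (rm - ro)
    ≡⟨ cong₂ (λ s t → a * (s - t)) (sym (trans (cong (rm *_) (L*r (opp i m))) (*-identityʳ rm))) (sym (trans (cong (ro *_) (L*r m)) (*-identityʳ ro))) ⟩
  a * (rm * (L (opp i m) * ro) - ro * (L m * rm))
    ≡⟨ cong (λ t → a * (rm * (t * ro) - ro * (L m * rm))) (L-opp i m) ⟩
  a * (rm * ((L m + 2ℚ * L i) * ro) - ro * (L m * rm))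
    ≡⟨ factor a rm ro (L m) (L i) ⟩
  2ℚ * (rm * ro) * (L i * a)
    ≡⟨ cong (2ℚ * (rm * ro) *_) (L*r i) ⟩
  2ℚ * (rm * ro) * 1ℚ
    ≡⟨ *-identityʳ _ ⟩
  2ℚ * κ i m ∎
  where
  open ≡-Reasoning
  a = r i
  rm = r m
  ro = r (opp i m)
  factor : ∀ a rm ro m i → a * (rm * ((m + (1ℚ + 1ℚ) * i) * ro) - ro * (m * rm)) ≡ (1ℚ + 1ℚ) * (rm * ro) * (i * a)
  factor = solve-∀ ℚ-ring

H : ℕ → ℚ
H = h 1

H-suc : ∀ n → H (suc n) ≡ H n + r n
H-suc n = trans (h-suc 0 n) (cong (H n +_) (*-identityˡ (r n)))

Σ≤-r : ∀ n m → Σ≤ (λ i → r (n ℕ.+ i)) m ≡ H (n ℕ.+ suc m) - H n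
Σ≤-r n zero    = trans (cong r (ℕ.+-identityʳ n)) (trans (cancel (r n) (H n)) (cong (_- H n) (trans (sym (H-suc n)) (cong H (sym (ℕ.+-comm n 1))))))
  where
  cancel : ∀ a b → a ≡ (b + a) - b
  cancel = solve-∀ ℚ-ring
Σ≤-r n (suc m) = trans (cong (_+ r (n ℕ.+ suc m)) (Σ≤-r n m)) (trans (rearrange (H (n ℕ.+ suc m)) (H n) (r (n ℕ.+ suc m)))
  (cong (_- H n) (trans (sym (H-suc (n ℕ.+ suc m))) (cong H (sym (ℕ.+-suc n (suc m)))))))
  where
  rearrange : ∀ a b c → (a - b) + c ≡ (a + c) - b
  rearrange = solve-∀ ℚ-ring

-- ∑ over 0 ≤ i < n, in terms of i and n - 1 - i
below-diag : (ℕ → ℕ → ℚ) → ℕ → ℚ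
below-diag f zero    = 0ℚ
below-diag f (suc n) = diag f n

double-+ : ∀ n → double n ≡ n ℕ.+ n
double-+ zero    = refl
double-+ (suc n) = cong suc (trans (cong suc (double-+ n)) (sym (ℕ.+-suc n n)))

r-double : ∀ n → 2ℚ * r (suc (double n)) ≡ r n
r-double n = begin
  2ℚ * ρ                         ≡⟨ *-identityʳ _ ⟨
  2ℚ * ρ * 1ℚ                    ≡⟨ cong (2ℚ * ρ *_) (L*r n) ⟨
  2ℚ * ρ * (L n * r n)           ≡⟨ factor ρ (L n) (r n) ⟩
  r n * ((L n + L n) * ρ)        ≡⟨ cong (λ t → r n * (t * ρ)) (ι-double (suc n)) ⟨
  r n * (L (suc (double n)) * ρ) ≡⟨ cong (r n *_) (L*r (suc (double n))) ⟩
  r n * 1ℚ                       ≡⟨ *-identityʳ (r n) ⟩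
  r n                            ∎
  where
  open ≡-Reasoning
  ρ = r (suc (double n))
  factor : ∀ p l r → (1ℚ + 1ℚ) * p * (l * r) ≡ r * ((l + l) * p)
  factor = solve-∀ ℚ-ring

-- For b = n + 1, summing `κ-split` over 0 < a < b gives H_{b-1} + H_{2b-1} - H_b = H_{2b} - 3/(2b),
-- which is the origin of the 3.
κ-sum : ∀ n → 4ℚ * below-diag κ n ≡ 2ℚ * (r n * H (double (suc n))) - 3ℚ * r² n
κ-sum zero    = refl
κ-sum (suc n) = begin
  4ℚ * diag κ n
    ≡⟨ regroup (diag κ n) ⟩
  2ℚ * (2ℚ * diag κ n)
    ≡⟨ cong (2ℚ *_) (trans (sym (diag-scale 2ℚ κ n)) (trans (diag-cong′ n (λ i m → κ-split i m n)) (trans (diag-scale ρ (λ i m → r m + r (opp i m)) n)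
         (cong (ρ *_) (diag-+ (λ i m → r m) (λ i m → r (opp i m)) n))))) ⟩
  2ℚ * (ρ * (diag (λ i m → r m) n + diag (λ i m → r (opp i m)) n))
    ≡⟨ cong₂ (λ s t → 2ℚ * (ρ * (s + t)))
         (trans (diag-comm (λ i m → r m) n) (trans (Σ≤-diag r n) (Σ≤-r 0 n)))
         (trans (diag-cong′ n (λ i m eq → cong r (opp-index i m eq))) (trans (Σ≤-diag (λ i → r (suc (suc n) ℕ.+ i)) n) (Σ≤-r (suc (suc n)) n))) ⟩
  2ℚ * (ρ * ((H (suc n) - 0ℚ) + (H N - H (suc (suc n)))))
    ≡⟨ cong (λ t → 2ℚ * (ρ * ((H (suc n) - 0ℚ) + (H N - t)))) (H-suc (suc n)) ⟩
  2ℚ * (ρ * ((H (suc n) - 0ℚ) + (H N - (H (suc n) + ρ))))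
    ≡⟨ cancel ρ (H (suc n)) (H N) ⟩
  2ℚ * (ρ * H N) + ρ * ρ - 3ℚ * r² (suc n)
    ≡⟨ cong (λ t → 2ℚ * (ρ * H N) + ρ * t - 3ℚ * r² (suc n)) (r-double (suc n)) ⟨
  2ℚ * (ρ * H N) + ρ * (2ℚ * r (suc (double (suc n)))) - 3ℚ * r² (suc n)
    ≡⟨ collect ρ (H N) (r (suc (double (suc n)))) (3ℚ * r² (suc n)) ⟩
  2ℚ * (ρ * (H N + r (suc (double (suc n))))) - 3ℚ * r² (suc n)
    ≡⟨ cong (λ t → 2ℚ * (ρ * t) - 3ℚ * r² (suc n)) (trans (cong (λ x → H x + r (suc (double (suc n)))) N≡) (sym (H-suc (suc (double (suc n)))))) ⟩
  2ℚ * (ρ * H (double (suc (suc n)))) - 3ℚ * r² (suc n) ∎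
  where
  open ≡-Reasoning
  ρ = r (suc n)
  N = suc (suc n) ℕ.+ suc n
  N≡ : N ≡ suc (double (suc n))
  N≡ = cong suc (sym (double-+ (suc n)))
  opp-index : ∀ i m → i ℕ.+ m ≡ n → opp i m ≡ suc (suc n) ℕ.+ i
  opp-index i m refl = trans (cong (λ d → m ℕ.+ suc (suc d)) (double-+ i)) (rearrange i m)
    where
    rearrange : ∀ i m → m ℕ.+ suc (suc (i ℕ.+ i)) ≡ suc (suc (i ℕ.+ m)) ℕ.+ i
    rearrange = ℕ-Solver.solve-∀
  regroup : ∀ d → (1ℚ + 1ℚ + (1ℚ + 1ℚ)) * d ≡ (1ℚ + 1ℚ) * ((1ℚ + 1ℚ) * d)
  regroup = solve-∀ ℚ-ring
  cancel : ∀ r h x → (1ℚ + 1ℚ) * (r * ((h - 0ℚ) + (x - (h + r)))) ≡ (1ℚ + 1ℚ) * (r * x) + r * r - (1ℚ + 1ℚ + 1ℚ) * (r * r)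
  cancel = solve-∀ ℚ-ring
  collect : ∀ r h x t → (1ℚ + 1ℚ) * (r * h) + r * ((1ℚ + 1ℚ) * x) - t ≡ (1ℚ + 1ℚ) * (r * (h + x)) - t
  collect = solve-∀ ℚ-ring

-- ∑_{i+j=k} p_i(n) x^{j+1} for x = 1/(n+1)²
cross : ℕ → ℕ → ℚ
cross n k = conv (λ i → p i n) (λ j → r²^ n (suc j)) k

r²^-suc-+ : ∀ n i j → r²^ n i * r²^ n (suc j) ≡ r²^ n (suc (i ℕ.+ j))
r²^-suc-+ n zero    j = *-identityˡ _
r²^-suc-+ n (suc i) j = trans (*-assoc (r² n) (r²^ n i) _) (cong (r² n *_) (r²^-suc-+ n i j))

p-Σ : ∀ i n → p i (suc n) ≡ Σ≤ (λ a → r²^ a (suc i)) n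
p-Σ i zero    = trans (p-suc i 0) (+-identityˡ _)
p-Σ i (suc n) = trans (p-suc i (suc n)) (cong (_+ r²^ (suc n) (suc i)) (p-Σ i n))

cross-suc : ∀ n k → cross n (suc k) ≡ r² n * cross n k + p (suc k) n * r² n
cross-suc n k = trans (diag-last (λ i j → p i n * r²^ n (suc j)) k) (cong₂ _+_
  (trans (diag-cong (λ i j → swap (p i n) (r² n) (r²^ n (suc j))) k) (diag-scale (r² n) (λ i j → p i n * r²^ n (suc j)) k))
  (cong (p (suc k) n *_) (*-identityʳ (r² n))))
  where
  swap : ∀ a x b → a * (x * b) ≡ x * (a * b)
  swap = solve-∀ ℚ-ring

-- the geometric sum ∑_{i+j=k} t^{i+1} x^{j+1} = (t^{k+1} - x^{k+1}) tx/(t-x)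
cross-κ : ∀ n k → cross n k ≡ below-diag (λ i m → κ i m * (r²^ i (suc k) - r²^ n (suc k))) n
cross-κ zero    k = trans (diag-cong (λ i j → *-zeroˡ (r²^ 0 (suc j))) k) (diag-0 k)
cross-κ (suc n) zero = begin
  p 0 (suc n) * (x * 1ℚ)
    ≡⟨ cong₂ _*_ (p-Σ 0 n) (*-identityʳ x) ⟩
  Σ≤ (λ a → r²^ a 1) n * x
    ≡⟨ *-comm (Σ≤ (λ a → r²^ a 1) n) x ⟩
  x * Σ≤ (λ a → r²^ a 1) n
    ≡⟨ trans (cong (x *_) (sym (Σ≤-diag (λ a → r²^ a 1) n))) (sym (diag-scale x (λ a _ → r²^ a 1) n)) ⟩
  diag (λ i m → x * r²^ i 1) n
    ≡⟨ diag-cong′ n (λ i m eq → trans (unit x (r² i)) (trans (sym (κ-fraction i m n eq)) (cong₂ (λ a b → κ i m * (a - b)) (sym (*-identityʳ (r² i))) (sym (*-identityʳ x))))) ⟩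
  diag (λ i m → κ i m * (r²^ i 1 - r²^ (suc n) 1)) n ∎
  where
  open ≡-Reasoning
  x = r² (suc n)
  unit : ∀ x t → x * (t * 1ℚ) ≡ t * x
  unit = solve-∀ ℚ-ring
cross-κ (suc n) (suc k) = begin
  cross (suc n) (suc k)
    ≡⟨ cross-suc (suc n) k ⟩
  x * cross (suc n) k + p (suc k) (suc n) * x
    ≡⟨ cong₂ (λ a b → x * a + b) (cross-κ (suc n) k) (trans (*-comm (p (suc k) (suc n)) x) (trans (cong (x *_) (trans (p-Σ (suc k) n) (sym (Σ≤-diag (λ a → r²^ a (suc (suc k))) n))))
         (sym (diag-scale x (λ a _ → r²^ a (suc (suc k))) n)))) ⟩
  x * diag (λ i m → κ i m * (r²^ i (suc k) - r²^ (suc n) (suc k))) n + diag (λ i m → x * r²^ i (suc (suc k))) n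
    ≡⟨ trans (cong (_+ diag (λ i m → x * r²^ i (suc (suc k))) n) (sym (diag-scale x (λ i m → κ i m * (r²^ i (suc k) - r²^ (suc n) (suc k))) n)))
         (sym (diag-+ (λ i m → x * (κ i m * (r²^ i (suc k) - r²^ (suc n) (suc k)))) (λ i m → x * r²^ i (suc (suc k))) n)) ⟩
  diag (λ i m → x * (κ i m * (r²^ i (suc k) - r²^ (suc n) (suc k))) + x * r²^ i (suc (suc k))) n
    ≡⟨ diag-cong′ n (λ i m eq → advance (κ i m) x (r² i) (r²^ i (suc k)) (r²^ (suc n) (suc k)) (κ-fraction i m n eq)) ⟩
  diag (λ i m → κ i m * (r²^ i (suc (suc k)) - r²^ (suc n) (suc (suc k)))) n ∎
  where
  open ≡-Reasoning
  x = r² (suc n)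
  advance : ∀ κ x t T X → κ * (t - x) ≡ t * x → x * (κ * (T - X)) + x * (t * T) ≡ κ * (t * T - x * X)
  advance κ x t T X eq = trans (e₁ κ x t T X) (trans (cong (λ q → x * (κ * (T - X)) + T * q) (sym eq)) (e₂ κ x t T X))
    where
    e₁ : ∀ κ x t T X → x * (κ * (T - X)) + x * (t * T) ≡ x * (κ * (T - X)) + T * (t * x)
    e₁ = solve-∀ ℚ-ring
    e₂ : ∀ κ x t T X → x * (κ * (T - X)) + T * (κ * (t - x)) ≡ κ * (t * T - x * X)
    e₂ = solve-∀ ℚ-ring

-- Williams' formula (2k+5) ζ(2k+4) = 2 ∑_{i+j=k} ζ(2i+2) ζ(2j+2) with the error made
-- by truncating all sums at n

-- For a = i + 1 and n = i + m + 1 this is (H_{n+a} - H_{n-a})/a, the closed form of the tail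
-- ∑_{b>n} 2/(b² - a²).
gap : ℕ → ℕ → ℚ
gap i m = r i * (H (opp i m) - H m)

error : ℕ → ℕ → ℚ
error k = below-diag (λ i m → r²^ i (suc k) * gap i m)

-- Raising the truncation from n to n + 1 removes the term b = n + 1 from the tail.
gap-suc : ∀ i m → gap i (suc m) ≡ gap i m + - (2ℚ * κ i m)
gap-suc i m = trans (cong₂ (λ s t → r i * (s - t)) (H-suc (opp i m)) (H-suc m)) (trans (rearrange (r i) (H (opp i m)) (r (opp i m)) (H m) (r m))
  (cong (λ t → gap i m + - t) (κ-difference i m)))
  where
  rearrange : ∀ a h o g m → a * ((h + o) - (g + m)) ≡ a * (h - g) + - (a * (m - o))
  rearrange = solve-∀ ℚ-ring

error-suc : ∀ k n → error k (suc n) ≡ error k n + (r²^ n (suc k) * (r n * H (double (suc n))) - 2ℚ * below-diag (λ i m → r²^ i (suc k) * κ i m) n)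
error-suc k zero    = trim (r²^ 0 (suc k)) (r 0) (H 2)
  where
  trim : ∀ a b h → a * (b * (h - 0ℚ)) ≡ 0ℚ + (a * (b * h) - (1ℚ + 1ℚ) * 0ℚ)
  trim = solve-∀ ℚ-ring
error-suc k (suc n) = begin
  diag f (suc n)
    ≡⟨ diag-last f n ⟩
  diag (λ i m → f i (suc m)) n + f (suc n) 0
    ≡⟨ cong (_+ f (suc n) 0) (trans (diag-cong (λ i m → trans (cong (r²^ i (suc k) *_) (gap-suc i m)) (distribute (r²^ i (suc k)) (gap i m) (κ i m))) n)
         (trans (diag-+ f (λ i m → - 2ℚ * (r²^ i (suc k) * κ i m)) n) (cong (diag f n +_) (diag-scale (- 2ℚ) (λ i m → r²^ i (suc k) * κ i m) n)))) ⟩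
  diag f n + - 2ℚ * Kt + f (suc n) 0
    ≡⟨ collect (diag f n) Kt (r²^ (suc n) (suc k)) (r (suc n)) (H (double (suc (suc n)))) ⟩
  diag f n + (r²^ (suc n) (suc k) * (r (suc n) * H (double (suc (suc n)))) - 2ℚ * Kt) ∎
  where
  open ≡-Reasoning
  f : ℕ → ℕ → ℚ
  f i m = r²^ i (suc k) * gap i m
  Kt = diag (λ i m → r²^ i (suc k) * κ i m) n
  distribute : ∀ a g κ → a * (g + - ((1ℚ + 1ℚ) * κ)) ≡ a * g + - (1ℚ + 1ℚ) * (a * κ)
  distribute = solve-∀ ℚ-ring
  collect : ∀ d Kt a b h → d + - (1ℚ + 1ℚ) * Kt + a * (b * (h - 0ℚ)) ≡ d + (a * (b * h) - (1ℚ + 1ℚ) * Kt)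
  collect = solve-∀ ℚ-ring

-- Induction on n. The product grows by two cross terms, which `cross-κ` turns into sums of `κ`, and
-- by k + 1 equal squares. The weighted sums of `κ` cancel against the growth of the error, and so
-- does the H_{2n+2} of `κ-sum`; the squares and the 3 of `κ-sum` leave 2(k+1) + 3 = 2k + 5.
williams : ∀ k n → 2ℚ * conv (λ i → p i n) (λ j → p j n) k + 2ℚ * error k n ≡ (2ℚ * ι k + 5ℚ) * p (suc k) n
williams k zero    = trans (cong (λ t → 2ℚ * t + 2ℚ * 0ℚ) (trans (diag-cong (λ i j → *-zeroˡ (p j 0)) k) (diag-0 k))) (zeros (2ℚ * ι k + 5ℚ))
  where
  zeros : ∀ a → (1ℚ + 1ℚ) * 0ℚ + (1ℚ + 1ℚ) * 0ℚ ≡ a * 0ℚ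
  zeros = solve-∀ ℚ-ring
williams k (suc n) = begin
  2ℚ * conv p′ p′ k + 2ℚ * error k (suc n)
    ≡⟨ cong₂ (λ a b → 2ℚ * a + 2ℚ * b) square (error-suc k n) ⟩
  2ℚ * (Q + cross n k + cross n k + (ι k + 1ℚ) * (x * xᵏ)) + 2ℚ * (error k n + (xᵏ * (r n * H₂) - 2ℚ * Kt))
    ≡⟨ cong (λ t → 2ℚ * (Q + t + t + (ι k + 1ℚ) * (x * xᵏ)) + 2ℚ * (error k n + (xᵏ * (r n * H₂) - 2ℚ * Kt))) (trans (cross-κ n k) (separate n)) ⟩
  2ℚ * (Q + (Kt - xᵏ * K₁) + (Kt - xᵏ * K₁) + (ι k + 1ℚ) * (x * xᵏ)) + 2ℚ * (error k n + (xᵏ * (r n * H₂) - 2ℚ * Kt))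
    ≡⟨ e₁ Q (error k n) Kt K₁ xᵏ x (ι k) (r n * H₂) ⟩
  (2ℚ * Q + 2ℚ * error k n) + (2ℚ * (ι k + 1ℚ) * (x * xᵏ) + 2ℚ * (xᵏ * (r n * H₂)) - xᵏ * (4ℚ * K₁))
    ≡⟨ cong₂ (λ a b → a + (2ℚ * (ι k + 1ℚ) * (x * xᵏ) + 2ℚ * (xᵏ * (r n * H₂)) - xᵏ * b)) (williams k n) (κ-sum n) ⟩
  (2ℚ * ι k + 5ℚ) * p (suc k) n + (2ℚ * (ι k + 1ℚ) * (x * xᵏ) + 2ℚ * (xᵏ * (r n * H₂)) - xᵏ * (2ℚ * (r n * H₂) - 3ℚ * x))
    ≡⟨ e₂ (p (suc k) n) xᵏ x (ι k) (r n * H₂) ⟩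
  (2ℚ * ι k + 5ℚ) * (p (suc k) n + x * xᵏ)
    ≡⟨ cong ((2ℚ * ι k + 5ℚ) *_) (p-suc (suc k) n) ⟨
  (2ℚ * ι k + 5ℚ) * p (suc k) (suc n) ∎
  where
  open ≡-Reasoning
  x = r² n
  xᵏ = r²^ n (suc k)
  H₂ = H (double (suc n))
  Q = conv (λ i → p i n) (λ j → p j n) k
  Kt = below-diag (λ i m → r²^ i (suc k) * κ i m) n
  K₁ = below-diag κ n
  p′ g : ℕ → ℚ
  p′ i = p i (suc n)
  g i = r²^ n (suc i)

  separate : ∀ n → below-diag (λ i m → κ i m * (r²^ i (suc k) - xᵏ)) n ≡ below-diag (λ i m → r²^ i (suc k) * κ i m) n - xᵏ * below-diag κ n
  separate zero    = zeros xᵏ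
    where
    zeros : ∀ a → 0ℚ ≡ 0ℚ - a * 0ℚ
    zeros = solve-∀ ℚ-ring
  separate (suc n) = trans (diag-cong (λ i m → expand (κ i m) (r²^ i (suc k)) xᵏ) n) (trans (diag-+ (λ i m → r²^ i (suc k) * κ i m) (λ i m → - xᵏ * κ i m) n)
    (trans (cong (diag (λ i m → r²^ i (suc k) * κ i m) n +_) (diag-scale (- xᵏ) κ n)) (neg-out (diag (λ i m → r²^ i (suc k) * κ i m) n) xᵏ (diag κ n))))
    where
    expand : ∀ κ a x → κ * (a - x) ≡ a * κ + - x * κ
    expand = solve-∀ ℚ-ring
    neg-out : ∀ a x κ → a + - x * κ ≡ a - x * κ
    neg-out = solve-∀ ℚ-ring

  squares : ∀ k → conv g g k ≡ (ι k + 1ℚ) * (x * r²^ n (suc k))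
  squares k = trans (diag-cong′ k (λ i j eq → trans (*-assoc x (r²^ n i) _) (cong (x *_) (trans (r²^-suc-+ n i j) (cong (λ t → r²^ n (suc t)) eq)))))
    (trans (diag-count (x * r²^ n (suc k)) k) (cong (_* (x * r²^ n (suc k))) (ι-suc k)))
    where
    diag-count : ∀ q k → diag (λ _ _ → q) k ≡ L k * q
    diag-count q zero    = sym (*-identityˡ q)
    diag-count q (suc k) = trans (cong (q +_) (diag-count q k)) (trans (add (L k) q) (cong (_* q) (sym (ι-suc (suc k)))))
      where
      add : ∀ l q → q + l * q ≡ (l + 1ℚ) * q
      add = solve-∀ ℚ-ring

  square : conv p′ p′ k ≡ Q + cross n k + cross n k + (ι k + 1ℚ) * (x * xᵏ)
  square = begin
    conv p′ p′ k
      ≡⟨ diag-cong (λ i j → trans (cong₂ _*_ (p-suc i n) (p-suc j n)) (expand (p i n) (g i) (p j n) (g j))) k ⟩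
    diag (λ i j → (p i n * p j n + p i n * g j) + (p j n * g i + g i * g j)) k
      ≡⟨ trans (diag-+ (λ i j → p i n * p j n + p i n * g j) (λ i j → p j n * g i + g i * g j) k)
           (cong₂ _+_ (diag-+ (λ i j → p i n * p j n) (λ i j → p i n * g j) k) (diag-+ (λ i j → p j n * g i) (λ i j → g i * g j) k)) ⟩
    (Q + cross n k) + (diag (λ i j → p j n * g i) k + conv g g k)
      ≡⟨ cong₂ (λ a b → (Q + cross n k) + (a + b)) (diag-comm (λ i j → p j n * g i) k) (squares k) ⟩
    (Q + cross n k) + (cross n k + (ι k + 1ℚ) * (x * xᵏ))
      ≡⟨ +-assoc (Q + cross n k) (cross n k) _ ⟨
    Q + cross n k + cross n k + (ι k + 1ℚ) * (x * xᵏ) ∎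
    where
    expand : ∀ a b c d → (a + b) * (c + d) ≡ (a * c + a * d) + (c * b + b * d)
    expand = solve-∀ ℚ-ring

  e₁ : ∀ Q E Kt K₁ X x i h →
       (1ℚ + 1ℚ) * (Q + (Kt - X * K₁) + (Kt - X * K₁) + (i + 1ℚ) * (x * X)) + (1ℚ + 1ℚ) * (E + (X * h - (1ℚ + 1ℚ) * Kt))
       ≡ ((1ℚ + 1ℚ) * Q + (1ℚ + 1ℚ) * E) + ((1ℚ + 1ℚ) * (i + 1ℚ) * (x * X) + (1ℚ + 1ℚ) * (X * h) - X * ((1ℚ + 1ℚ + (1ℚ + 1ℚ)) * K₁))
  e₁ = solve-∀ ℚ-ring
  e₂ : ∀ p X x i h →
       ((1ℚ + 1ℚ) * i + (1ℚ + 1ℚ + (1ℚ + 1ℚ) + 1ℚ)) * p + ((1ℚ + 1ℚ) * (i + 1ℚ) * (x * X) + (1ℚ + 1ℚ) * (X * h) - X * ((1ℚ + 1ℚ) * h - (1ℚ + 1ℚ + 1ℚ) * x))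
       ≡ ((1ℚ + 1ℚ) * i + (1ℚ + 1ℚ + (1ℚ + 1ℚ) + 1ℚ)) * (p + x * X)
  e₂ = solve-∀ ℚ-ring

-- The truncation error tends to 0

r≤1 : ∀ n → r n ≤ 1ℚ
r≤1 n = PartialSums./-mono 1 (suc n) (s≤s z≤n)

r²≥0 : ∀ n → 0ℚ ≤ r² n
r²≥0 n = 0≤-* (r≥0 n) (r≥0 n)

r²^≥0 : ∀ n k → 0ℚ ≤ r²^ n k
r²^≥0 n zero    = 0≤1
r²^≥0 n (suc k) = 0≤-* (r²≥0 n) (r²^≥0 n k)

r²≤r : ∀ n → r² n ≤ r n
r²≤r n = subst (r² n ≤_) (*-identityʳ (r n)) (Cauchy.*-monoˡ (r n) (r≥0 n) (r≤1 n))

r²^≤1 : ∀ n k → r²^ n k ≤ 1ℚ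
r²^≤1 n zero    = ≤-refl
r²^≤1 n (suc k) = ≤-trans (Cauchy.*-monoˡ (r² n) (r²≥0 n) (r²^≤1 n k))
  (subst (_≤ 1ℚ) (sym (*-identityʳ (r² n))) (≤-trans (r²≤r n) (r≤1 n)))

r²^≤r : ∀ n k → r²^ n (suc k) ≤ r n
r²^≤r n k = ≤-trans (Cauchy.*-monoˡ (r² n) (r²≥0 n) (r²^≤1 n k)) (subst (_≤ r n) (sym (*-identityʳ (r² n))) (r²≤r n))

r-+-≤ : ∀ m d → r (m ℕ.+ d) ≤ r m
r-+-≤ m d = PartialSums./-mono (suc m) (suc (m ℕ.+ d)) (s≤s (ℕ.m≤m+n m d))

H-≤ : ∀ m d → H (m ℕ.+ d) - H m ≤ ι d * r m
H-≤ m zero    = ≤-reflexive (trans (cong (λ t → H t - H m) (ℕ.+-identityʳ m)) (cancel (H m) (r m)))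
  where
  cancel : ∀ a b → a - a ≡ 0ℚ * b
  cancel = solve-∀ ℚ-ring
H-≤ m (suc d) = begin
  H (m ℕ.+ suc d) - H m             ≡⟨ cong (λ t → H t - H m) (ℕ.+-suc m d) ⟩
  H (suc (m ℕ.+ d)) - H m           ≡⟨ cong (_- H m) (H-suc (m ℕ.+ d)) ⟩
  (H (m ℕ.+ d) + r (m ℕ.+ d)) - H m ≡⟨ swap (H (m ℕ.+ d)) (r (m ℕ.+ d)) (H m) ⟩
  (H (m ℕ.+ d) - H m) + r (m ℕ.+ d) ≤⟨ +-mono-≤ (H-≤ m d) (r-+-≤ m d) ⟩
  ι d * r m + r m                   ≡⟨ collect (ι d) (r m) ⟩
  (ι d + 1ℚ) * r m                  ≡⟨ cong (_* r m) (ι-suc d) ⟨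
  ι (suc d) * r m                   ∎
  where
  open ≤-Reasoning
  swap : ∀ a b c → (a + b) - c ≡ (a - c) + b
  swap = solve-∀ ℚ-ring
  collect : ∀ a b → a * b + b ≡ (a + 1ℚ) * b
  collect = solve-∀ ℚ-ring

H-≥ : ∀ m d → 0ℚ ≤ H (m ℕ.+ d) - H m
H-≥ m zero    = ≤-reflexive (sym (trans (cong (λ t → H t - H m) (ℕ.+-identityʳ m)) (+-inverseʳ (H m))))
H-≥ m (suc d) = subst (0ℚ ≤_) (trans (swap (H (m ℕ.+ d)) (r (m ℕ.+ d)) (H m)) (cong (_- H m) (trans (sym (H-suc (m ℕ.+ d))) (cong H (sym (ℕ.+-suc m d))))))
  (0≤-+ (H-≥ m d) (r≥0 (m ℕ.+ d)))
  where
  swap : ∀ a b c → (a - c) + b ≡ (a + b) - c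
  swap = solve-∀ ℚ-ring

gap≥0 : ∀ i m → 0ℚ ≤ gap i m
gap≥0 i m = 0≤-* (r≥0 i) (H-≥ m (double (suc i)))

-- The difference of harmonic numbers has 2(i+1) terms, each at most `r m`.
gap≤ : ∀ i m → gap i m ≤ 2ℚ * r m
gap≤ i m = begin
  r i * (H (opp i m) - H m)            ≤⟨ Cauchy.*-monoˡ (r i) (r≥0 i) (H-≤ m (double (suc i))) ⟩
  r i * (ι (double (suc i)) * r m)     ≡⟨ cong (λ t → r i * (t * r m)) (ι-double (suc i)) ⟩
  r i * ((L i + L i) * r m)            ≡⟨ factor (r i) (L i) (r m) ⟩
  L i * r i * (2ℚ * r m)               ≡⟨ cong (_* (2ℚ * r m)) (L*r i) ⟩
  1ℚ * (2ℚ * r m)                      ≡⟨ *-identityˡ _ ⟩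
  2ℚ * r m                             ∎
  where
  open ≤-Reasoning
  factor : ∀ r l m → r * ((l + l) * m) ≡ l * r * ((1ℚ + 1ℚ) * m)
  factor = solve-∀ ℚ-ring

r*r : ∀ i m n → i ℕ.+ m ≡ n → r i * r m ≡ r (suc n) * (r i + r m)
r*r i m n refl = begin
  r i * r m                                     ≡⟨ *-identityʳ _ ⟨
  r i * r m * 1ℚ                                ≡⟨ cong (r i * r m *_) (L*r (suc n)) ⟨
  r i * r m * (L (suc n) * r (suc n))           ≡⟨ cong (λ t → r i * r m * (t * r (suc n))) (L-top i m) ⟩
  r i * r m * ((L i + L m) * r (suc n))         ≡⟨ factor (r i) (r m) (L i) (L m) (r (suc n)) ⟩
  r (suc n) * ((L m * r m) * r i + (L i * r i) * r m) ≡⟨ cong₂ (λ s t → r (suc n) * (s * r i + t * r m)) (L*r m) (L*r i) ⟩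
  r (suc n) * (1ℚ * r i + 1ℚ * r m)             ≡⟨ cong₂ (λ s t → r (suc n) * (s + t)) (*-identityˡ (r i)) (*-identityˡ (r m)) ⟩
  r (suc n) * (r i + r m)                       ∎
  where
  open ≡-Reasoning
  factor : ∀ a b l m t → a * b * ((l + m) * t) ≡ t * ((m * b) * a + (l * a) * b)
  factor = solve-∀ ℚ-ring

Σ≤-r₀ : ∀ n → Σ≤ r n ≡ H (suc n)
Σ≤-r₀ n = trans (Σ≤-r 0 n) (+-identityʳ (H (suc n)))

error≥0 : ∀ k n → 0ℚ ≤ error k n
error≥0 k zero    = ≤-refl
error≥0 k (suc n) = diag-nonneg (λ i m → 0≤-* (r²^≥0 i (suc k)) (gap≥0 i m)) n

error≤ : ∀ k n → error k n ≤ 4ℚ * h/ 1 n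
error≤ k zero    = ≤-refl
error≤ k (suc n) = begin
  diag (λ i m → r²^ i (suc k) * gap i m) n
    ≤⟨ diag-≤ (λ i m → ≤-trans (Cauchy.*-monoʳ (gap i m) (gap≥0 i m) (r²^≤r i k)) (Cauchy.*-monoˡ (r i) (r≥0 i) (gap≤ i m))) n ⟩
  diag (λ i m → r i * (2ℚ * r m)) n
    ≡⟨ diag-cong′ n (λ i m eq → trans (swap (r i) (r m)) (trans (cong (2ℚ *_) (r*r i m n eq)) (sym (*-assoc 2ℚ (r (suc n)) _)))) ⟩
  diag (λ i m → 2ℚ * r (suc n) * (r i + r m)) n
    ≡⟨ trans (diag-scale (2ℚ * r (suc n)) (λ i m → r i + r m) n) (cong (2ℚ * r (suc n) *_) (diag-+ (λ i _ → r i) (λ _ m → r m) n)) ⟩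
  2ℚ * r (suc n) * (diag (λ i _ → r i) n + diag (λ _ m → r m) n)
    ≡⟨ cong₂ (λ s t → 2ℚ * r (suc n) * (s + t)) (trans (Σ≤-diag r n) (Σ≤-r₀ n)) (trans (diag-comm (λ _ m → r m) n) (trans (Σ≤-diag r n) (Σ≤-r₀ n))) ⟩
  2ℚ * r (suc n) * (H (suc n) + H (suc n))
    ≡⟨ collect (r (suc n)) (H (suc n)) ⟩
  4ℚ * H (suc n) * r (suc n)
    ≤⟨ Cauchy.*-monoˡ (4ℚ * H (suc n)) (0≤-* 0≤4ℚ (h≥0 1 (suc n))) (r-antitone n) ⟩
  4ℚ * H (suc n) * r n
    ≡⟨ *-assoc 4ℚ (H (suc n)) (r n) ⟩
  4ℚ * h/ 1 (suc n) ∎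
  where
  open ≤-Reasoning
  0≤4ℚ : 0ℚ ≤ 4ℚ
  0≤4ℚ = nonNegative⁻¹ 4ℚ
  swap : ∀ a b → a * ((1ℚ + 1ℚ) * b) ≡ (1ℚ + 1ℚ) * (a * b)
  swap = solve-∀ ℚ-ring
  collect : ∀ r h → (1ℚ + 1ℚ) * r * (h + h) ≡ (1ℚ + 1ℚ + (1ℚ + 1ℚ)) * h * r
  collect = solve-∀ ℚ-ring

small⇒null : ∀ {a} → (∀ n → 0ℚ ≤ a n) → Small a → Null a
small⇒null {a} nn small = mkNull λ e 0<e →
  let δ , 0<δ , δ+δ≡e = Cauchy.halve e 0<e
      N , q = small δ 0<δ
  in N , λ n l → subst₂ _<_ (sym (0≤p⇒∣p∣≡p (nn n))) δ+δ≡e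
    (≤-<-trans (q n l) (subst (_< δ + δ) (+-identityʳ δ) (+-monoʳ-< δ 0<δ)))

error-null : ∀ k → Null (error k)
error-null k = null-≤ (λ n → subst (_≤ 4ℚ * h/ 1 n) (sym (0≤p⇒∣p∣≡p (error≥0 k n))) (error≤ k n))
  (small⇒null (λ n → 0≤-* (nonNegative⁻¹ 4ℚ) (h/≥0 1 n)) (small-* 4ℚ (nonNegative⁻¹ 4ℚ) h/1-small))
  where
  h/1-small : Small (h/ 1)
  h/1-small e 0<e = let N , q = h/-small 1 e 0<e in suc N , λ { (suc n) (s≤s l) → q n l }

-- The ideal ζ(2)𝒵

open import Algebra.Properties.Ring Real.ring using (-‿distribˡ-*; -‿distribʳ-*; -‿+-comm)
open import Algebra.Properties.CommutativeSemigroup Real.+-commutativeSemigroup using (interchange)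

∑ᴿ-++ : ∀ rs ss → ∑ᴿ (rs ++ ss) ≈ᴿ ∑ᴿ rs ⊕ ∑ᴿ ss
∑ᴿ-++ []       ss = ≈-sym (Real.+-identityˡ _)
∑ᴿ-++ (r ∷ rs) ss = ≈-trans (≈-sym (⊕-≈ r (∑ᴿ (rs ++ ss)))) (≈-trans (⊕-cong ≈-refl (∑ᴿ-++ rs ss))
  (≈-trans (Real.sym (Real.+-assoc _ _ _)) (⊕-cong (⊕-≈ r (∑ᴿ rs)) ≈-refl)))

Summand : Set
Summand = ℚ × ∃ Admissible

summand : Summand → ℝ
summand (q , k , adm) = q *ₗᴿ ζ k adm

𝒵-resp : ∀ {a b} → a ≈ᴿ b → b ∈𝒵 → a ∈𝒵
𝒵-resp a≈b (ts , eq) = ts , ≈-trans a≈b eq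

𝒵-0 : 0ᴿ ∈𝒵
𝒵-0 = [] , ≈-refl

𝒵-⊕ : ∀ {a b} → a ∈𝒵 → b ∈𝒵 → (a ⊕ b) ∈𝒵
𝒵-⊕ (ts , eq) (us , eq′) = ts ++ us , ≈-trans (⊕-cong eq eq′)
  (≈-trans (≈-sym (∑ᴿ-++ (map summand ts) (map summand us))) (Real.reflexive (cong ∑ᴿ (sym (map-++ summand ts us)))))

𝒵-scale : ∀ q {a} → a ∈𝒵 → (fromℚ q ⊗ a) ∈𝒵
𝒵-scale q (ts , eq) = map scale ts , ≈-trans (⊗-cong ≈-refl eq) (go ts)
  where
  scale : Summand → Summand
  scale (q′ , k , adm) = q * q′ , k , adm
  go : ∀ ts → fromℚ q ⊗ ∑ᴿ (map summand ts) ≈ᴿ ∑ᴿ (map summand (map scale ts))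
  go []       = Real.zeroʳ _
  go ((q′ , k , adm) ∷ ts) = ≈-trans (⊗-cong ≈-refl (≈-sym (⊕-≈ (summand (q′ , k , adm)) (∑ᴿ (map summand ts)))))
    (≈-trans (Real.distribˡ _ _ _) (≈-trans (⊕-cong (pointwise λ n → trans (⊗-approx (fromℚ q) (summand (q′ , k , adm)) n) (sym (*-assoc q q′ (ζ≤ k n)))) (go ts))
      (⊕-≈ (summand (scale (q′ , k , adm))) _)))

𝒵-ζ : ∀ k adm → ζ k adm ∈𝒵
𝒵-ζ k adm = [ 1ℚ , k , adm ] , pointwise λ n → sym (trans (+-identityʳ (1ℚ * ζ≤ k n)) (*-identityˡ (ζ≤ k n)))

𝒵-1 : 1ᴿ ∈𝒵
𝒵-1 = 𝒵-resp (pointwise (λ _ → refl)) (𝒵-ζ [] empty)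

opaque
  unfolding _⊕_

  ⊖-scale : ∀ a → ⊖ a ≈ᴿ fromℚ (- 1ℚ) ⊗ a
  ⊖-scale a = pointwise λ n → negate (approx a n)
    where
    negate : ∀ a → - a ≡ - 1ℚ * a
    negate = solve-∀ ℚ-ring

  unscale : ∀ j s → fromℚ (- r j) ⊗ ⊖ (fromℚ (ι (suc j)) ⊗ s) ≈ᴿ s
  unscale j s = pointwise λ n → trans (rearrange (r j) (L j) (approx s n)) (trans (cong (_* approx s n) (L*r j)) (*-identityˡ (approx s n)))
    where
    rearrange : ∀ r l x → - r * - (l * x) ≡ l * r * x
    rearrange = solve-∀ ℚ-ring

𝒵-⊖ : ∀ {a} → a ∈𝒵 → (⊖ a) ∈𝒵
𝒵-⊖ a∈ = 𝒵-resp (⊖-scale _) (𝒵-scale (- 1ℚ) a∈)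

𝒵-⟨⟩ : ∀ F h → All (λ (q , w) → F w ∈𝒵) h → ⟨ F , h ⟩ ∈𝒵
𝒵-⟨⟩ F []            []       = 𝒵-0
𝒵-⟨⟩ F ((q , w) ∷ h) (p ∷ ps) = 𝒵-⊕ (𝒵-scale q p) (𝒵-⟨⟩ F h ps)

module Values {ψ} (char : ShuffleCharacter ψ) where
  open ShuffleCharacter char
  open Regularization char using (ψ-∙𝑦^)
  open Limits char
  open ≈ᴿ-Reasoning

  -- `ψ-∙𝑦^` is solved for the word with one more trailing y, all other words in it having only j of
  -- them after the last displayed x.
  𝒵-∙𝑦^ : ∀ j v → ψ ((ε ∙ 𝑦 · v) ∙ 𝑥 ∙𝑦^ j) ∈𝒵
  𝒵-∙𝑦^ zero    v = let k , adm , eq = admissible-z v in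
    𝒵-resp (≈-trans (Real.reflexive (cong ψ (sym eq))) (ψ-ζ k adm)) (𝒵-ζ k adm)
  𝒵-∙𝑦^ (suc j) v = 𝒵-resp (≈-trans (≈-sym (unscale j _)) (⊗-cong ≈-refl (≈-sym (ψ-∙𝑦^ v j))))
    (𝒵-scale (- r j) (𝒵-⟨⟩ (λ w → ψ (w ∙ 𝑥 ∙𝑦^ j)) _ (All.map (λ { (v , refl) → 𝒵-∙𝑦^ j v }) (Words.sh-startsY ε v))))

  -- not by with-abstraction, which would normalize the reals in the goal
  𝒵-zʷ : ∀ k → ψ (zʷ k) ∈𝒵
  𝒵-zʷ k = go (trailing-ones k)
    where
    then : ∀ l i b → Words.StartsY (zʷ l · z (1+ i)) → ψ (zʷ (l ++ (1+ suc i) ∷ ones b)) ∈𝒵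
    then l i b (v , eq) = 𝒵-resp (Real.reflexive (cong ψ (trans (zʷ-then-ones l i b) (cong (λ w → w ∙ 𝑥 ∙𝑦^ b) eq)))) (𝒵-∙𝑦^ b v)
    go : ∀ {k} → TrailingOnes k → ψ (zʷ k) ∈𝒵
    go (only-ones zero)    = 𝒵-resp ψ-ε 𝒵-1
    go (only-ones (suc b)) = 𝒵-resp (≈-trans (Real.reflexive (cong ψ (zʷ-ones (suc b)))) (ψ-𝑦^ b)) 𝒵-0
    go (then-ones l i b)   = then l i b (Words.Word¹-· (Words.foldl-word¹ l one) (Words.z-startsY (1+ i)))

  𝒵-word : ∀ {w} → Word¹ w → ψ w ∈𝒵
  𝒵-word one    = 𝒵-zʷ []
  𝒵-word (y· v) = let ks , k , eq = last-z v in subst (λ w → ψ w ∈𝒵) eq (𝒵-zʷ (ks ∷ʳ k))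

  𝒵-ζ⊗ζ : ∀ k adm l adm′ → (ζ k adm ⊗ ζ l adm′) ∈𝒵
  𝒵-ζ⊗ζ k adm l adm′ = 𝒵-resp (≈-trans (⊗-cong (≈-sym (ψ-ζ k adm)) (≈-sym (ψ-ζ l adm′))) (ψ-sh (zʷ-word¹ k) (zʷ-word¹ l)))
    (𝒵-⟨⟩ ψ _ (All.map 𝒵-word (Words.shʷ-word¹ (zʷ-word¹ k) (zʷ-word¹ l))))

  𝒵-⊗ : ∀ {a b} → a ∈𝒵 → b ∈𝒵 → (a ⊗ b) ∈𝒵
  𝒵-⊗ (ts , eq) (us , eq′) = 𝒵-resp (⊗-cong eq eq′) (go ts)
    where
    one-summand : ∀ k adm us → (ζ k adm ⊗ ∑ᴿ (map summand us)) ∈𝒵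
    one-summand k adm []                     = 𝒵-resp (Real.zeroʳ _) 𝒵-0
    one-summand k adm ((q , l , adm′) ∷ us) = 𝒵-resp
      (≈-trans (⊗-cong ≈-refl (≈-trans (≈-sym (⊕-≈ (summand (q , l , adm′)) (∑ᴿ (map summand us)))) (⊕-cong (≈-sym (⊗-≈ (fromℚ q) (ζ l adm′))) ≈-refl)))
        (≈-trans (Real.distribˡ _ _ _) (⊕-cong (≈-trans (≈-sym (Real.*-assoc _ _ _)) (≈-trans (⊗-cong (Real.*-comm _ _) ≈-refl) (Real.*-assoc _ _ _))) ≈-refl)))
      (𝒵-⊕ (𝒵-scale q (𝒵-ζ⊗ζ k adm l adm′)) (one-summand k adm us))
    go : ∀ ts → (∑ᴿ (map summand ts) ⊗ ∑ᴿ (map summand us)) ∈𝒵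
    go []                     = 𝒵-resp (Real.zeroˡ _) 𝒵-0
    go ((q , k , adm) ∷ ts) = 𝒵-resp
      (≈-trans (⊗-cong (≈-trans (≈-sym (⊕-≈ (summand (q , k , adm)) (∑ᴿ (map summand ts)))) (⊕-cong (≈-sym (⊗-≈ (fromℚ q) (ζ k adm))) ≈-refl)) ≈-refl)
        (≈-trans (Real.distribʳ _ _ _) (⊕-cong (Real.*-assoc _ _ _) ≈-refl)))
      (𝒵-⊕ (𝒵-scale q (one-summand k adm us)) (go ts))

  infix 4 _∈ζ[2]𝒵

  _∈ζ[2]𝒵 : ℝ → Set
  a ∈ζ[2]𝒵 = ∃ λ b → b ∈𝒵 × a ≈ᴿ ζ[2] ⊗ b

  ideal-resp : ∀ {a b} → a ≈ᴿ b → b ∈ζ[2]𝒵 → a ∈ζ[2]𝒵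
  ideal-resp a≈b (c , c∈ , eq) = c , c∈ , ≈-trans a≈b eq

  ideal-0 : 0ᴿ ∈ζ[2]𝒵
  ideal-0 = 0ᴿ , 𝒵-0 , ≈-sym (Real.zeroʳ _)

  ideal-⊕ : ∀ {a b} → a ∈ζ[2]𝒵 → b ∈ζ[2]𝒵 → a ⊕ b ∈ζ[2]𝒵
  ideal-⊕ (c , c∈ , eq) (d , d∈ , eq′) = c ⊕ d , 𝒵-⊕ c∈ d∈ , ≈-trans (⊕-cong eq eq′) (≈-sym (Real.distribˡ _ _ _))

  ideal-⊗ : ∀ {a b} → a ∈𝒵 → b ∈ζ[2]𝒵 → a ⊗ b ∈ζ[2]𝒵
  ideal-⊗ {a} a∈ (c , c∈ , eq) = a ⊗ c , 𝒵-⊗ a∈ c∈ , ≈-trans (⊗-cong ≈-refl eq)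
    (≈-trans (≈-sym (Real.*-assoc _ _ _)) (≈-trans (⊗-cong (Real.*-comm _ _) ≈-refl) (Real.*-assoc _ _ _)))

  𝒵-fromℚ : ∀ q → fromℚ q ∈𝒵
  𝒵-fromℚ q = 𝒵-resp (≈-sym (Real.*-identityʳ _)) (𝒵-scale q 𝒵-1)

  ideal-⊖ : ∀ {a} → a ∈ζ[2]𝒵 → ⊖ a ∈ζ[2]𝒵
  ideal-⊖ a∈ = ideal-resp (⊖-scale _) (ideal-⊗ (𝒵-fromℚ (- 1ℚ)) a∈)

  ideal⊂𝒵 : ∀ {a} → a ∈ζ[2]𝒵 → a ∈𝒵
  ideal⊂𝒵 (c , c∈ , eq) = 𝒵-resp eq (𝒵-⊗ (𝒵-ζ [ 1+ 1 ] (last≥2 [] (s≤s (s≤s z≤n)))) c∈)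

  -- Carrying the limit along with the sequence lets the truncated identities be used directly,
  -- without a separate real identity for each.
  LimIn : (ℝ → Set) → (ℕ → ℚ) → Set
  LimIn S a = ∃ λ l → S l × a ⟶ l

  Lim𝒵 Limζ[2]𝒵 : (ℕ → ℚ) → Set
  Lim𝒵     = LimIn _∈𝒵
  Limζ[2]𝒵 = LimIn _∈ζ[2]𝒵

  lim-cong : ∀ {S a b} → (∀ n → a n ≡ b n) → LimIn S a → LimIn S b
  lim-cong eq (l , l∈ , a⟶l) = l , l∈ , ⟶-cong eq a⟶l

  lim-0 : Limζ[2]𝒵 (λ _ → 0ℚ)
  lim-0 = 0ᴿ , ideal-0 , ⟶-const 0ℚ

  lim-+ : ∀ {a b} → Limζ[2]𝒵 a → Limζ[2]𝒵 b → Limζ[2]𝒵 (λ n → a n + b n)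
  lim-+ (l , l∈ , a⟶l) (m , m∈ , b⟶m) = l ⊕ m , ideal-⊕ l∈ m∈ , ⟶-⊕ a⟶l b⟶m

  lim-* : ∀ {a b} → Lim𝒵 a → Limζ[2]𝒵 b → Limζ[2]𝒵 (λ n → a n * b n)
  lim-* (l , l∈ , a⟶l) (m , m∈ , b⟶m) = l ⊗ m , ideal-⊗ l∈ m∈ , ⟶-⊗ a⟶l b⟶m

  lim-scale : ∀ q {a} → Limζ[2]𝒵 a → Limζ[2]𝒵 (λ n → q * a n)
  lim-scale q = lim-* (fromℚ q , 𝒵-fromℚ q , ⟶-const q)

  lim-𝒵 : ∀ {a} → Limζ[2]𝒵 a → Lim𝒵 a
  lim-𝒵 (l , l∈ , a⟶l) = l , ideal⊂𝒵 l∈ , a⟶l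

  lim-diag : ∀ (f : ℕ → ℕ → ℕ → ℚ) k → (∀ i j → i ℕ.+ j ≡ k → Limζ[2]𝒵 (f i j)) → Limζ[2]𝒵 (λ n → diag (λ i j → f i j n) k)
  lim-diag f zero    p = p 0 0 refl
  lim-diag f (suc k) p = lim-+ (p 0 (suc k) refl) (lim-diag (f ∘ suc) k (λ i j eq → p (suc i) j (cong suc eq)))

  p-zero-lim : Limζ[2]𝒵 (p 0)
  p-zero-lim = ζ[2] , (1ᴿ , 𝒵-1 , ≈-sym (Real.*-identityʳ _)) , ⟶-approx ζ[2]

  -- The bound `k` makes the strong induction structural. `williams` at `i` expresses `p (suc i)`
  -- through products with both indices at most `i` and a null sequence.
  p-lim≤ : ∀ k i → i ℕ.≤ k → Limζ[2]𝒵 (p i)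
  p-lim≤ k       zero    _ = p-zero-lim
  p-lim≤ (suc k) (suc i) (s≤s i≤k) = lim-cong solve-p (lim-scale ρ (lim-+ (lim-scale 2ℚ squares) (lim-scale 2ℚ (0ᴿ , ideal-0 , error⟶0))))
    where
    -- This is 1/(2i+5), the inverse of the coefficient in `williams`.
    ρ = r (4 ℕ.+ (i ℕ.+ i))
    squares : Limζ[2]𝒵 (λ n → conv (λ i → p i n) (λ j → p j n) i)
    squares = lim-diag (λ i j n → p i n * p j n) i λ a b eq → lim-*
      (lim-𝒵 (p-lim≤ k a (ℕ.≤-trans (subst (a ℕ.≤_) eq (ℕ.m≤m+n a b)) i≤k)))
      (p-lim≤ k b (ℕ.≤-trans (subst (b ℕ.≤_) eq (ℕ.m≤n+m b a)) i≤k))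
    error⟶0 : error i ⟶ 0ᴿ
    error⟶0 = lim (null-cong (λ n → sym (+-identityʳ (error i n))) (error-null i))
    L≡ : L (4 ℕ.+ (i ℕ.+ i)) ≡ 2ℚ * ι i + 5ℚ
    L≡ = trans (ι-+ 5 (i ℕ.+ i)) (trans (cong (ι 5 +_) (ι-+ i i)) (rearrange (ι i)))
      where
      rearrange : ∀ a → (1ℚ + 1ℚ + (1ℚ + 1ℚ) + 1ℚ) + (a + a) ≡ (1ℚ + 1ℚ) * a + (1ℚ + 1ℚ + (1ℚ + 1ℚ) + 1ℚ)
      rearrange = solve-∀ ℚ-ring
    solve-p : ∀ n → ρ * (2ℚ * conv (λ i → p i n) (λ j → p j n) i + 2ℚ * error i n) ≡ p (suc i) n
    solve-p n = trans (*-comm ρ total) (sym (divide-L (4 ℕ.+ (i ℕ.+ i)) (p (suc i) n) total (trans (cong (_* p (suc i) n) L≡) (sym (williams i n)))))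
      where total = 2ℚ * conv (λ i → p i n) (λ j → p j n) i + 2ℚ * error i n

  p-lim : ∀ i → Limζ[2]𝒵 (p i)
  p-lim i = p-lim≤ i i ℕ.≤-refl

  -- `newton` divided by i + 1. Every term of it contains a power sum, which lies in the ideal even
  -- where the other factor is `y 0`, that is 1.
  y-lim≤ : ∀ k i → i ℕ.≤ k → Limζ[2]𝒵 (y (suc i))
  y-lim≤ k i i≤k = lim-cong solve-y (lim-scale (r i) (lim-diag (λ a b n → p a n * y b n) i λ a b eq → product a b eq k i≤k))
    where
    product : ∀ a b → a ℕ.+ b ≡ i → ∀ k → i ℕ.≤ k → Limζ[2]𝒵 (λ n → p a n * y b n)
    product a zero    eq k i≤k = lim-cong (λ n → sym (*-identityʳ (p a n))) (p-lim a)
    product a (suc b) eq (suc k) i≤k = lim-* (lim-𝒵 (p-lim a)) (y-lim≤ k b (ℕ.≤-pred (ℕ.≤-trans (subst (suc b ℕ.≤_) eq (ℕ.m≤n+m (suc b) a)) i≤k)))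
    product a (suc b) eq zero    i≤k = case trans (sym (ℕ.+-suc a b)) (trans eq (ℕ.n≤0⇒n≡0 i≤k)) of λ ()
    solve-y : ∀ n → r i * conv (λ a → p a n) (λ b → y b n) i ≡ y (suc i) n
    solve-y n = trans (*-comm (r i) _) (sym (divide-L i (y (suc i) n) (conv (λ a → p a n) (λ b → y b n) i) (newton n i)))

  Y-lim : ∀ m → Limζ[2]𝒵 (λ n → Y n (suc m))
  Y-lim m = go m (parity m)
    where
    parity : ∀ m → ∃ λ i → m ≡ double i ⊎ m ≡ suc (double i)
    parity zero    = 0 , inj₁ refl
    parity (suc m) with parity m
    ... | i , inj₁ eq = i , inj₂ (cong suc eq)
    ... | i , inj₂ eq = suc i , inj₁ (cong suc eq)
    go : ∀ m → (∃ λ i → m ≡ double i ⊎ m ≡ suc (double i)) → Limζ[2]𝒵 (λ n → Y n (suc m))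
    go _ (i , inj₁ refl) = lim-cong (λ n → sym (Y-odd n i)) lim-0
    go _ (i , inj₂ refl) = lim-cong (λ n → sym (Y-even n (suc i))) (y-lim≤ i i ℕ.≤-refl)

  on-Y-lim : ∀ k ks → Limζ[2]𝒵 (λ n → on (Y n) (k ∷ ks))
  on-Y-lim k ks = go (trailing-ones (k ∷ ks)) refl
    where
    go : ∀ {l} → TrailingOnes l → k ∷ ks ≡ l → Limζ[2]𝒵 (λ n → on (Y n) (k ∷ ks))
    go (only-ones (suc b))  refl = lim-cong (λ n → sym (on-ones (Y n) (suc b))) (Y-lim b)
    go (then-ones l i b) eq   = lim-cong (λ n → sym (trans (cong (on (Y n)) eq) (on-big (Y n) l i b))) lim-0

  -- Comparison of the two star values

  infixl 7 _✶ᴿ_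

  _✶ᴿ_ : (Index → ℝ) → (Index → ℝ) → Index → ℝ
  _✶ᴿ_ = convolve _⊕_ _⊗_

  ⟶-✶ : ∀ {f g : ℕ → Index → ℚ} {F F′} → (∀ k → (λ n → f n k) ⟶ F k) → (∀ k → (λ n → g n k) ⟶ F′ k) →
        ∀ k → (λ n → (f n ✶ g n) k) ⟶ (F ✶ᴿ F′) k
  ⟶-✶ f⟶ g⟶ []       = ⟶-⊗ (f⟶ []) (g⟶ [])
  ⟶-✶ f⟶ g⟶ (k ∷ ks) = ⟶-⊕ (⟶-⊗ (f⟶ []) (g⟶ (k ∷ ks))) (⟶-✶ (f⟶ ∘ (k ∷_)) g⟶ ks)

  ζ⋆ : Index → ℝ
  ζ⋆ k = ∑ᴿ (map (λ l → ψ (zʷ l)) (contractions k))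

  ⟶-C⁺ : ∀ {f : ℕ → Index → ℚ} {F : Index → ℝ} → (∀ k → (λ n → f n k) ⟶ F k) →
         ∀ k ls → (λ n → C⁺ (f n) k ls) ⟶ ∑ᴿ (map F (contractions⁺ k ls))
  ⟶-C⁺ {F = F} f⟶ k []       = ⟶-resp (f⟶ [ k ]) (pointwise λ n → sym (+-identityʳ (approx (F [ k ]) n)))
  ⟶-C⁺ {F = F} f⟶ k (l ∷ ls) = ⟶-resp (⟶-⊕ (⟶-C⁺ (f⟶ ∘ (k ∷_)) l ls) (⟶-C⁺ f⟶ (k +⁺ l) ls))
    (≈-sym (≈-trans (Real.reflexive (cong ∑ᴿ (trans (map-++ F (map (k ∷_) (contractions⁺ l ls)) (contractions⁺ (k +⁺ l) ls)) (cong (_++ map F (contractions⁺ (k +⁺ l) ls)) (sym (map-∘ (contractions⁺ l ls)))))))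
      (∑ᴿ-++ (map (F ∘ (k ∷_)) (contractions⁺ l ls)) _)))

  C-s⟶ζ⋆ : ∀ k → (λ n → C (s n) k) ⟶ ζ⋆ k
  C-s⟶ζ⋆ []       = ⟶-resp (s⟶ψ []) (pointwise λ n → sym (+-identityʳ (approx (ψ ε) n)))
  C-s⟶ζ⋆ (k ∷ ks) = ⟶-C⁺ s⟶ψ k ks

  -- Rψ t k = (-1)ʳ ψ(z_{kᵣ} ⋯ z_{k₁} z_t)
  Rψ : Index → Index → ℝ
  Rψ t []       = ψ (zʷ t)
  Rψ t (k ∷ ks) = ⊖ Rψ (k ∷ t) ks

  R-s⟶Rψ : ∀ t k → (λ n → R (λ l → s n (l ++ t)) k) ⟶ Rψ t k
  R-s⟶Rψ t []       = s⟶ψ t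
  R-s⟶Rψ t (k ∷ ks) = ⟶-⊖ (⟶-cong (λ n → R-cong (λ l → cong (s n) (sym (++-assoc l [ k ] t))) ks) (R-s⟶Rψ (k ∷ t) ks))

  -- Uniqueness of limits: by `R-s-C-s` the same sequence is `on (Y n) (k ∷ ks)`, which is 0 or a
  -- coefficient of positive degree.
  Rψ-✶-ζ⋆ : ∀ k ks → (Rψ [] ✶ᴿ ζ⋆) (k ∷ ks) ∈ζ[2]𝒵
  Rψ-✶-ζ⋆ k ks = let l , l∈ , Y⟶l = on-Y-lim k ks in ideal-resp (⟶-unique
    (⟶-✶ {f = λ n → R (s n)} (λ l → ⟶-cong (λ n → R-cong (λ m → cong (s n) (++-identityʳ m)) l) (R-s⟶Rψ [] l)) C-s⟶ζ⋆ (k ∷ ks))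
    (⟶-cong (λ n → sym (R-s-C-s n (k ∷ ks))) Y⟶l)) l∈

  ⊖-✶ : ∀ F H k → ((λ l → ⊖ F l) ✶ᴿ H) k ≈ᴿ ⊖ (F ✶ᴿ H) k
  ⊖-✶ F H []       = Real.sym (-‿distribˡ-* _ _)
  ⊖-✶ F H (k ∷ ks) = ≈-trans (⊕-cong (Real.sym (-‿distribˡ-* _ _)) (⊖-✶ (F ∘ (k ∷_)) H ks)) (-‿+-comm _ _)

  -- Unrolling the recursion of `K` stacks the columns of an initial segment, with a sign for each,
  -- and multiplies by `KY` on the remaining suffix.
  K-Rψ : ∀ ks t → K ψ t ks ≈ᴿ (Rψ t ✶ᴿ KY ψ) ks
  K-Rψ []       t = ≈-sym (Real.*-identityʳ _)
  K-Rψ (k ∷ ks) t = ⊕-cong ≈-refl (≈-trans (⊖-cong (K-Rψ ks (k ∷ t))) (≈-sym (⊖-✶ (Rψ (k ∷ t)) (KY ψ) ks)))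

  -- With an empty chain the two terms in the recursion of `K` coincide, since ψ(1) = 1.
  Rψ-✶-KY : ∀ k ks → (Rψ [] ✶ᴿ KY ψ) (k ∷ ks) ≈ᴿ 0ᴿ
  Rψ-✶-KY k ks = ≈-trans (≈-sym (K-Rψ (k ∷ ks) [])) (≈-trans (⊕-cong (≈-trans (⊗-cong ψ-ε ≈-refl) (Real.*-identityˡ _)) ≈-refl) (Real.-‿inverseʳ _))

  Rψ∈𝒵 : ∀ t k → Rψ t k ∈𝒵
  Rψ∈𝒵 t []       = 𝒵-zʷ t
  Rψ∈𝒵 t (k ∷ ks) = 𝒵-⊖ (Rψ∈𝒵 (k ∷ t) ks)

  d : Index → ℝ
  d k = ζ⋆ k ⊕ ⊖ KY ψ k

  -- The convolution involves `d` on every suffix, so the induction carries all of them.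
  OnSuffixes : Index → Set
  OnSuffixes []       = d [] ∈ζ[2]𝒵
  OnSuffixes (k ∷ ks) = d (k ∷ ks) ∈ζ[2]𝒵 × OnSuffixes ks

  factor : ∀ a b c → a ⊗ b ⊕ ⊖ (a ⊗ c) ≈ᴿ a ⊗ (b ⊕ ⊖ c)
  factor a b c = ≈-trans (⊕-cong ≈-refl (-‿distribʳ-* a c)) (≈-sym (Real.distribˡ _ _ _))

  rearrange : ∀ a b c e f → (a ⊗ b ⊕ e) ⊕ ⊖ (a ⊗ c ⊕ f) ≈ᴿ a ⊗ (b ⊕ ⊖ c) ⊕ (e ⊕ ⊖ f)
  rearrange a b c e f = ≈-trans (⊕-cong ≈-refl (≈-sym (-‿+-comm _ _))) (≈-trans (interchange _ _ _ _) (⊕-cong (factor a b c) ≈-refl))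

  ✶-difference : ∀ F → (∀ k → F k ∈𝒵) → ∀ k → OnSuffixes k → (F ✶ᴿ ζ⋆) k ⊕ ⊖ (F ✶ᴿ KY ψ) k ∈ζ[2]𝒵
  ✶-difference F F∈ []       d∈        = ideal-resp (factor _ _ _) (ideal-⊗ (F∈ []) d∈)
  ✶-difference F F∈ (k ∷ ks) (d∈ , ds) = ideal-resp (rearrange _ _ _ _ _)
    (ideal-⊕ (ideal-⊗ (F∈ []) d∈) (✶-difference (F ∘ (k ∷_)) (F∈ ∘ (k ∷_)) ks ds))

  d∈ζ[2]𝒵 : ∀ k → OnSuffixes k
  d∈ζ[2]𝒵 [] = ideal-resp (≈-trans (⊕-cong (≈-trans (pointwise λ n → +-identityʳ (approx (ψ ε) n)) ψ-ε) ≈-refl) (Real.-‿inverseʳ _)) ideal-0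
  -- In the difference of the two convolutions `d (k ∷ ks)` has the coefficient ψ(1) = 1 and can be
  -- solved for; `rest` involves proper suffixes only.
  d∈ζ[2]𝒵 (k ∷ ks) = ideal-resp (begin
      d (k ∷ ks)
        ≈⟨ Real.*-identityˡ _ ⟨
      1ᴿ ⊗ d (k ∷ ks)
        ≈⟨ ⊗-cong ψ-ε ≈-refl ⟨
      Rψ [] [] ⊗ d (k ∷ ks)
        ≈⟨ Real.+-identityʳ _ ⟨
      Rψ [] [] ⊗ d (k ∷ ks) ⊕ 0ᴿ
        ≈⟨ ⊕-cong ≈-refl (Real.-‿inverseʳ rest) ⟨
      Rψ [] [] ⊗ d (k ∷ ks) ⊕ (rest ⊕ ⊖ rest)
        ≈⟨ Real.+-assoc _ _ _ ⟨
      (Rψ [] [] ⊗ d (k ∷ ks) ⊕ rest) ⊕ ⊖ rest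
        ≈⟨ ⊕-cong (rearrange _ _ _ _ _) ≈-refl ⟨
      ((Rψ [] ✶ᴿ ζ⋆) (k ∷ ks) ⊕ ⊖ (Rψ [] ✶ᴿ KY ψ) (k ∷ ks)) ⊕ ⊖ rest ∎)
    (ideal-⊕ (ideal-⊕ (Rψ-✶-ζ⋆ k ks) (ideal-resp (⊖-cong (Rψ-✶-KY k ks)) (ideal-⊖ ideal-0)))
      (ideal-⊖ (✶-difference (Rψ [] ∘ (k ∷_)) (Rψ∈𝒵 [] ∘ (k ∷_)) ks ih)))
    , ih
    where
    ih = d∈ζ[2]𝒵 ks
    rest = ((Rψ [] ∘ (k ∷_)) ✶ᴿ ζ⋆) ks ⊕ ⊖ ((Rψ [] ∘ (k ∷_)) ✶ᴿ KY ψ) ks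

  d∈ : ∀ k → d k ∈ζ[2]𝒵
  d∈ []       = d∈ζ[2]𝒵 []
  d∈ (k ∷ ks) = proj₁ (d∈ζ[2]𝒵 (k ∷ ks))

theorem2p1 :
    (Z : 𝔥⁰ → ℝ) → IsZ Z →
    (Zˢʰ : 𝔥¹ → ℝ[T]) → IsShuffleRegularization Z Zˢʰ →
    (k : Index) → ζ⋆ˢʰ Zˢʰ k ≡ᴿ ζ⋆ᴷʸ Zˢʰ k mod-ζ[2]𝒵
theorem2p1 Z isZ Zˢʰ isReg k = conclude (Values.d∈ isShuffleCharacter k)
  where
  open Restrict Z isZ Zˢʰ isReg
  open Values isShuffleCharacter using (d; _∈ζ[2]𝒵)
  open ≈ᴿ-Reasoning

  star : ∀ ls → ∑ᴿ (map (ζˢʰ Zˢʰ) ls) ≈ᴿ ∑ᴿ (map (λ l → ψ (zʷ l)) ls)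
  star []       = ≈-refl
  star (l ∷ ls) = begin
    ζˢʰ Zˢʰ l +ᴿ ∑ᴿ (map (ζˢʰ Zˢʰ) ls)            ≈⟨ ⊕-≈ (ζˢʰ Zˢʰ l) (∑ᴿ (map (ζˢʰ Zˢʰ) ls)) ⟨
    ζˢʰ Zˢʰ l ⊕ ∑ᴿ (map (ζˢʰ Zˢʰ) ls)             ≈⟨ ⊕-cong (ζˢʰ-ψ l) (star ls) ⟩
    ψ (zʷ l) ⊕ ∑ᴿ (map (λ l → ψ (zʷ l)) ls)       ≈⟨ ⊕-≈ (ψ (zʷ l)) (∑ᴿ (map (λ l → ψ (zʷ l)) ls)) ⟩
    ψ (zʷ l) +ᴿ ∑ᴿ (map (λ l → ψ (zʷ l)) ls)      ∎

  conclude : d k ∈ζ[2]𝒵 → ζ⋆ˢʰ Zˢʰ k ≡ᴿ ζ⋆ᴷʸ Zˢʰ k mod-ζ[2]𝒵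
  conclude (b , b∈ , eq) = b , b∈ , (begin
    ζ⋆ˢʰ Zˢʰ k -ᴿ ζ⋆ᴷʸ Zˢʰ k
      ≈⟨ ⊕-≈ (ζ⋆ˢʰ Zˢʰ k) (-ᴿ ζ⋆ᴷʸ Zˢʰ k) ⟨
    ζ⋆ˢʰ Zˢʰ k ⊕ -ᴿ ζ⋆ᴷʸ Zˢʰ k
      ≈⟨ ⊕-cong (star (contractions k)) (≈-trans (≈-sym (⊖-≈ (ζ⋆ᴷʸ Zˢʰ k))) (⊖-cong (≈-trans (ζ⋆ᴷʸ-ψ k) (⟨⟩-w⋆ isShuffleCharacter k)))) ⟩
    d k
      ≈⟨ eq ⟩
    ζ[2] ⊗ b
      ≈⟨ ⊗-≈ ζ[2] b ⟩
    ζ[2] *ᴿ b ∎)
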